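{- Let $\mathbf{d}=(d_1,\ldots,d_n)$ be a degree sequence with $M=\sum_{i=1}^n d_i$ even and $\Delta^2=o(M)$, where $\Delta=\max_i d_i$, and let $\mathcal{G}(n,\mathbf{d})$ be a uniformly random graph on $[n]$ with degree sequence $\mathbf{d}$. Let $H_1,H_2$ be graphs on $[n]$ with no common edge, such that $d_i^{H_1}\le d_i$ for all $i$ and the maximum degree of $H_2$ is $O(\Delta)$. Let $\widetilde{d}_i=d_i-d_i^{H_1}$, $\widetilde{M}=\sum_i \widetilde{d}_i$ and $\widetilde{M}_2=\sum_i \widetilde{d}_i(\widetilde{d}_i-1)$, and suppose $\widetilde{M}=\Omega(M)$. Let $u\ne v$ with $uv\notin H_1\cup H_2$. Then \begin{align*} &\mathbb{P}\big(uv\in\mathcal{G}(n,\mathbf{d})\mid H_1\subseteq \mathcal{G}(n,\mathbf{d}),\ H_2\cap \mathcal{G}(n,\mathbf{d})=\emptyset\big)\\ &=\left(1+O\left(\frac{\Delta^5n}{M^3}\right)\right)\frac{\widetilde{d}_u\widetilde{d}_v}{\widetilde{M}}\left(1-\frac{\widetilde{M}_2^2}{\widetilde{M}^3}-\frac{\widetilde{M}_2}{\widetilde{M}^2}-\sum_{(x,y)\in \mathcal{W}} \frac{\widetilde{d}_x\widetilde{d}_y}{\widetilde{M}^2} \right)\left(1-\frac{\bar\phi(uv)}{M-2|H_1|}\right), \end{align*} where \[ \bar\phi(uv)=-2(\widetilde{d}_u+\widetilde{d}_v)+2-\sum_{x\in \mathcal{N}_{H_1\cup H_2}(u)} \widetilde{d}_x-\sum_{y\in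 \mathcal{N}_{H_1\cup H_2}(v)} \widetilde{d}_y-\frac{(\widetilde{d}_u+\widetilde{d}_v-2)\widetilde{M}_2}{\widetilde{M}} +\widetilde{d}_u\widetilde{d}_v , \] and $\mathcal{W}$ is the set of ordered pairs $(x,y)$ such that $xy\in H_1\cup H_2$, $xu\notin H_1\cup H_2$, $yv\notin H_1\cup H_2$, and $\{x,y\}\cap\{u,v\}=\emptyset$.
   Context: $d_i^{H_1}$ is the degree of $i$ in $H_1$, $|H_1|$ the number of edges of $H_1$, and $\mathcal{N}_{G}(u)$ the set of neighbours of $u$ in graph $G$. Asymptotics are as $n\to\infty$, uniformly in all objects satisfying the hypotheses. -}

module Defs where

open import Data.Bool using (Bool; true; false; _∧_; _∨_; not; if_then_else_; T)
open import Data.Nat as ℕ using (ℕ; zero; suc; _∸_)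
open import Data.Fin using (Fin; toℕ)
open import Data.Vec using (Vec; lookup; []; _∷_)
open import Data.List using (List; []; _∷_; map; foldr; concatMap; allFin; length; filter)
open import Data.Product using (_×_; _,_)
open import Data.Integer using (+_)
open import Data.Rational as ℚ using (ℚ; 0ℚ; _÷_; ≢-nonZero)
open import Data.Rational.Properties using (_≟_)
open import Relation.Nullary using (yes; no)
open import Relation.Binary.PropositionalEquality using (_≡_)

Adj : ℕ → Set
Adj n = Vec (Vec Bool n) n

edge : ∀ {n} → Adj n → Fin n → Fin n → Bool
edge A i j = lookup (lookup A i) j

pairs : ∀ n → List (Fin n × Fin n)
pairs n = concatMap (λ i → map (λ j → (i , j)) (allFin n)) (allFin n)

allB : ∀ {A : Set} → (A → Bool) → List A → Bool
allB p = foldr (λ x b → p x ∧ b) true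

countTrue : List Bool → ℕ
countTrue = foldr (λ b k → if b then suc k else k) 0

isSimple : ∀ {n} → Adj n → Bool
isSimple {n} A =
  allB (λ { (i , j) → (not (edge A i j) ∨ edge A j i) }) (pairs n)
  ∧ allB (λ i → not (edge A i i)) (allFin n)

IsSimple : ∀ {n} → Adj n → Set
IsSimple A = T (isSimple A)

deg : ∀ {n} → Adj n → Fin n → ℕ
deg {n} A i = countTrue (map (edge A i) (allFin n))

numEdges : ∀ {n} → Adj n → ℕ
numEdges {n} A =
  countTrue (map (λ { (i , j) → (toℕ i ℕ.<ᵇ toℕ j) ∧ edge A i j }) (pairs n))

maxOf : ∀ {n} → (Fin n → ℕ) → ℕ
maxOf {n} f = foldr ℕ._⊔_ 0 (map f (allFin n))

maxDeg : ∀ {n} → Adj n → ℕ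
maxDeg A = maxOf (deg A)

sumℕ : ∀ {n} → (Fin n → ℕ) → ℕ
sumℕ {n} f = foldr ℕ._+_ 0 (map f (allFin n))

zipOr : ∀ {m} → Vec Bool m → Vec Bool m → Vec Bool m
zipOr [] [] = []
zipOr (x ∷ xs) (y ∷ ys) = (x ∨ y) ∷ zipOr xs ys

unionRows : ∀ {m k} → Vec (Vec Bool m) k → Vec (Vec Bool m) k → Vec (Vec Bool m) k
unionRows [] [] = []
unionRows (r ∷ A) (s ∷ B) = zipOr r s ∷ unionRows A B

_∪G_ : ∀ {n} → Adj n → Adj n → Adj n
A ∪G B = unionRows A B

subgraph : ∀ {n} → Adj n → Adj n → Bool
subgraph {n} H G = allB (λ { (i , j) → not (edge H i j) ∨ edge G i j }) (pairs n)

disjoint : ∀ {n} → Adj n → Adj n → Bool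
disjoint {n} H G = allB (λ { (i , j) → not (edge H i j ∧ edge G i j) }) (pairs n)

hasDegrees : ∀ {n} → Adj n → (Fin n → ℕ) → Bool
hasDegrees {n} G d = allB (λ i → deg G i ℕ.≡ᵇ d i) (allFin n)

-- Enumeration of all n×n Boolean matrices; the uniform random graph
-- G(n,d) is uniform over those which are simple with degree sequence d.

allVecs : ∀ {A : Set} → List A → (m : ℕ) → List (Vec A m)
allVecs xs zero = [] ∷ []
allVecs xs (suc m) = concatMap (λ x → map (x ∷_) (allVecs xs m)) xs

allAdj : ∀ n → List (Adj n)
allAdj n = allVecs (allVecs (true ∷ false ∷ []) n) n

countGraphs : ∀ n → (Fin n → ℕ) → (Adj n → Bool) → ℕ
countGraphs n d p =
  countTrue (map (λ G → isSimple G ∧ hasDegrees G d ∧ p G) (allAdj n))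

ℕtoℚ : ℕ → ℚ
ℕtoℚ k = (+ k) ℚ./ 1

-- total division, with the convention x / 0 = 0
_÷'_ : ℚ → ℚ → ℚ
p ÷' q with q ≟ 0ℚ
... | yes _ = 0ℚ
... | no q≢0 = _÷_ p q {{≢-nonZero q≢0}}

sumℚ : ∀ {A : Set} → (A → ℚ) → List A → ℚ
sumℚ f = foldr (λ x s → f x ℚ.+ s) 0ℚ

condEvent : ∀ {n} → Adj n → Adj n → Adj n → Bool
condEvent H₁ H₂ G = subgraph H₁ G ∧ disjoint H₂ G

condCount : ∀ n → (Fin n → ℕ) → Adj n → Adj n → ℕ
condCount n d H₁ H₂ = countGraphs n d (condEvent H₁ H₂)

condProb : ∀ n → (Fin n → ℕ) → Adj n → Adj n → Fin n → Fin n → ℚ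
condProb n d H₁ H₂ u v =
  ℕtoℚ (countGraphs n d (λ G → condEvent H₁ H₂ G ∧ edge G u v))
  ÷' ℕtoℚ (condCount n d H₁ H₂)

module Quantities {n : ℕ} (d : Fin n → ℕ) (H₁ H₂ : Adj n) (u v : Fin n) where

  M : ℕ
  M = sumℕ d

  Δ : ℕ
  Δ = maxOf d

  dt : Fin n → ℕ
  dt i = d i ∸ deg H₁ i

  Mt : ℕ
  Mt = sumℕ dt

  Mt₂ : ℕ
  Mt₂ = sumℕ (λ i → dt i ℕ.* (dt i ∸ 1))

  H : Adj n
  H = H₁ ∪G H₂

  q : ℕ → ℚ
  q = ℕtoℚ

  qdt : Fin n → ℚ
  qdt i = q (dt i)

  nbrSum : Fin n → ℚ
  nbrSum w = sumℚ (λ x → if edge H w x then qdt x else 0ℚ) (allFin n)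

  inW : Fin n × Fin n → Bool
  inW (x , y) = edge H x y ∧ not (edge H x u) ∧ not (edge H y v)
    ∧ not (toℕ x ℕ.≡ᵇ toℕ u) ∧ not (toℕ x ℕ.≡ᵇ toℕ v)
    ∧ not (toℕ y ℕ.≡ᵇ toℕ u) ∧ not (toℕ y ℕ.≡ᵇ toℕ v)

  Wsum : ℚ
  Wsum = sumℚ (λ p → if inW p then
                       (qdt (Data.Product.proj₁ p) ℚ.* qdt (Data.Product.proj₂ p))
                         ÷' (q Mt ℚ.* q Mt)
                     else 0ℚ) (pairs n)

  φbar : ℚ
  φbar = ((((ℚ.- (q 2 ℚ.* (qdt u ℚ.+ qdt v))) ℚ.+ q 2)
           ℚ.- nbrSum u) ℚ.- nbrSum v)
         ℚ.- (((qdt u ℚ.+ qdt v) ℚ.- q 2) ℚ.* q Mt₂) ÷' q Mt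
         ℚ.+ qdt u ℚ.* qdt v

  mainTerm : ℚ
  mainTerm =
    ((qdt u ℚ.* qdt v) ÷' q Mt)
    ℚ.* ((((ℚ.1ℚ ℚ.- (q Mt₂ ℚ.* q Mt₂) ÷' (q Mt ℚ.* q Mt ℚ.* q Mt))
            ℚ.- q Mt₂ ÷' (q Mt ℚ.* q Mt))
            ℚ.- Wsum))
    ℚ.* (ℚ.1ℚ ℚ.- φbar ÷' (q M ℚ.- q 2 ℚ.* q (numEdges H₁)))

  errorScale : ℚ
  errorScale = (q (Δ ℕ.^ 5) ℚ.* q n) ÷' q (M ℕ.^ 3)

{-# OPTIONS --safe #-}
module Submission where

-- Switch a pair of edges uv, xy to ux, vy. Counting the switchings from the graphs that
-- contain uv to those that avoid it, once from each side, gives an exact identity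
-- (switch-identity). Removing H₁ from every graph reduces the problem to graphs with
-- residual degrees that avoid H = H₁ ∪ H₂, and conditioning on further pairs only
-- enlarges H. Bounding the defects trivially yields P(uv) ≤ (1 + 40ε) d̃ᵤ d̃ᵥ / M̃ with
-- ε = O(Δ² / M̃); applied successively this bounds the probability of two or three
-- given edges, and feeding these bounds back into the identity gives the matching lower
-- bound. With both bounds the identity can be evaluated up to a relative error O(ε²),
-- which is the claim because M ≤ n Δ makes Δ⁴ / M² at most Δ⁵ n / M³.

open import Defs
open import Data.Bool as 𝔹 using (Bool; true; false; _∧_; _∨_; not; _xor_; if_then_else_)
open import Data.Bool.Properties using (∨-zeroʳ; ∨-identityʳ; ∧-zeroʳ; ∧-identityʳ; ∧-assoc)
open import Data.Empty using (⊥; ⊥-elim)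
open import Data.Fin using (Fin; zero; suc; toℕ)
import Data.Fin.Properties as FP
import Data.Integer as ℤ
import Data.Integer.Properties as ℤP
open import Data.List using (List; []; _∷_; _++_; map; foldr; length; concatMap; allFin; tabulate)
open import Data.List.Membership.Propositional using (_∈_; lose)
open import Data.List.Membership.Propositional.Properties using (∈-allFin; ∈-concatMap⁺; ∈-map⁺)
open import Data.List.Properties using (map-tabulate; length-tabulate)
open import Data.List.Relation.Unary.Any using (here; there)
open import Data.Nat as ℕ using (ℕ; zero; suc; _∸_; z≤n; s≤s)
open import Data.Nat.Divisibility using (_∣_)
import Data.Nat.Properties as ℕP
open import Data.Product using (Σ; _×_; _,_; proj₁; proj₂)
open import Data.Rational as ℚ using (ℚ; 0ℚ; 1ℚ; _≤_; _<_; nonNegative; toℚᵘ)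
open import Data.Rational.Properties as ℚP using (≤-refl; ≤-trans; ≤-antisym; ≤-reflexive)
import Data.Rational.Unnormalised as ℚᵘ
import Data.Rational.Unnormalised.Properties as ℚᵘP
open import Data.Sum using (_⊎_; inj₁; inj₂; [_,_]′)
open import Data.Vec using (Vec; lookup; updateAt)
open import Data.Vec.Properties using (lookup∘updateAt; lookup∘updateAt′)
open import Function using (_∘_; id)
open import Relation.Binary using (tri<; tri≈; tri>)
open import Relation.Binary.PropositionalEquality hiding (J)
open import Relation.Nullary using (¬_; yes; no; does)
open import Relation.Nullary.Decidable using (dec⇒maybe; dec-true; dec-false)
open import Tactic.RingSolver using (solve; solve-∀)
open import Tactic.RingSolver.Core.AlmostCommutativeRing using (AlmostCommutativeRing; fromCommutativeRing)

-- The corrections in the formula count blocked switchings. From a graph avoiding uv, an inverse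
-- switching with edges ux, vy is blocked by x = y (the term M̃₂/M̃²), by xy in H (the sum over W),
-- or by xy being an edge (M̃₂²/M̃³). From a graph containing uv, a choice of xy is blocked by
-- meeting u or v, or by ux or vy lying in H or in the graph; these make up φ̄, whose last term
-- d̃ᵤd̃ᵥ appears because the avoiding graphs number N - P. Each correction is O(ε), so knowing it
-- up to a factor 1 + O(ε) leaves only O(ε²), and one round of feeding back is enough. The obstacle
-- is that the corrections involve up to three simultaneous edges, so the one-edge bounds must hold
-- with the same constants after several conditionings. Hence D, m₀ and r are fixed once, and a
-- budget of six further conditionings is carried along. Expectations are unnormalised sums over a
-- class of graphs, so an empty conditioned class never causes a division by zero.

module Arithmetic where

  -- Opaque rational arithmetic, indicators and finite sums.

  ℚ-ring : AlmostCommutativeRing _ _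
  ℚ-ring = fromCommutativeRing ℚP.+-*-commutativeRing (λ x → dec⇒maybe (0ℚ ℚP.≟ x))

  infixl 6 _+_ _-_
  infixl 7 _*_
  infix 8 -_

  -- Opaque copies of the operations: unification then treats them as injective.
  opaque

    _+_ _*_ _-_ : ℚ → ℚ → ℚ
    _+_ = ℚ._+_
    _*_ = ℚ._*_
    _-_ = ℚ._-_

    -_ : ℚ → ℚ
    -_ = ℚ.-_

    ι : ℕ → ℚ
    ι = ℕtoℚ

  opaque

    ⟦_⟧ : Bool → ℚ
    ⟦ true ⟧ = 1ℚ
    ⟦ false ⟧ = 0ℚ

    ⟦true⟧ : ⟦ true ⟧ ≡ 1ℚ
    ⟦true⟧ = refl

    ⟦false⟧ : ⟦ false ⟧ ≡ 0ℚ
    ⟦false⟧ = refl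

  infixl 6 _⊕_
  infixl 7 _⊗_

  opaque
    unfolding _+_ _*_ _-_ -_ ι ⟦_⟧

    +-identityˡ : ∀ a → 0ℚ + a ≡ a
    +-identityˡ = ℚP.+-identityˡ

    +-identityʳ : ∀ a → a + 0ℚ ≡ a
    +-identityʳ = ℚP.+-identityʳ

    *-identityˡ : ∀ a → 1ℚ * a ≡ a
    *-identityˡ = ℚP.*-identityˡ

    *-identityʳ : ∀ a → a * 1ℚ ≡ a
    *-identityʳ = ℚP.*-identityʳ

    *-zeroˡ : ∀ a → 0ℚ * a ≡ 0ℚ
    *-zeroˡ = ℚP.*-zeroˡ

    *-zeroʳ : ∀ a → a * 0ℚ ≡ 0ℚ
    *-zeroʳ = ℚP.*-zeroʳ

    +-assoc : ∀ a b c → (a + b) + c ≡ a + (b + c)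
    +-assoc = ℚP.+-assoc

    *-assoc : ∀ a b c → (a * b) * c ≡ a * (b * c)
    *-assoc = ℚP.*-assoc

    +-comm : ∀ a b → a + b ≡ b + a
    +-comm = ℚP.+-comm

    *-comm : ∀ a b → a * b ≡ b * a
    *-comm = ℚP.*-comm

    *-distribˡ-+ : ∀ a b c → a * (b + c) ≡ a * b + a * c
    *-distribˡ-+ = ℚP.*-distribˡ-+

    +-mono-≤ : ∀ {a b c d} → a ≤ b → c ≤ d → a + c ≤ b + d
    +-mono-≤ = ℚP.+-mono-≤

    _⊕_ : ∀ {a b} → 0ℚ ≤ a → 0ℚ ≤ b → 0ℚ ≤ a + b
    _⊕_ = ℚP.+-mono-≤

    _⊗_ : ∀ {a b} → 0ℚ ≤ a → 0ℚ ≤ b → 0ℚ ≤ a * b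
    _⊗_ {a} {b} h k = subst (_≤ a ℚ.* b) (ℚP.*-zeroˡ b) (ℚP.*-monoʳ-≤-nonNeg b {{nonNegative k}} h)

    gap : ∀ {a b} → a ≤ b → 0ℚ ≤ b - a
    gap {a} {b} h = subst (_≤ b ℚ.- a) (ℚP.+-inverseʳ a) (ℚP.+-monoˡ-≤ (ℚ.- a) h)

    ungap : ∀ {a b} → 0ℚ ≤ b - a → a ≤ b
    ungap {a} {b} h = subst₂ _≤_ (ℚP.+-identityˡ a) (lem a b) (ℚP.+-monoˡ-≤ a h)
      where
      lem : ∀ a b → b ℚ.- a ℚ.+ a ≡ b
      lem = solve-∀ ℚ-ring

    -- The scheme behind the rational inequalities below: the first argument, assembled from `_⊕_`,
    -- `_⊗_`, `gap` and `#`, exhibits a sum of products of nonnegative quantities, and the ring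
    -- solver checks that it equals `b - a`.
    certify : ∀ {t a b} → 0ℚ ≤ t → b - a ≡ t → a ≤ b
    certify h e = ungap (subst (0ℚ ≤_) (sym e) h)

    *-mono : ∀ {a b c d} → 0ℚ ≤ a → 0ℚ ≤ d → a ≤ b → c ≤ d → a * c ≤ b * d
    *-mono {a} {b} {c} {d} pa pd h k =
      certify (pa ⊗ gap k ⊕ pd ⊗ gap h) (solve (a ∷ b ∷ c ∷ d ∷ []) ℚ-ring)

    *-monoˡ : ∀ {a b c} → 0ℚ ≤ c → a ≤ b → c * a ≤ c * b
    *-monoˡ {a} {b} {c} pc h = certify (pc ⊗ gap h) (solve (a ∷ b ∷ c ∷ []) ℚ-ring)

    *-monoʳ : ∀ {a b c} → 0ℚ ≤ c → a ≤ b → a * c ≤ b * c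
    *-monoʳ {a} {b} {c} pc h = certify (pc ⊗ gap h) (solve (a ∷ b ∷ c ∷ []) ℚ-ring)

    ι-+ : ∀ a b → ι (a ℕ.+ b) ≡ ι a + ι b
    ι-+ a b = ℚP.toℚᵘ-injective (begin
      toℚᵘ (ℕtoℚ (a ℕ.+ b))                        ≈⟨ ℚP.toℚᵘ-fromℚᵘ (ℚᵘ.mkℚᵘ (ℤ.+ (a ℕ.+ b)) 0) ⟩
      ℚᵘ.mkℚᵘ (ℤ.+ (a ℕ.+ b)) 0                       ≈⟨ ℚᵘ.*≡* (cong (ℤ._* ℤ.+ 1) (cong₂ ℤ._+_ (sym (ℤP.*-identityʳ (ℤ.+ a))) (sym (ℤP.*-identityʳ (ℤ.+ b))))) ⟩
      ℚᵘ.mkℚᵘ (ℤ.+ a) 0 ℚᵘ.+ ℚᵘ.mkℚᵘ (ℤ.+ b) 0          ≈⟨ ℚᵘP.≃-sym (ℚᵘP.+-cong (ℚP.toℚᵘ-fromℚᵘ (ℚᵘ.mkℚᵘ (ℤ.+ a) 0)) (ℚP.toℚᵘ-fromℚᵘ (ℚᵘ.mkℚᵘ (ℤ.+ b) 0))) ⟩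
      toℚᵘ (ℕtoℚ a) ℚᵘ.+ toℚᵘ (ℕtoℚ b)              ≈⟨ ℚᵘP.≃-sym (ℚP.toℚᵘ-homo-+ (ℕtoℚ a) (ℕtoℚ b)) ⟩
      toℚᵘ (ℕtoℚ a ℚ.+ ℕtoℚ b)                        ∎)
      where open ℚᵘP.≃-Reasoning

    ι-* : ∀ a b → ι (a ℕ.* b) ≡ ι a * ι b
    ι-* zero b = sym (*-zeroˡ (ι b))
    ι-* (suc a) b = trans (ι-+ b (a ℕ.* b)) (trans (cong (ι b +_) (ι-* a b))
      (trans (lem (ι a) (ι b)) (cong (_* ι b) (sym (ι-+ 1 a)))))
      where
      lem : ∀ x y → y ℚ.+ x ℚ.* y ≡ (1ℚ ℚ.+ x) ℚ.* y
      lem = solve-∀ ℚ-ring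

    ι0 : ι 0 ≡ 0ℚ
    ι0 = refl

    ι1 : ι 1 ≡ 1ℚ
    ι1 = refl

    ⟦∨⟧-≤ : ∀ a b → ⟦ a ∨ b ⟧ ≤ ⟦ a ⟧ + ⟦ b ⟧
    ⟦∨⟧-≤ true true = ℚP.≤ᵇ⇒≤ _
    ⟦∨⟧-≤ true false = ℚP.≤ᵇ⇒≤ _
    ⟦∨⟧-≤ false true = ℚP.≤ᵇ⇒≤ _
    ⟦∨⟧-≤ false false = ℚP.≤ᵇ⇒≤ _

    ⟦∨⟧ : ∀ a b → ⟦ a ∨ b ⟧ ≡ 1ℚ - (1ℚ - ⟦ a ⟧) * (1ℚ - ⟦ b ⟧)
    ⟦∨⟧ true true = refl
    ⟦∨⟧ true false = refl
    ⟦∨⟧ false true = refl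
    ⟦∨⟧ false false = refl

    ⟦∧⟧ : ∀ a b → ⟦ a ∧ b ⟧ ≡ ⟦ a ⟧ * ⟦ b ⟧
    ⟦∧⟧ true true = refl
    ⟦∧⟧ true false = refl
    ⟦∧⟧ false true = refl
    ⟦∧⟧ false false = refl

    ⟦not⟧ : ∀ a → ⟦ not a ⟧ ≡ 1ℚ - ⟦ a ⟧
    ⟦not⟧ true = refl
    ⟦not⟧ false = refl

    ⟦⟧-idem : ∀ a → ⟦ a ⟧ * ⟦ a ⟧ ≡ ⟦ a ⟧
    ⟦⟧-idem true = refl
    ⟦⟧-idem false = refl

    0≤1 : 0ℚ ≤ 1ℚ
    0≤1 = ℚP.≤ᵇ⇒≤ _

    ⟦⟧≥0 : ∀ b → 0ℚ ≤ ⟦ b ⟧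
    ⟦⟧≥0 true = 0≤1
    ⟦⟧≥0 false = ≤-refl

    ⟦⟧≤1 : ∀ b → ⟦ b ⟧ ≤ 1ℚ
    ⟦⟧≤1 true = ≤-refl
    ⟦⟧≤1 false = 0≤1

    ⟦⟧-mono : ∀ {a b} → (a ≡ true → b ≡ true) → ⟦ a ⟧ ≤ ⟦ b ⟧
    ⟦⟧-mono {false} {b} h = ⟦⟧≥0 b
    ⟦⟧-mono {true} h = ≤-reflexive (cong ⟦_⟧ (sym (h refl)))

    square≥0 : ∀ x → 0ℚ ≤ x * x
    square≥0 x = [ (λ h → h ⊗ h) , nonpositive ]′ (ℚP.≤-total 0ℚ x)
      where
      nonpositive : x ≤ 0ℚ → 0ℚ ≤ x * x
      nonpositive h = certify (gap h ⊗ gap h) (solve (x ∷ []) ℚ-ring)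

    +-swap : ∀ a b c d → (a + b) + (c + d) ≡ (a + c) + (b + d)
    +-swap = solve-∀ ℚ-ring

    +-swap-- : ∀ a b c d → (a - b) + (c - d) ≡ (a + c) - (b + d)
    +-swap-- = solve-∀ ℚ-ring

    0-0≡0 : 0ℚ - 0ℚ ≡ 0ℚ
    0-0≡0 = refl

    x-0≡x : ∀ x → x - 0ℚ ≡ x
    x-0≡x = solve-∀ ℚ-ring

  ≤-resp : ∀ {a a′ b b′} → a ≡ a′ → b ≡ b′ → a ≤ b → a′ ≤ b′
  ≤-resp refl refl h = h

  # : ∀ k → 0ℚ ≤ ι k
  # zero = ≤-reflexive (sym ι0)
  # (suc k) = subst (0ℚ ≤_) (sym (trans (ι-+ 1 k) (cong (_+ ι k) ι1))) (0≤1 ⊕ # k)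

  ι-mono : ∀ {a b} → a ℕ.≤ b → ι a ≤ ι b
  ι-mono {a} {b} h = subst₂ _≤_ (+-identityʳ _) (trans (sym (ι-+ a (b ∸ a))) (cong ι (ℕP.m+[n∸m]≡n h)))
    (+-mono-≤ ≤-refl (# (b ∸ a)))

  ∧-true⁻ : ∀ {a b} → a ∧ b ≡ true → a ≡ true × b ≡ true
  ∧-true⁻ {true} h = refl , h

  ∧-true⁺ : ∀ {a b} → a ≡ true → b ≡ true → a ∧ b ≡ true
  ∧-true⁺ refl refl = refl

  ∨-false⁻ : ∀ {a b} → a ∨ b ≡ false → a ≡ false × b ≡ false
  ∨-false⁻ {false} h = refl , h

  not-true⁻ : ∀ {a} → not a ≡ true → a ≡ false
  not-true⁻ {false} h = refl

  ¬true : ∀ {a} → ¬ (a ≡ true) → a ≡ false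
  ¬true {false} h = refl
  ¬true {true} h = ⊥-elim (h refl)

  true≢false : ∀ {a} {X : Set} → a ≡ true → a ≡ false → X
  true≢false refl ()

  opaque

    sum : ∀ {A : Set} → (A → ℚ) → List A → ℚ
    sum = sumℚ

  opaque
    unfolding sum _+_

    sum-[] : ∀ {A : Set} (f : A → ℚ) → sum f [] ≡ 0ℚ
    sum-[] f = refl

    sum-∷ : ∀ {A : Set} (f : A → ℚ) x xs → sum f (x ∷ xs) ≡ f x + sum f xs
    sum-∷ f x xs = refl

  module _ {A : Set} where

    sum-cong : ∀ {f g : A → ℚ} (xs : List A) → (∀ x → f x ≡ g x) → sum f xs ≡ sum g xs
    sum-cong {f} {g} [] h = trans (sum-[] f) (sym (sum-[] g))
    sum-cong {f} {g} (x ∷ xs) h = trans (sum-∷ f x xs) (trans (cong₂ _+_ (h x) (sum-cong xs h)) (sym (sum-∷ g x xs)))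

    sum-mono : ∀ {f g : A → ℚ} (xs : List A) → (∀ x → f x ≤ g x) → sum f xs ≤ sum g xs
    sum-mono {f} {g} [] h = ≤-reflexive (trans (sum-[] f) (sym (sum-[] g)))
    sum-mono {f} {g} (x ∷ xs) h = ≤-resp (sym (sum-∷ f x xs)) (sym (sum-∷ g x xs)) (+-mono-≤ (h x) (sum-mono xs h))

    sum-0 : ∀ (xs : List A) → sum (λ _ → 0ℚ) xs ≡ 0ℚ
    sum-0 [] = sum-[] _
    sum-0 (x ∷ xs) = trans (sum-∷ _ x xs) (trans (+-identityˡ _) (sum-0 xs))

    sum-nonneg : ∀ {f : A → ℚ} (xs : List A) → (∀ x → 0ℚ ≤ f x) → 0ℚ ≤ sum f xs
    sum-nonneg xs h = ≤-resp (sum-0 xs) refl (sum-mono xs h)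

    sum-+ : ∀ (f g : A → ℚ) xs → sum (λ x → f x + g x) xs ≡ sum f xs + sum g xs
    sum-+ f g [] = trans (sum-[] _) (sym (trans (cong₂ _+_ (sum-[] f) (sum-[] g)) (+-identityˡ 0ℚ)))
    sum-+ f g (x ∷ xs) = trans (sum-∷ _ x xs) (trans (cong (f x + g x +_) (sum-+ f g xs))
      (trans (+-swap (f x) (g x) (sum f xs) (sum g xs)) (sym (cong₂ _+_ (sum-∷ f x xs) (sum-∷ g x xs)))))

    sum-*ˡ : ∀ c (f : A → ℚ) xs → sum (λ x → c * f x) xs ≡ c * sum f xs
    sum-*ˡ c f [] = trans (sum-[] _) (sym (trans (cong (c *_) (sum-[] f)) (*-zeroʳ c)))
    sum-*ˡ c f (x ∷ xs) = trans (sum-∷ _ x xs) (trans (cong (c * f x +_) (sum-*ˡ c f xs))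
      (trans (sym (*-distribˡ-+ c (f x) (sum f xs))) (cong (c *_) (sym (sum-∷ f x xs)))))

    sum-*ʳ : ∀ c (f : A → ℚ) xs → sum (λ x → f x * c) xs ≡ sum f xs * c
    sum-*ʳ c f xs = trans (sum-cong xs (λ x → *-comm (f x) c)) (trans (sum-*ˡ c f xs) (*-comm c _))

    sum-- : ∀ (f g : A → ℚ) xs → sum (λ x → f x - g x) xs ≡ sum f xs - sum g xs
    sum-- f g [] = trans (sum-[] _) (sym (trans (cong₂ _-_ (sum-[] f) (sum-[] g)) 0-0≡0))
    sum-- f g (x ∷ xs) = trans (sum-∷ _ x xs) (trans (cong (f x - g x +_) (sum-- f g xs))
      (trans (+-swap-- (f x) (g x) (sum f xs) (sum g xs)) (sym (cong₂ _-_ (sum-∷ f x xs) (sum-∷ g x xs)))))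

    sum-++ : ∀ (f : A → ℚ) xs ys → sum f (xs ++ ys) ≡ sum f xs + sum f ys
    sum-++ f [] ys = sym (trans (cong (_+ sum f ys) (sum-[] f)) (+-identityˡ _))
    sum-++ f (x ∷ xs) ys = trans (sum-∷ f x (xs ++ ys)) (trans (cong (f x +_) (sum-++ f xs ys))
      (trans (sym (+-assoc (f x) _ _)) (cong (_+ sum f ys) (sym (sum-∷ f x xs)))))

  sum-map : ∀ {A B : Set} (f : B → ℚ) (g : A → B) xs → sum f (map g xs) ≡ sum (λ x → f (g x)) xs
  sum-map f g [] = trans (sum-[] f) (sym (sum-[] _))
  sum-map f g (x ∷ xs) = trans (sum-∷ f (g x) (map g xs)) (trans (cong (f (g x) +_) (sum-map f g xs)) (sym (sum-∷ _ x xs)))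

  sum-concatMap : ∀ {A B : Set} (f : B → ℚ) (g : A → List B) xs → sum f (concatMap g xs) ≡ sum (λ x → sum f (g x)) xs
  sum-concatMap f g [] = trans (sum-[] f) (sym (sum-[] _))
  sum-concatMap f g (x ∷ xs) = trans (sum-++ f (g x) (concatMap g xs))
    (trans (cong (sum f (g x) +_) (sum-concatMap f g xs)) (sym (sum-∷ _ x xs)))

  sum-swap : ∀ {A B : Set} (f : A → B → ℚ) xs ys →
    sum (λ x → sum (f x) ys) xs ≡ sum (λ y → sum (λ x → f x y) xs) ys
  sum-swap f [] ys = trans (sum-[] _) (sym (trans (sum-cong ys (λ y → sum-[] (λ x → f x y))) (sum-0 ys)))
  sum-swap f (x ∷ xs) ys = trans (sum-∷ _ x xs) (trans (cong (sum (f x) ys +_) (sum-swap f xs ys))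
    (trans (sym (sum-+ (f x) (λ y → sum (λ x → f x y) xs) ys)) (sum-cong ys (λ y → sym (sum-∷ (λ x → f x y) x xs)))))

  ∑ : ∀ {n} → (Fin n → ℚ) → ℚ
  ∑ {n} f = sum f (allFin n)

  ∑-suc : ∀ {n} (f : Fin (suc n) → ℚ) → ∑ f ≡ f zero + ∑ (λ x → f (suc x))
  ∑-suc {n} f = trans (sum-∷ f zero (tabulate suc)) (cong (f zero +_) (trans (cong (sum f) (sym (map-tabulate id suc))) (sum-map f suc (allFin n))))

  sum-pairs : ∀ {n} (f : Fin n × Fin n → ℚ) → sum f (pairs n) ≡ ∑ λ x → ∑ λ y → f (x , y)
  sum-pairs {n} f = trans (sum-concatMap f (λ i → map (λ j → (i , j)) (allFin n)) (allFin n))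
    (sum-cong (allFin n) (λ x → sum-map f (λ y → (x , y)) (allFin n)))

  infix 4 _==_

  opaque

    _==_ : ∀ {n} → Fin n → Fin n → Bool
    x == y = does (x FP.≟ y)

    ==-true : ∀ {n} {x y : Fin n} → (x == y) ≡ true → x ≡ y
    ==-true {x = x} {y} h with x FP.≟ y
    ... | yes p = p

    ==-refl : ∀ {n} (x : Fin n) → (x == x) ≡ true
    ==-refl x = dec-true (x FP.≟ x) refl

    ==-≢ : ∀ {n} {x y : Fin n} → x ≢ y → (x == y) ≡ false
    ==-≢ {x = x} {y} h = dec-false (x FP.≟ y) h

    suc-== : ∀ {n} (x y : Fin n) → (suc x == suc y) ≡ (x == y)
    suc-== x y = refl

  ==-false : ∀ {n} {x y : Fin n} → (x == y) ≡ false → x ≢ y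
  ==-false {x = x} h refl = true≢false (==-refl x) h

  ==-sym : ∀ {n} (x y : Fin n) → (x == y) ≡ (y == x)
  ==-sym x y with x FP.≟ y
  ... | yes refl = refl
  ... | no h = trans (==-≢ h) (sym (==-≢ (≢-sym h)))

  δ : ∀ {n} → Fin n → Fin n → ℚ
  δ x y = ⟦ x == y ⟧

  δ-refl : ∀ {n} (x : Fin n) → δ x x ≡ 1ℚ
  δ-refl x = trans (cong ⟦_⟧ (==-refl x)) ⟦true⟧

  δ-≢ : ∀ {n} {x y : Fin n} → x ≢ y → δ x y ≡ 0ℚ
  δ-≢ h = trans (cong ⟦_⟧ (==-≢ h)) ⟦false⟧

  δ-sym : ∀ {n} (x y : Fin n) → δ x y ≡ δ y x
  δ-sym x y = cong ⟦_⟧ (==-sym x y)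

  δ-replace : ∀ {n} (f : Fin n → ℚ) x y → δ x y * f x ≡ δ x y * f y
  δ-replace f x y with x FP.≟ y
  ... | yes refl = refl
  ... | no h rewrite δ-≢ h = trans (*-zeroˡ (f x)) (sym (*-zeroˡ (f y)))

  ∑-δ : ∀ {n} (f : Fin n → ℚ) x → ∑ (λ y → δ y x * f y) ≡ f x
  ∑-δ {suc n} f zero = trans (∑-suc (λ y → δ y zero * f y))
    (trans (cong₂ _+_ (trans (cong (_* f zero) (δ-refl zero)) (*-identityˡ (f zero)))
      (trans (sum-cong (allFin n) (λ y → trans (cong (_* f (suc y)) (δ-≢ (λ ()))) (*-zeroˡ (f (suc y))))) (sum-0 (allFin n)))) (+-identityʳ _))
  ∑-δ {suc n} f (suc x) = trans (∑-suc (λ y → δ y (suc x) * f y))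
    (trans (cong₂ _+_ (trans (cong (_* f zero) (δ-≢ (λ ()))) (*-zeroˡ (f zero)))
      (trans (sum-cong (allFin n) (λ y → cong (λ t → ⟦ t ⟧ * f (suc y)) (suc-== y x))) (∑-δ (λ y → f (suc y)) x))) (+-identityˡ _))

  ∑-δ1 : ∀ {n} (x : Fin n) → ∑ (λ y → δ y x) ≡ 1ℚ
  ∑-δ1 {n} x = trans (sum-cong (allFin n) (λ y → sym (*-identityʳ (δ y x)))) (∑-δ (λ _ → 1ℚ) x) 

-- Toggling matrix entries, and classes of graphs closed under switchings.

module Switching where
  open Arithmetic
  open import Data.Vec using ([]; _∷_)

  sum-allVecs : ∀ {A : Set} (xs : List A) m (F : Vec A (suc m) → ℚ) →
    sum F (allVecs xs (suc m)) ≡ sum (λ x → sum (λ v → F (x ∷ v)) (allVecs xs m)) xs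
  sum-allVecs xs m F = trans (sum-concatMap F (λ x → map (x ∷_) (allVecs xs m)) xs)
    (sum-cong xs (λ x → sum-map F (x ∷_) (allVecs xs m)))

  -- Stands for `f` permuting the list. Bijections serve only to reindex sums here, and this form
  -- composes and lifts through `allVecs` directly.
  SumInvariant : {A : Set} → List A → (A → A) → Set
  SumInvariant {A} xs f = ∀ (g : A → ℚ) → sum (g ∘ f) xs ≡ sum g xs

  updateAt-invariant : ∀ {A : Set} {xs : List A} {f : A → A} → SumInvariant xs f →
    ∀ {m} (i : Fin m) → SumInvariant (allVecs xs m) (λ v → updateAt v i f)
  updateAt-invariant {xs = xs} {f} inv {suc m} zero F = begin
    sum (λ v → F (updateAt v zero f)) (allVecs xs (suc m))             ≡⟨ sum-allVecs xs m _ ⟩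
    sum (λ x → sum (λ v → F (f x ∷ v)) (allVecs xs m)) xs             ≡⟨ inv (λ x → sum (λ v → F (x ∷ v)) (allVecs xs m)) ⟩
    sum (λ x → sum (λ v → F (x ∷ v)) (allVecs xs m)) xs               ≡⟨ sum-allVecs xs m F ⟨
    sum F (allVecs xs (suc m))                                         ∎
    where open ≡-Reasoning
  updateAt-invariant {xs = xs} {f} inv {suc m} (suc i) F = begin
    sum (λ v → F (updateAt v (suc i) f)) (allVecs xs (suc m))          ≡⟨ sum-allVecs xs m _ ⟩
    sum (λ x → sum (λ v → F (x ∷ updateAt v i f)) (allVecs xs m)) xs  ≡⟨ sum-cong xs (λ x → updateAt-invariant inv i (λ v → F (x ∷ v))) ⟩
    sum (λ x → sum (λ v → F (x ∷ v)) (allVecs xs m)) xs               ≡⟨ sum-allVecs xs m F ⟨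
    sum F (allVecs xs (suc m))                                         ∎
    where open ≡-Reasoning

  opaque
    unfolding sum _+_

    not-invariant : SumInvariant (true ∷ false ∷ []) not
    not-invariant g = lem (g false) (g true)
      where
      lem : ∀ a b → a ℚ.+ (b ℚ.+ 0ℚ) ≡ b ℚ.+ (a ℚ.+ 0ℚ)
      lem = solve-∀ ℚ-ring

  ∘-invariant : ∀ {A : Set} {xs : List A} {f g : A → A} →
    SumInvariant xs f → SumInvariant xs g → SumInvariant xs (f ∘ g)
  ∘-invariant {f = f} p q F = trans (q (F ∘ f)) (p F)

  flip : ∀ {n} → Fin n → Fin n → Adj n → Adj n
  flip i j A = updateAt A i (λ r → updateAt r j not)

  flip-invariant : ∀ {n} (i j : Fin n) → SumInvariant (allAdj n) (flip i j)
  flip-invariant i j = updateAt-invariant (updateAt-invariant not-invariant j) i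

  opaque

    adj : ∀ {n} → Adj n → Fin n → Fin n → Bool
    adj = edge

  xor-false : ∀ a → a ≡ a xor false
  xor-false true = refl
  xor-false false = refl

  xor-true : ∀ a → not a ≡ a xor true
  xor-true true = refl
  xor-true false = refl

  xor-∨ : ∀ e s t → (s ≡ true → t ≡ false) → (e xor t) xor s ≡ e xor (s ∨ t)
  xor-∨ e true t h rewrite h refl | sym (xor-false e) = refl
  xor-∨ e false t h = sym (xor-false (e xor t))

  opaque
    unfolding adj

    adj-flip : ∀ {n} (i j : Fin n) A x y → adj (flip i j A) x y ≡ adj A x y xor ((x == i) ∧ (y == j))
    adj-flip i j A x y with x FP.≟ i
    ... | no x≢i rewrite ==-≢ x≢i = trans (cong (λ r → lookup r y) (lookup∘updateAt′ x i x≢i A)) (xor-false _)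
    ... | yes refl rewrite ==-refl x with y FP.≟ j
    ...   | yes refl rewrite ==-refl y = trans (cong (λ r → lookup r y) (lookup∘updateAt x A)) (trans (lookup∘updateAt y (lookup A x)) (xor-true _))
    ...   | no y≢j rewrite ==-≢ y≢j = trans (cong (λ r → lookup r y) (lookup∘updateAt x A)) (trans (lookup∘updateAt′ y j y≢j (lookup A x)) (xor-false _))

  opaque

    isE : ∀ {n} → Fin n → Fin n → Fin n → Fin n → Bool
    isE p q x y = (x == p) ∧ (y == q) ∨ (x == q) ∧ (y == p)

    isE-def : ∀ {n} (p q x y : Fin n) → isE p q x y ≡ (x == p) ∧ (y == q) ∨ (x == q) ∧ (y == p)
    isE-def p q x y = refl

  opaque
    unfolding _+_ _*_ _-_ -_ ⟦_⟧ ι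

    ⟦∨⟧-left : ∀ b c → ⟦ b ∨ false ⟧ ≡ ⟦ true ⟧ * ⟦ b ⟧ + ⟦ false ⟧ * ⟦ c ⟧
    ⟦∨⟧-left true true = refl
    ⟦∨⟧-left true false = refl
    ⟦∨⟧-left false true = refl
    ⟦∨⟧-left false false = refl

    ⟦∨⟧-right : ∀ b c d → ⟦ c ∧ d ⟧ ≡ ⟦ false ⟧ * ⟦ b ⟧ + ⟦ c ⟧ * ⟦ d ⟧
    ⟦∨⟧-right true true true = refl
    ⟦∨⟧-right true true false = refl
    ⟦∨⟧-right true false true = refl
    ⟦∨⟧-right true false false = refl
    ⟦∨⟧-right false true true = refl
    ⟦∨⟧-right false true false = refl
    ⟦∨⟧-right false false true = refl
    ⟦∨⟧-right false false false = refl

    toggle-uv : ⟦ false ⟧ ≡ ⟦ true ⟧ + ((⟦ false ⟧ + ⟦ false ⟧) - (⟦ true ⟧ + ⟦ false ⟧))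
    toggle-uv = refl

    toggle-xy : ⟦ false ⟧ ≡ ⟦ true ⟧ + ((⟦ false ⟧ + ⟦ false ⟧) - (⟦ false ⟧ + ⟦ true ⟧))
    toggle-xy = refl

    toggle-ux : ⟦ true ⟧ ≡ ⟦ false ⟧ + ((⟦ true ⟧ + ⟦ false ⟧) - (⟦ false ⟧ + ⟦ false ⟧))
    toggle-ux = refl

    toggle-vy : ⟦ true ⟧ ≡ ⟦ false ⟧ + ((⟦ false ⟧ + ⟦ true ⟧) - (⟦ false ⟧ + ⟦ false ⟧))
    toggle-vy = refl

    toggle-none : ∀ e → ⟦ e ⟧ ≡ ⟦ e ⟧ + ((⟦ false ⟧ + ⟦ false ⟧) - (⟦ false ⟧ + ⟦ false ⟧))
    toggle-none true = refl
    toggle-none false = refl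

    cancel-δ : ∀ s a b c d → s + (((a + c) + (b + d)) - ((a + b) + (c + d))) ≡ s
    cancel-δ = solve-∀ ℚ-ring

    -- Nonnegativity excludes k = 0, the one case in which truncated subtraction would differ.
    drop-one : ∀ k → 0ℚ ≤ ι k - 1ℚ → ι k - 1ℚ ≡ ι (k ∸ 1)
    drop-one zero (ℚ.*≤* ())
    drop-one (suc k) _ = trans (cong (_- 1ℚ) (trans (ι-+ 1 k) (cong (_+ ι k) ι1))) (lem (ι k))
      where
      lem : ∀ z → 1ℚ + z - 1ℚ ≡ z
      lem = solve-∀ ℚ-ring

    drop-none : ∀ z → z - (⟦ false ⟧ + ⟦ false ⟧) ≡ z
    drop-none = solve-∀ ℚ-ring

    drop-left : ∀ z → z - (⟦ true ⟧ + ⟦ false ⟧) ≡ z - 1ℚ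
    drop-left = solve-∀ ℚ-ring

    drop-right : ∀ z → z - (⟦ false ⟧ + ⟦ true ⟧) ≡ z - 1ℚ
    drop-right = solve-∀ ℚ-ring

    minus-true : ⟦ false ⟧ ≡ ⟦ true ⟧ - ⟦ true ⟧
    minus-true = refl

  ∨-true⁻ : ∀ {a b} → a ∨ b ≡ true → a ≡ true ⊎ b ≡ true
  ∨-true⁻ {true} h = inj₁ refl
  ∨-true⁻ {false} h = inj₂ h

  SamePair : ∀ {n} → Fin n → Fin n → Fin n → Fin n → Set
  SamePair p q x y = (x ≡ p × y ≡ q) ⊎ (x ≡ q × y ≡ p)

  module _ {n : ℕ} where

    isE-true⁻ : ∀ {p q x y : Fin n} → isE p q x y ≡ true → SamePair p q x y
    isE-true⁻ {p} {q} {x} {y} e with ∨-true⁻ {(x == p) ∧ (y == q)} (trans (sym (isE-def p q x y)) e)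
    ... | inj₁ h = inj₁ (==-true (proj₁ (∧-true⁻ h)) , ==-true (proj₂ (∧-true⁻ {x == p} h)))
    ... | inj₂ h = inj₂ (==-true (proj₁ (∧-true⁻ h)) , ==-true (proj₂ (∧-true⁻ {x == q} h)))

    isE-true⁺ : ∀ {p q x y : Fin n} → SamePair p q x y → isE p q x y ≡ true
    isE-true⁺ {p} {q} (inj₁ (refl , refl)) rewrite isE-def p q p q | ==-refl p | ==-refl q = refl
    isE-true⁺ {p} {q} (inj₂ (refl , refl)) rewrite isE-def p q q p | ==-refl p | ==-refl q = ∨-zeroʳ _

    isE-false⁺ : ∀ {p q x y : Fin n} → ¬ SamePair p q x y → isE p q x y ≡ false
    isE-false⁺ h = ¬true (h ∘ isE-true⁻)

    isE-sym : ∀ (p q x y : Fin n) → isE p q x y ≡ isE p q y x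
    isE-sym p q x y with isE p q x y in e
    ... | true = sym (isE-true⁺ (swap (isE-true⁻ e)))
      where
      swap : SamePair p q x y → SamePair p q y x
      swap (inj₁ (a , b)) = inj₂ (b , a)
      swap (inj₂ (a , b)) = inj₁ (b , a)
    ... | false = sym (isE-false⁺ λ s → true≢false (isE-true⁺ (swap s)) e)
      where
      swap : SamePair p q y x → SamePair p q x y
      swap (inj₁ (a , b)) = inj₂ (b , a)
      swap (inj₂ (a , b)) = inj₁ (b , a)

    isE-flip : ∀ {p q x y : Fin n} → isE p q x y ≡ false → isE x y p q ≡ false
    isE-flip e = isE-false⁺ λ s → true≢false (isE-true⁺ (swap s)) e
      where
      swap : ∀ {p q x y : Fin n} → SamePair p q x y → SamePair x y p q
      swap (inj₁ (a , b)) = inj₁ (sym a , sym b)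
      swap (inj₂ (a , b)) = inj₂ (sym b , sym a)

    ⟦isE⟧ : ∀ {p q : Fin n} → p ≢ q → ∀ x y → ⟦ isE p q x y ⟧ ≡ δ x p * δ y q + δ x q * δ y p
    ⟦isE⟧ {p} {q} p≢q x y rewrite isE-def p q x y with x FP.≟ p
    ... | yes refl rewrite ==-refl x | ==-≢ p≢q = ⟦∨⟧-left (y == q) (y == x)
    ... | no h rewrite ==-≢ h = ⟦∨⟧-right (y == q) (x == q) (y == p)

    ∑-isE : ∀ {p q : Fin n} → p ≢ q → ∀ x → ∑ (λ y → ⟦ isE p q x y ⟧) ≡ δ x p + δ x q
    ∑-isE {p} {q} p≢q x = begin
      ∑ (λ y → ⟦ isE p q x y ⟧)                                  ≡⟨ sum-cong (allFin n) (⟦isE⟧ p≢q x) ⟩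
      ∑ (λ y → δ x p * δ y q + δ x q * δ y p)                    ≡⟨ sum-+ _ _ (allFin n) ⟩
      ∑ (λ y → δ x p * δ y q) + ∑ (λ y → δ x q * δ y p)          ≡⟨ cong₂ _+_ (sum-*ˡ (δ x p) _ (allFin n)) (sum-*ˡ (δ x q) _ (allFin n)) ⟩
      δ x p * ∑ (λ y → δ y q) + δ x q * ∑ (λ y → δ y p)          ≡⟨ cong₂ (λ a b → δ x p * a + δ x q * b) (∑-δ1 q) (∑-δ1 p) ⟩
      δ x p * 1ℚ + δ x q * 1ℚ                                    ≡⟨ cong₂ _+_ (*-identityʳ (δ x p)) (*-identityʳ (δ x q)) ⟩
      δ x p + δ x q                                              ∎
      where open ≡-Reasoning

    flip₂ : Fin n → Fin n → Adj n → Adj n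
    flip₂ p q = flip p q ∘ flip q p

    adj-flip₂ : ∀ {p q : Fin n} → p ≢ q → ∀ A x y → adj (flip₂ p q A) x y ≡ adj A x y xor isE p q x y
    adj-flip₂ {p} {q} p≢q A x y = trans (adj-flip p q (flip q p A) x y)
      (trans (cong (_xor ((x == p) ∧ (y == q))) (adj-flip q p A x y))
        (trans (xor-∨ (adj A x y) ((x == p) ∧ (y == q)) ((x == q) ∧ (y == p)) exclusive) (cong (adj A x y xor_) (sym (isE-def p q x y)))))
      where
      exclusive : (x == p) ∧ (y == q) ≡ true → (x == q) ∧ (y == p) ≡ false
      exclusive h rewrite ==-≢ {x = x} {q} (λ e → p≢q (trans (sym (==-true (proj₁ (∧-true⁻ h)))) e)) = refl

    record Distinct₄ (u v x y : Fin n) : Set where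
      constructor distinct₄
      field
        u≢v : u ≢ v
        u≢x : u ≢ x
        u≢y : u ≢ y
        v≢x : v ≢ x
        v≢y : v ≢ y
        x≢y : x ≢ y

    -- Four toggles, defined on every Boolean matrix, so that invariance of sums over `allAdj` is
    -- immediate. That uv and xy disappear while ux and vy appear depends only on the entries met.
    switch : Fin n → Fin n → Fin n → Fin n → Adj n → Adj n
    switch u v x y = flip₂ u v ∘ (flip₂ x y ∘ (flip₂ u x ∘ flip₂ v y))

    switch-invariant : ∀ u v x y → SumInvariant (allAdj n) (switch u v x y)
    switch-invariant u v x y = ∘-invariant (fl u v) (∘-invariant (fl x y) (∘-invariant (fl u x) (fl v y)))
      where
      fl : ∀ p q → SumInvariant (allAdj n) (flip₂ p q)
      fl p q = ∘-invariant (flip-invariant p q) (flip-invariant q p)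

    module Switch {u v x y : Fin n} (D : Distinct₄ u v x y) (G : Adj n) where
      open Distinct₄ D

      adj-switch : ∀ a b → adj (switch u v x y G) a b ≡
        (((adj G a b xor isE v y a b) xor isE u x a b) xor isE x y a b) xor isE u v a b
      adj-switch a b = trans (adj-flip₂ u≢v _ a b) (cong (_xor isE u v a b)
        (trans (adj-flip₂ x≢y _ a b) (cong (_xor isE x y a b)
          (trans (adj-flip₂ u≢x _ a b) (cong (_xor isE u x a b) (adj-flip₂ v≢y G a b))))))

      adj-away : ∀ {a b} → isE u v a b ≡ false → isE x y a b ≡ false → isE u x a b ≡ false → isE v y a b ≡ false →
        adj (switch u v x y G) a b ≡ adj G a b
      adj-away {a} {b} h₁ h₂ h₃ h₄ = trans (adj-switch a b) lem
        where
        bool : ∀ e → (((e xor false) xor false) xor false) xor false ≡ e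
        bool true = refl
        bool false = refl
        lem : (((adj G a b xor isE v y a b) xor isE u x a b) xor isE x y a b) xor isE u v a b ≡ adj G a b
        lem rewrite h₁ | h₂ | h₃ | h₄ = bool (adj G a b)

      -- For distinct u, v, x, y the four toggled pairs are different, so at most one toggle acts on
      -- a given entry: five of the sixteen outcomes of the four tests remain.
      data Place (a b : Fin n) : Set where
        at-uv : isE u v a b ≡ true → isE x y a b ≡ false → isE u x a b ≡ false → isE v y a b ≡ false → Place a b
        at-xy : isE u v a b ≡ false → isE x y a b ≡ true → isE u x a b ≡ false → isE v y a b ≡ false → Place a b
        at-ux : isE u v a b ≡ false → isE x y a b ≡ false → isE u x a b ≡ true → isE v y a b ≡ false → Place a b
        at-vy : isE u v a b ≡ false → isE x y a b ≡ false → isE u x a b ≡ false → isE v y a b ≡ true → Place a b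
        away  : isE u v a b ≡ false → isE x y a b ≡ false → isE u x a b ≡ false → isE v y a b ≡ false → Place a b

      apart : ∀ {p q r s a b : Fin n} → isE p q a b ≡ true → ¬ SamePair p q r s → isE r s a b ≡ false
      apart {p} {q} {r} {s} e k = isE-false⁺ λ z → k (lem (isE-true⁻ e) z)
        where
        lem : ∀ {a b} → SamePair p q a b → SamePair r s a b → SamePair p q r s
        lem (inj₁ (refl , refl)) (inj₁ (refl , refl)) = inj₁ (refl , refl)
        lem (inj₁ (refl , refl)) (inj₂ (refl , refl)) = inj₂ (refl , refl)
        lem (inj₂ (refl , refl)) (inj₁ (refl , refl)) = inj₂ (refl , refl)
        lem (inj₂ (refl , refl)) (inj₂ (refl , refl)) = inj₁ (refl , refl)

      ¬same₁ : ∀ {p q r s : Fin n} → r ≢ p → r ≢ q → ¬ SamePair p q r s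
      ¬same₁ h k (inj₁ (e , _)) = h e
      ¬same₁ h k (inj₂ (e , _)) = k e

      ¬same₂ : ∀ {p q r s : Fin n} → s ≢ p → s ≢ q → ¬ SamePair p q r s
      ¬same₂ h k (inj₁ (_ , e)) = k e
      ¬same₂ h k (inj₂ (_ , e)) = h e

      place : ∀ a b → Place a b
      place a b with isE u v a b in e₁
      ... | true = at-uv e₁ (apart e₁ (¬same₁ (≢-sym u≢x) (≢-sym v≢x))) (apart e₁ (¬same₂ (≢-sym u≢x) (≢-sym v≢x)))
                     (apart e₁ (¬same₂ (≢-sym u≢y) (≢-sym v≢y)))
      ... | false with isE x y a b in e₂
      ...   | true = at-xy e₁ e₂ (apart e₂ (¬same₁ u≢x u≢y)) (apart e₂ (¬same₁ v≢x v≢y))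
      ...   | false with isE u x a b in e₃
      ...     | true = at-ux e₁ e₂ e₃ (apart e₃ (¬same₁ (≢-sym u≢v) v≢x))
      ...     | false with isE v y a b in e₄
      ...       | true = at-vy e₁ e₂ e₃ e₄
      ...       | false = away e₁ e₂ e₃ e₄

      module Switched
        (adj-sym : ∀ a b → adj G a b ≡ adj G b a)
        (uv : adj G u v ≡ true) (xy : adj G x y ≡ true) (ux : adj G u x ≡ false) (vy : adj G v y ≡ false) where

        adj-same : ∀ {p q a b c} → isE p q a b ≡ true → adj G p q ≡ c → adj G a b ≡ c
        adj-same {p} {q} {a} {b} e h with isE-true⁻ {p} {q} {a} {b} e
        ... | inj₁ (refl , refl) = h
        ... | inj₂ (refl , refl) = trans (adj-sym q p) h

        ⟦adj-switch⟧ : ∀ a b → ⟦ adj (switch u v x y G) a b ⟧ ≡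
          ⟦ adj G a b ⟧ + ((⟦ isE u x a b ⟧ + ⟦ isE v y a b ⟧) - (⟦ isE u v a b ⟧ + ⟦ isE x y a b ⟧))
        ⟦adj-switch⟧ a b with place a b
        ... | at-uv h₁ h₂ h₃ h₄ rewrite adj-switch a b | h₁ | h₂ | h₃ | h₄ | adj-same h₁ uv = toggle-uv
        ... | at-xy h₁ h₂ h₃ h₄ rewrite adj-switch a b | h₁ | h₂ | h₃ | h₄ | adj-same h₂ xy = toggle-xy
        ... | at-ux h₁ h₂ h₃ h₄ rewrite adj-switch a b | h₁ | h₂ | h₃ | h₄ | adj-same h₃ ux = toggle-ux
        ... | at-vy h₁ h₂ h₃ h₄ rewrite adj-switch a b | h₁ | h₂ | h₃ | h₄ | adj-same h₄ vy = toggle-vy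
        ... | away h₁ h₂ h₃ h₄ rewrite adj-away h₁ h₂ h₃ h₄ | h₁ | h₂ | h₃ | h₄ = toggle-none (adj G a b)

        uv-gone : adj (switch u v x y G) u v ≡ false
        uv-gone with place u v
        ... | at-uv h₁ h₂ h₃ h₄ rewrite adj-switch u v | h₁ | h₂ | h₃ | h₄ | uv = refl
        ... | at-xy h₁ _ _ _ = true≢false (isE-true⁺ (inj₁ (refl , refl))) h₁
        ... | at-ux h₁ _ _ _ = true≢false (isE-true⁺ (inj₁ (refl , refl))) h₁
        ... | at-vy h₁ _ _ _ = true≢false (isE-true⁺ (inj₁ (refl , refl))) h₁
        ... | away h₁ _ _ _ = true≢false (isE-true⁺ (inj₁ (refl , refl))) h₁

        xy-gone : adj (switch u v x y G) x y ≡ false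
        xy-gone with place x y
        ... | at-xy h₁ h₂ h₃ h₄ rewrite adj-switch x y | h₁ | h₂ | h₃ | h₄ | xy = refl
        ... | at-uv _ h₂ _ _ = true≢false (isE-true⁺ (inj₁ (refl , refl))) h₂
        ... | at-ux _ h₂ _ _ = true≢false (isE-true⁺ (inj₁ (refl , refl))) h₂
        ... | at-vy _ h₂ _ _ = true≢false (isE-true⁺ (inj₁ (refl , refl))) h₂
        ... | away _ h₂ _ _ = true≢false (isE-true⁺ (inj₁ (refl , refl))) h₂

        ux-new : adj (switch u v x y G) u x ≡ true
        ux-new with place u x
        ... | at-ux h₁ h₂ h₃ h₄ rewrite adj-switch u x | h₁ | h₂ | h₃ | h₄ | ux = refl
        ... | at-uv _ _ h₃ _ = true≢false (isE-true⁺ (inj₁ (refl , refl))) h₃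
        ... | at-xy _ _ h₃ _ = true≢false (isE-true⁺ (inj₁ (refl , refl))) h₃
        ... | at-vy _ _ h₃ _ = true≢false (isE-true⁺ (inj₁ (refl , refl))) h₃
        ... | away _ _ h₃ _ = true≢false (isE-true⁺ (inj₁ (refl , refl))) h₃

        vy-new : adj (switch u v x y G) v y ≡ true
        vy-new with place v y
        ... | at-vy h₁ h₂ h₃ h₄ rewrite adj-switch v y | h₁ | h₂ | h₃ | h₄ | vy = refl
        ... | at-uv _ _ _ h₄ = true≢false (isE-true⁺ (inj₁ (refl , refl))) h₄
        ... | at-xy _ _ _ h₄ = true≢false (isE-true⁺ (inj₁ (refl , refl))) h₄
        ... | at-ux _ _ _ h₄ = true≢false (isE-true⁺ (inj₁ (refl , refl))) h₄
        ... | away _ _ _ h₄ = true≢false (isE-true⁺ (inj₁ (refl , refl))) h₄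

        -- By `⟦adj-switch⟧` the change of an entry is additive, and in the row sum each of u, v, x,
        -- y is added once and subtracted once.
        degree-switch : ∀ a → ∑ (λ b → ⟦ adj (switch u v x y G) a b ⟧) ≡ ∑ (λ b → ⟦ adj G a b ⟧)
        degree-switch a = begin
          ∑ (λ b → ⟦ adj (switch u v x y G) a b ⟧)
            ≡⟨ sum-cong (allFin n) (⟦adj-switch⟧ a) ⟩
          ∑ (λ b → ⟦ adj G a b ⟧ + ((⟦ isE u x a b ⟧ + ⟦ isE v y a b ⟧) - (⟦ isE u v a b ⟧ + ⟦ isE x y a b ⟧)))
            ≡⟨ trans (sum-+ _ _ (allFin n)) (cong (_ +_) (trans (sum-- _ _ (allFin n)) (cong₂ _-_ (sum-+ _ _ (allFin n)) (sum-+ _ _ (allFin n))))) ⟩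
          ∑ (λ b → ⟦ adj G a b ⟧) + ((∑ (λ b → ⟦ isE u x a b ⟧) + ∑ (λ b → ⟦ isE v y a b ⟧)) - (∑ (λ b → ⟦ isE u v a b ⟧) + ∑ (λ b → ⟦ isE x y a b ⟧)))
            ≡⟨ cong (_ +_) (cong₂ _-_ (cong₂ _+_ (∑-isE u≢x a) (∑-isE v≢y a)) (cong₂ _+_ (∑-isE u≢v a) (∑-isE x≢y a))) ⟩
          ∑ (λ b → ⟦ adj G a b ⟧) + (((δ a u + δ a x) + (δ a v + δ a y)) - ((δ a u + δ a v) + (δ a x + δ a y)))
            ≡⟨ cancel-δ _ (δ a u) (δ a v) (δ a x) (δ a y) ⟩
          ∑ (λ b → ⟦ adj G a b ⟧) ∎
          where open ≡-Reasoning

  -- A class of graphs w in which the pairs of H have a fixed status; d counts the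
  -- neighbours through pairs outside H. Conditioning on one more pair stays within
  -- this notion: delete conditions on pq being absent, contract on pq being present.
  record Instance (n : ℕ) : Set where
    field
      w : Adj n → Bool
      H : Fin n → Fin n → Bool
      d : Fin n → ℕ
      H-sym : ∀ x y → H x y ≡ H y x
      H-irr : ∀ x → H x x ≡ false
      G-sym : ∀ G → w G ≡ true → ∀ x y → adj G x y ≡ adj G y x
      G-irr : ∀ G → w G ≡ true → ∀ x → adj G x x ≡ false
      rows  : ∀ G → w G ≡ true → ∀ x → ∑ (λ y → ⟦ adj G x y ∧ not (H x y) ⟧) ≡ ι (d x)
      switchable : ∀ G u v x y → Distinct₄ u v x y →
        H u v ≡ false → H x y ≡ false → H u x ≡ false → H v y ≡ false → w G ≡ true →
        adj G u v ≡ true → adj G x y ≡ true → adj G u x ≡ false → adj G v y ≡ false →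
        w (switch u v x y G) ≡ true

  lower : ∀ {n} → (Fin n → ℕ) → Fin n → Fin n → Fin n → ℕ
  lower d p q x = if (x == p) ∨ (x == q) then d x ∸ 1 else d x

  module _ {n : ℕ} (I : Instance n) (p q : Fin n) (p≢q : p ≢ q) where
    open Instance I

    private
      H⁺ : Fin n → Fin n → Bool
      H⁺ x y = H x y ∨ isE p q x y

      H⁺-sym : ∀ x y → H⁺ x y ≡ H⁺ y x
      H⁺-sym x y = cong₂ _∨_ (H-sym x y) (isE-sym p q x y)

      H⁺-irr : ∀ x → H⁺ x x ≡ false
      H⁺-irr x rewrite H-irr x = isE-false⁺ λ { (inj₁ (a , b)) → p≢q (trans (sym a) b) ; (inj₂ (a , b)) → p≢q (trans (sym b) a) }

      switch-pq : ∀ G u v x y → Distinct₄ u v x y →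
        H⁺ u v ≡ false → H⁺ x y ≡ false → H⁺ u x ≡ false → H⁺ v y ≡ false →
        adj (switch u v x y G) p q ≡ adj G p q
      switch-pq G u v x y D h₁ h₂ h₃ h₄ = Switch.adj-away D G (f h₁) (f h₂) (f h₃) (f h₄)
        where
        f : ∀ {r s} → H⁺ r s ≡ false → isE r s p q ≡ false
        f {r} {s} h = isE-flip (proj₂ (∨-false⁻ {H r s} h))

      weaken : ∀ {r s} → H⁺ r s ≡ false → H r s ≡ false
      weaken h = proj₁ (∨-false⁻ h)

    -- Degrees stay as they are: in this class `pq` is no edge, so moving it into `H` takes nothing
    -- away from any row.
    delete : Instance n
    delete = record
      { w = λ G → w G ∧ not (adj G p q)
      ; H = H⁺
      ; d = d
      ; H-sym = H⁺-sym
      ; H-irr = H⁺-irr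
      ; G-sym = λ G h → G-sym G (proj₁ (∧-true⁻ h))
      ; G-irr = λ G h → G-irr G (proj₁ (∧-true⁻ h))
      ; rows = λ G h x → trans (sum-cong (allFin n) (row G h x)) (rows G (proj₁ (∧-true⁻ h)) x)
      ; switchable = λ G u v x y D h₁ h₂ h₃ h₄ wG e₁ e₂ e₃ e₄ →
          ∧-true⁺ (switchable G u v x y D (weaken h₁) (weaken h₂) (weaken h₃) (weaken h₄) (proj₁ (∧-true⁻ wG)) e₁ e₂ e₃ e₄)
                  (trans (cong not (switch-pq G u v x y D h₁ h₂ h₃ h₄)) (proj₂ (∧-true⁻ {w G} wG)))
      }
      where
      no-edge : ∀ G → w G ∧ not (adj G p q) ≡ true → ∀ {x y} → SamePair p q x y → adj G x y ≡ false
      no-edge G h (inj₁ (refl , refl)) = not-true⁻ (proj₂ (∧-true⁻ {w G} h))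
      no-edge G h (inj₂ (refl , refl)) = trans (G-sym G (proj₁ (∧-true⁻ h)) q p) (not-true⁻ (proj₂ (∧-true⁻ {w G} h)))

      row : ∀ G → w G ∧ not (adj G p q) ≡ true → ∀ x y → ⟦ adj G x y ∧ not (H⁺ x y) ⟧ ≡ ⟦ adj G x y ∧ not (H x y) ⟧
      row G h x y with isE p q x y in e
      ... | false = cong (λ t → ⟦ adj G x y ∧ not t ⟧) (∨-identityʳ (H x y))
      ... | true rewrite no-edge G h (isE-true⁻ e) = refl

    -- The edge `pq` moves into `H`, which costs p and q one degree each. Switchings touch no pair
    -- of `H`, so the condition that `pq` is present survives them.
    contract : H p q ≡ false → Instance n
    contract Hpq = record
      { w = λ G → w G ∧ adj G p q
      ; H = H⁺
      ; d = lower d p q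
      ; H-sym = H⁺-sym
      ; H-irr = H⁺-irr
      ; G-sym = λ G h → G-sym G (proj₁ (∧-true⁻ h))
      ; G-irr = λ G h → G-irr G (proj₁ (∧-true⁻ h))
      ; rows = row
      ; switchable = λ G u v x y D h₁ h₂ h₃ h₄ wG e₁ e₂ e₃ e₄ →
          ∧-true⁺ (switchable G u v x y D (weaken h₁) (weaken h₂) (weaken h₃) (weaken h₄) (proj₁ (∧-true⁻ wG)) e₁ e₂ e₃ e₄)
                  (trans (switch-pq G u v x y D h₁ h₂ h₃ h₄) (proj₂ (∧-true⁻ {w G} wG)))
      }
      where
      module _ (G : Adj n) (h : w G ∧ adj G p q ≡ true) (x : Fin n) where
        wG : w G ≡ true
        wG = proj₁ (∧-true⁻ h)

        pq : adj G p q ≡ true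
        pq = proj₂ (∧-true⁻ {w G} h)

        present : ∀ {y} → SamePair p q x y → adj G x y ≡ true
        present (inj₁ (refl , refl)) = pq
        present (inj₂ (refl , refl)) = trans (G-sym G wG q p) pq

        free : ∀ {y} → SamePair p q x y → H x y ≡ false
        free (inj₁ (refl , refl)) = Hpq
        free (inj₂ (refl , refl)) = trans (H-sym q p) Hpq

        split : ∀ y → ⟦ adj G x y ∧ not (H⁺ x y) ⟧ ≡ ⟦ adj G x y ∧ not (H x y) ⟧ - ⟦ isE p q x y ⟧
        split y with isE p q x y in e
        ... | false = trans (cong (λ t → ⟦ adj G x y ∧ not t ⟧) (∨-identityʳ (H x y))) (sym (trans (cong (λ t → ⟦ adj G x y ∧ not (H x y) ⟧ - t) ⟦false⟧) (x-0≡x _)))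
        ... | true rewrite present (isE-true⁻ e) | free (isE-true⁻ e) = minus-true

        total : ∑ (λ y → ⟦ adj G x y ∧ not (H⁺ x y) ⟧) ≡ ι (d x) - (δ x p + δ x q)
        total = trans (sum-cong (allFin n) split) (trans (sum-- _ _ (allFin n)) (cong₂ _-_ (rows G wG x) (∑-isE p≢q x)))

        -- A sum of indicators cannot be negative, so the existence of one graph in the class forces
        -- the degrees of p and q to be at least 1, and the truncated subtraction in `lower` is
        -- exact.
        total≥0 : 0ℚ ≤ ι (d x) - (δ x p + δ x q)
        total≥0 = subst (0ℚ ≤_) total (sum-nonneg (allFin n) (λ y → ⟦⟧≥0 _))

        row : ∑ (λ y → ⟦ adj G x y ∧ not (H⁺ x y) ⟧) ≡ ι (lower d p q x)
        row = trans total (go total≥0)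
          where
          go : 0ℚ ≤ ι (d x) - (δ x p + δ x q) → ι (d x) - (δ x p + δ x q) ≡ ι (lower d p q x)
          go h with x FP.≟ p
          ... | yes refl rewrite ==-refl x | ==-≢ p≢q = trans (drop-left (ι (d x))) (drop-one (d x) (subst (0ℚ ≤_) (drop-left (ι (d x))) h))
          ... | no k rewrite ==-≢ k with x FP.≟ q
          ...   | yes refl rewrite ==-refl x = trans (drop-right (ι (d x))) (drop-one (d x) (subst (0ℚ ≤_) (drop-right (ι (d x))) h))
          ...   | no k′ rewrite ==-≢ k′ = drop-none (ι (d x)) 

-- Unnormalised expectations over a class, and the exact switching identity.

module Expectations where
  open Arithmetic
  open Switching

  infixl 6 _⊞_
  infixl 7 _⊠_

  opaque
    unfolding _+_ _*_ _-_ -_ ι ⟦_⟧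

    _⊞_ : ∀ {a b} → a ≡ 0ℚ → b ≡ 0ℚ → a + b ≡ 0ℚ
    refl ⊞ refl = refl

    _⊠_ : ∀ k {a b} → a ≡ b → k * (a - b) ≡ 0ℚ
    _⊠_ k {a} refl = solve (k ∷ a ∷ []) ℚ-ring

    -- Equational counterpart of `certify`: the difference of the two sides is a combination, built
    -- with `_⊠_` and `_⊞_`, of known equations with polynomial multipliers.
    equate : ∀ {t a b} → t ≡ 0ℚ → a - b ≡ t → a ≡ b
    equate {a = a} {b} refl e = trans (lem a b) (trans (cong (ℚ._+ b) e) (ℚP.+-identityˡ b))
      where
      lem : ∀ a b → a ≡ (a ℚ.- b) ℚ.+ b
      lem = solve-∀ ℚ-ring

    -- Beside a, the factor 1 - s is redundant because s excludes a; the factor 1 - t is redundant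
    -- because a agrees with e wherever t holds, and 1 - e is already present.
    absorb : ∀ s t a e → s * a ≡ 0ℚ → t * a ≡ t * e → e * e ≡ e → a * (1ℚ - s) * (1ℚ - t) * (1ℚ - e) ≡ a * (1ℚ - e)
    absorb s t a e p q r = equate ((- ((1ℚ - t) * (1ℚ - e))) ⊠ p ⊞ (- (1ℚ - e)) ⊠ q ⊞ t ⊠ r) (solve (s ∷ t ∷ a ∷ e ∷ []) ℚ-ring)

    complement : ∀ a h → 1ℚ - (a * (1ℚ - h) + h) ≡ (1ℚ - a) * (1ℚ - h)
    complement = solve-∀ ℚ-ring

    left-regroup : ∀ A B C E F P Q S k l s t → (A * (B * (C * (E * (F * (P * (Q * S))))))) * (k * (l * (s * t)))
      ≡ k * ((A * B) * (C * E) * (F * l * S) * ((s * P) * (t * Q)))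
    left-regroup = solve-∀ ℚ-ring

    left-absorb : ∀ s t → s * t ≡ 0ℚ → (1ℚ - s) * t ≡ t
    left-absorb s t z = equate ((- 1ℚ) ⊠ z) (solve (s ∷ t ∷ []) ℚ-ring)

    right-group : ∀ A B C E F P Q S s t k l → (A * (B * (C * (E * (F * (P * (Q * S))))))) * (s * (t * (k * l)))
      ≡ (s * A * B * k) * ((t * E * C) * (P * Q) * (F * S * l))
    right-group = solve-∀ ℚ-ring

    right-regroup : ∀ t E C k u v w → (w * k) * ((t * E * C) * u * v) ≡ (t * E * C * k) * (w * u * v)
    right-regroup = solve-∀ ℚ-ring

    right-last : ∀ t k s P Q F S l → (t * k) * (s * (P * Q) * (F * S * l)) ≡ k * ((s * P) * (t * Q) * (F * (l * S)))
    right-last = solve-∀ ℚ-ring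

    -- The obstructions x = y, xy an edge outside H, and xy in H exclude one another, so their joint
    -- negation is linear. This is why `R` later splits into three plain counts.
    right-absorb : ∀ δ a h → δ * a ≡ 0ℚ → δ * h ≡ 0ℚ → (1ℚ - δ) * ((1ℚ - a) * (1ℚ - h)) ≡ (1ℚ - δ) - (a * (1ℚ - h) + h)
    right-absorb δ a h z z′ = equate ((1ℚ - h) ⊠ z ⊞ 1ℚ ⊠ z′) (solve (δ ∷ a ∷ h ∷ []) ℚ-ring)

  left-term : ∀ xp xq yp yq xy hpx hqy hxy apq axy apx aqy → xy * axy ≡ 0ℚ →
    ((1ℚ - xp) * ((1ℚ - xq) * ((1ℚ - yp) * ((1ℚ - yq) * ((1ℚ - xy) * ((1ℚ - hpx) * ((1ℚ - hqy) * (1ℚ - hxy)))))))) *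
      (apq * (axy * ((1ℚ - apx) * (1ℚ - aqy))))
    ≡ apq * (((1ℚ - xp) * (1ℚ - xq)) * ((1ℚ - yp) * (1ℚ - yq)) * (axy * (1ℚ - hxy)) *
        ((1ℚ - (apx * (1ℚ - hpx) + hpx)) * (1ℚ - (aqy * (1ℚ - hqy) + hqy))))
  left-term xp xq yp yq xy hpx hqy hxy apq axy apx aqy z =
    trans (left-regroup _ _ _ _ _ _ _ _ apq axy _ _)
      (cong₂ (λ s t → apq * (((1ℚ - xp) * (1ℚ - xq)) * ((1ℚ - yp) * (1ℚ - yq)) * (s * (1ℚ - hxy)) * t)) (left-absorb xy axy z)
        (sym (cong₂ _*_ (complement apx hpx) (complement aqy hqy))))

  -- Of the five distinctness conditions only x ≠ y survives: the edges px and qy exclude x = p and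
  -- y = q, and the absence of pq excludes x = q and y = p.
  right-term : ∀ xp xq yp yq xy hpx hqy hxy apq axy apx aqy → xy * axy ≡ 0ℚ → xy * hxy ≡ 0ℚ →
    xp * apx ≡ 0ℚ → xq * apx ≡ xq * apq → yq * aqy ≡ 0ℚ → yp * aqy ≡ yp * apq → apq * apq ≡ apq →
    ((1ℚ - xp) * ((1ℚ - xq) * ((1ℚ - yp) * ((1ℚ - yq) * ((1ℚ - xy) * ((1ℚ - hpx) * ((1ℚ - hqy) * (1ℚ - hxy)))))))) *
      (apx * (aqy * ((1ℚ - apq) * (1ℚ - axy))))
    ≡ (1ℚ - apq) * ((apx * (1ℚ - hpx)) * (aqy * (1ℚ - hqy)) * ((1ℚ - xy) - (axy * (1ℚ - hxy) + hxy)))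
  right-term xp xq yp yq xy hpx hqy hxy apq axy apx aqy z z′ f₁ f₂ f₃ f₄ f₅ =
    trans (right-group _ _ _ _ _ _ _ _ apx aqy _ _)
    (trans (cong (_* _) (absorb xp xq apx apq f₁ f₂ f₅))
    (trans (right-regroup aqy _ _ _ _ _ apx)
    (trans (cong (_* _) (absorb yq yp aqy apq f₃ f₄ f₅))
    (trans (right-last aqy _ apx _ _ _ _ _)
      (cong (λ t → (1ℚ - apq) * ((apx * (1ℚ - hpx)) * (aqy * (1ℚ - hqy)) * t)) (right-absorb xy axy hxy z z′))))))

  module Expectation {n : ℕ} (I : Instance n) where
    open Instance I public

    a b c : Adj n → Fin n → Fin n → ℚ
    a G x y = ⟦ adj G x y ⟧
    b G x y = ⟦ adj G x y ∧ not (H x y) ⟧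

    h : Fin n → Fin n → ℚ
    h x y = ⟦ H x y ⟧

    c G x y = b G x y + h x y

    deg⁻ : Fin n → ℚ
    deg⁻ x = ι (d x)

    m : ℚ
    m = ∑ deg⁻

    -- Not divided by the size `N` of the class: conditioning on an edge is then just multiplication
    -- by its indicator.
    𝔼 : (Adj n → ℚ) → ℚ
    𝔼 f = sum (λ G → ⟦ w G ⟧ * f G) (allAdj n)

    N : ℚ
    N = 𝔼 (λ _ → 1ℚ)

    𝔼-cong : ∀ {f g} → (∀ G → w G ≡ true → f G ≡ g G) → 𝔼 f ≡ 𝔼 g
    𝔼-cong {f} {g} e = sum-cong (allAdj n) pointwise
      where
      pointwise : ∀ G → ⟦ w G ⟧ * f G ≡ ⟦ w G ⟧ * g G
      pointwise G with w G in wG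
      ... | true = cong (⟦ true ⟧ *_) (e G wG)
      ... | false rewrite ⟦false⟧ = trans (*-zeroˡ (f G)) (sym (*-zeroˡ (g G)))

    𝔼-mono : ∀ {f g} → (∀ G → w G ≡ true → f G ≤ g G) → 𝔼 f ≤ 𝔼 g
    𝔼-mono {f} {g} e = sum-mono (allAdj n) pointwise
      where
      pointwise : ∀ G → ⟦ w G ⟧ * f G ≤ ⟦ w G ⟧ * g G
      pointwise G with w G in wG
      ... | true = *-monoˡ (⟦⟧≥0 true) (e G wG)
      ... | false rewrite ⟦false⟧ = ≤-reflexive (trans (*-zeroˡ (f G)) (sym (*-zeroˡ (g G))))

    𝔼-+ : ∀ f g → 𝔼 (λ G → f G + g G) ≡ 𝔼 f + 𝔼 g
    𝔼-+ f g = trans (sum-cong (allAdj n) (λ G → *-distribˡ-+ ⟦ w G ⟧ (f G) (g G))) (sum-+ _ _ (allAdj n))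

    𝔼-*ˡ : ∀ k f → 𝔼 (λ G → k * f G) ≡ k * 𝔼 f
    𝔼-*ˡ k f = trans (sum-cong (allAdj n) (λ G → lem ⟦ w G ⟧ k (f G))) (sum-*ˡ k _ (allAdj n))
      where
      lem : ∀ x y z → x * (y * z) ≡ y * (x * z)
      lem x y z = trans (sym (*-assoc x y z)) (trans (cong (_* z) (*-comm x y)) (*-assoc y x z))

    𝔼-0 : 𝔼 (λ _ → 0ℚ) ≡ 0ℚ
    𝔼-0 = trans (sum-cong (allAdj n) (λ G → *-zeroʳ ⟦ w G ⟧)) (sum-0 (allAdj n))

    𝔼-nonneg : ∀ {f} → (∀ G → w G ≡ true → 0ℚ ≤ f G) → 0ℚ ≤ 𝔼 f
    𝔼-nonneg {f} e = subst (_≤ 𝔼 f) 𝔼-0 (𝔼-mono e)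

    𝔼-const : ∀ k → 𝔼 (λ _ → k) ≡ k * N
    𝔼-const k = trans (𝔼-cong (λ G _ → sym (*-identityʳ k))) (𝔼-*ˡ k (λ _ → 1ℚ))

    𝔼-*ʳ : ∀ k f → 𝔼 (λ G → f G * k) ≡ k * 𝔼 f
    𝔼-*ʳ k f = trans (𝔼-cong (λ G _ → *-comm (f G) k)) (𝔼-*ˡ k f)

    𝔼-sum : ∀ {A : Set} (f : A → Adj n → ℚ) xs → 𝔼 (λ G → sum (λ x → f x G) xs) ≡ sum (λ x → 𝔼 (f x)) xs
    𝔼-sum f xs = trans (sum-cong (allAdj n) (λ G → sym (sum-*ˡ ⟦ w G ⟧ (λ x → f x G) xs))) (sum-swap (λ G x → ⟦ w G ⟧ * f x G) (allAdj n) xs)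

    𝔼-∑∑ : (f : Fin n → Fin n → Adj n → ℚ) → 𝔼 (λ G → ∑ λ x → ∑ λ y → f x y G) ≡ (∑ λ x → ∑ λ y → 𝔼 (f x y))
    𝔼-∑∑ f = trans (𝔼-sum (λ x G → ∑ λ y → f x y G) (allFin n)) (sum-cong (allFin n) (λ x → 𝔼-sum (f x) (allFin n)))

    N≥0 : 0ℚ ≤ N
    N≥0 = 𝔼-nonneg (λ _ _ → 0≤1)

    b≡a*[1-h] : ∀ G x y → b G x y ≡ a G x y * (1ℚ - h x y)
    b≡a*[1-h] G x y = trans (⟦∧⟧ (adj G x y) (not (H x y))) (cong (a G x y *_) (⟦not⟧ (H x y)))

    b≡a : ∀ G {x y} → H x y ≡ false → b G x y ≡ a G x y
    b≡a G {x} {y} e rewrite e = cong ⟦_⟧ (∧-identityʳ (adj G x y))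

    b≡0 : ∀ G {x y} → H x y ≡ true → b G x y ≡ 0ℚ
    b≡0 G {x} {y} e rewrite e = trans (cong ⟦_⟧ (∧-zeroʳ (adj G x y))) ⟦false⟧

    b-sym : ∀ G → w G ≡ true → ∀ x y → b G x y ≡ b G y x
    b-sym G wG x y = cong₂ (λ s t → ⟦ s ∧ not t ⟧) (G-sym G wG x y) (H-sym x y)

    b-irr : ∀ G → w G ≡ true → ∀ x → b G x x ≡ 0ℚ
    b-irr G wG x rewrite G-irr G wG x = ⟦false⟧

    h-irr : ∀ x → h x x ≡ 0ℚ
    h-irr x = trans (cong ⟦_⟧ (H-irr x)) ⟦false⟧

    b≥0 : ∀ G x y → 0ℚ ≤ b G x y
    b≥0 G x y = ⟦⟧≥0 _

    b≤1 : ∀ G x y → b G x y ≤ 1ℚ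
    b≤1 G x y = ⟦⟧≤1 _

    h≥0 : ∀ x y → 0ℚ ≤ h x y
    h≥0 x y = ⟦⟧≥0 _

    deg⁻≥0 : ∀ x → 0ℚ ≤ deg⁻ x
    deg⁻≥0 x = # (d x)

    bh≡0 : ∀ G x y → b G x y * h x y ≡ 0ℚ
    bh≡0 G x y with H x y in e
    ... | true = trans (cong (λ t → ⟦ t ⟧ * ⟦ true ⟧) (∧-zeroʳ (adj G x y))) (trans (cong (_* ⟦ true ⟧) ⟦false⟧) (*-zeroˡ _))
    ... | false = trans (cong (⟦ adj G x y ∧ true ⟧ *_) ⟦false⟧) (*-zeroʳ _)

    -- c G x y is the indicator of the union of G and H.
    c≥0 : ∀ G x y → 0ℚ ≤ c G x y
    c≥0 G x y = b≥0 G x y ⊕ h≥0 x y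

    c≤1 : ∀ G x y → c G x y ≤ 1ℚ
    c≤1 G x y with H x y
    ... | true = ≤-reflexive (trans (cong₂ _+_ (trans (cong ⟦_⟧ (∧-zeroʳ (adj G x y))) ⟦false⟧) ⟦true⟧) (+-identityˡ 1ℚ))
    ... | false = ≤-resp (sym (trans (cong (⟦ adj G x y ∧ true ⟧ +_) ⟦false⟧) (+-identityʳ _))) refl (⟦⟧≤1 _)

    row-sum : ∀ G → w G ≡ true → ∀ x → ∑ (λ y → b G x y) ≡ deg⁻ x
    row-sum = rows

    col-sum : ∀ G → w G ≡ true → ∀ y → ∑ (λ x → b G x y) ≡ deg⁻ y
    col-sum G wG y = trans (sum-cong (allFin n) (λ x → b-sym G wG x y)) (rows G wG y)

    switchCount : Fin n → Fin n → Fin n → Fin n → ℚ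
    switchCount p q x y = sum (λ G → ⟦ w G ∧ (adj G p q ∧ (adj G x y ∧ (not (adj G p x) ∧ not (adj G q y)))) ⟧) (allAdj n)

    -- Switching sends the graphs counted on the left to graphs counted on the right. As it permutes
    -- all matrices, a pointwise comparison followed by reindexing takes the place of an injectivity
    -- argument.
    switchCount-≤ : ∀ {p q x y} → Distinct₄ p q x y → H p q ≡ false → H x y ≡ false → H p x ≡ false → H q y ≡ false →
      switchCount p q x y ≤ switchCount p x q y
    switchCount-≤ {p} {q} {x} {y} D h₁ h₂ h₃ h₄ = ≤-resp refl
      (switch-invariant p q x y (λ G → ⟦ w G ∧ (adj G p x ∧ (adj G q y ∧ (not (adj G p q) ∧ not (adj G x y)))) ⟧))
      (sum-mono (allAdj n) (λ G → ⟦⟧-mono (step G)))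
      where
      step : ∀ G → w G ∧ (adj G p q ∧ (adj G x y ∧ (not (adj G p x) ∧ not (adj G q y)))) ≡ true →
        let G′ = switch p q x y G in w G′ ∧ (adj G′ p x ∧ (adj G′ q y ∧ (not (adj G′ p q) ∧ not (adj G′ x y)))) ≡ true
      step G e = ∧-true⁺ (switchable G p q x y D h₁ h₂ h₃ h₄ wG e₁ e₂ e₃ e₄)
          (∧-true⁺ ux-new (∧-true⁺ vy-new (∧-true⁺ (cong not uv-gone) (cong not xy-gone))))
        where
        wG = proj₁ (∧-true⁻ {w G} e)
        r₁ = proj₂ (∧-true⁻ {w G} e)
        e₁ = proj₁ (∧-true⁻ {adj G p q} r₁)
        r₂ = proj₂ (∧-true⁻ {adj G p q} r₁)
        e₂ = proj₁ (∧-true⁻ {adj G x y} r₂)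
        r₃ = proj₂ (∧-true⁻ {adj G x y} r₂)
        e₃ = not-true⁻ (proj₁ (∧-true⁻ {not (adj G p x)} r₃))
        e₄ = not-true⁻ (proj₂ (∧-true⁻ {not (adj G p x)} r₃))
        open Switch.Switched D G (G-sym G wG) e₁ e₂ e₃ e₄

    module SwitchIdentity (p q : Fin n) (p≢q : p ≢ q) (Hpq : H p q ≡ false) where

      admissible : Fin n → Fin n → Bool
      admissible x y = not (x == p) ∧ (not (x == q) ∧ (not (y == p) ∧ (not (y == q) ∧ (not (x == y) ∧
        (not (H p x) ∧ (not (H q y) ∧ not (H x y)))))))

      ν : Fin n → ℚ
      ν x = (1ℚ - δ x p) * (1ℚ - δ x q)

      gate : Fin n → Fin n → ℚ
      gate x y = (1ℚ - δ x p) * ((1ℚ - δ x q) * ((1ℚ - δ y p) * ((1ℚ - δ y q) * ((1ℚ - δ x y) *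
        ((1ℚ - h p x) * ((1ℚ - h q y) * (1ℚ - h x y)))))))

      ⟦not∧⟧ : ∀ s t {z} → ⟦ t ⟧ ≡ z → ⟦ not s ∧ t ⟧ ≡ (1ℚ - ⟦ s ⟧) * z
      ⟦not∧⟧ s t e = trans (⟦∧⟧ (not s) t) (cong₂ _*_ (⟦not⟧ s) e)

      ⟦admissible⟧ : ∀ x y → ⟦ admissible x y ⟧ ≡ gate x y
      ⟦admissible⟧ x y = ⟦not∧⟧ _ _ (⟦not∧⟧ _ _ (⟦not∧⟧ _ _ (⟦not∧⟧ _ _ (⟦not∧⟧ _ _ (⟦not∧⟧ _ _ (⟦not∧⟧ _ _ (⟦not⟧ (H x y))))))))

      -- Exchanging q and x turns the switching into its inverse, so `switchCount-≤` applies in both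
      -- directions.
      switchCount-≡ : ∀ x y → gate x y * switchCount p q x y ≡ gate x y * switchCount p x q y
      switchCount-≡ x y rewrite sym (⟦admissible⟧ x y) with admissible x y in e
      ... | false rewrite ⟦false⟧ = trans (*-zeroˡ _) (sym (*-zeroˡ _))
      ... | true = cong (⟦ true ⟧ *_) (≤-antisym (switchCount-≤ (distinct₄ p≢q p≢x p≢y q≢x q≢y x≢y) Hpq hxy hpx hqy)
                                                 (switchCount-≤ (distinct₄ p≢x p≢q p≢y (≢-sym q≢x) x≢y q≢y) hpx hqy Hpq hxy))
        where
        r₁ = ∧-true⁻ {not (x == p)} e
        r₂ = ∧-true⁻ {not (x == q)} (proj₂ r₁)
        r₃ = ∧-true⁻ {not (y == p)} (proj₂ r₂)
        r₄ = ∧-true⁻ {not (y == q)} (proj₂ r₃)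
        r₅ = ∧-true⁻ {not (x == y)} (proj₂ r₄)
        r₆ = ∧-true⁻ {not (H p x)} (proj₂ r₅)
        r₇ = ∧-true⁻ {not (H q y)} (proj₂ r₆)
        p≢x = ≢-sym (==-false (not-true⁻ (proj₁ r₁)))
        q≢x = ≢-sym (==-false (not-true⁻ (proj₁ r₂)))
        p≢y = ≢-sym (==-false (not-true⁻ (proj₁ r₃)))
        q≢y = ≢-sym (==-false (not-true⁻ (proj₁ r₄)))
        x≢y = ==-false (not-true⁻ (proj₁ r₅))
        hpx = not-true⁻ (proj₁ r₆)
        hqy = not-true⁻ (proj₁ r₇)
        hxy = not-true⁻ (proj₂ r₇)

      gate-𝔼 : ∀ x y (s t u v : Adj n → Bool) → sum (λ G → ⟦ w G ∧ (s G ∧ (t G ∧ (not (u G) ∧ not (v G)))) ⟧) (allAdj n) * gate x y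
        ≡ 𝔼 (λ G → gate x y * (⟦ s G ⟧ * (⟦ t G ⟧ * ((1ℚ - ⟦ u G ⟧) * (1ℚ - ⟦ v G ⟧)))))
      gate-𝔼 x y s t u v = trans (*-comm _ _) (trans (cong (gate x y *_) (sum-cong (allAdj n) (λ G →
          trans (⟦∧⟧ (w G) (s G ∧ (t G ∧ (not (u G) ∧ not (v G))))) (cong (⟦ w G ⟧ *_)
            (trans (⟦∧⟧ (s G) (t G ∧ (not (u G) ∧ not (v G)))) (cong (⟦ s G ⟧ *_)
              (trans (⟦∧⟧ (t G) (not (u G) ∧ not (v G))) (cong (⟦ t G ⟧ *_) (⟦not∧⟧ (u G) (not (v G)) (⟦not⟧ (v G)))))))))))
        (sym (𝔼-*ˡ (gate x y) _)))

      -- On graphs containing pq, L counts the switchings pq, xy ↦ px, qy; on graphs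
      -- avoiding pq, R counts their inverses.
      L R : Adj n → ℚ
      L G = ∑ λ x → ∑ λ y → ν x * ν y * b G x y * ((1ℚ - c G p x) * (1ℚ - c G q y))
      R G = ∑ λ x → ∑ λ y → b G p x * b G q y * ((1ℚ - δ x y) - c G x y)

      module _ (G : Adj n) (wG : w G ≡ true) where

        a-irr : ∀ x → a G x x ≡ 0ℚ
        a-irr x = trans (cong ⟦_⟧ (G-irr G wG x)) ⟦false⟧

        a-sym : ∀ x y → a G x y ≡ a G y x
        a-sym x y = cong ⟦_⟧ (G-sym G wG x y)

        δa : ∀ x y → δ x y * a G x y ≡ 0ℚ
        δa x y = trans (δ-replace (λ z → a G z y) x y) (trans (cong (δ x y *_) (a-irr y)) (*-zeroʳ _))

        δh : ∀ x y → δ x y * h x y ≡ 0ℚ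
        δh x y = trans (δ-replace (λ z → h z y) x y) (trans (cong (δ x y *_) (h-irr y)) (*-zeroʳ _))

        left-pointwise : ∀ x y → gate x y * (a G p q * (a G x y * ((1ℚ - a G p x) * (1ℚ - a G q y))))
          ≡ b G p q * (ν x * ν y * b G x y * ((1ℚ - c G p x) * (1ℚ - c G q y)))
        left-pointwise x y rewrite b≡a*[1-h] G x y | b≡a*[1-h] G p x | b≡a*[1-h] G q y | b≡a G Hpq =
          left-term (δ x p) (δ x q) (δ y p) (δ y q) (δ x y) (h p x) (h q y) (h x y) (a G p q) (a G x y) (a G p x) (a G q y) (δa x y)

        right-pointwise : ∀ x y → gate x y * (a G p x * (a G q y * ((1ℚ - a G p q) * (1ℚ - a G x y))))
          ≡ (1ℚ - b G p q) * (b G p x * b G q y * ((1ℚ - δ x y) - c G x y))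
        right-pointwise x y rewrite b≡a*[1-h] G x y | b≡a*[1-h] G p x | b≡a*[1-h] G q y | b≡a G Hpq =
          right-term (δ x p) (δ x q) (δ y p) (δ y q) (δ x y) (h p x) (h q y) (h x y) (a G p q) (a G x y) (a G p x) (a G q y)
            (δa x y) (δh x y) (trans (cong (δ x p *_) (a-sym p x)) (δa x p)) (δ-replace (λ z → a G p z) x q)
            (trans (cong (δ y q *_) (a-sym q y)) (δa y q)) (trans (δ-replace (λ z → a G q z) y p) (cong (δ y p *_) (a-sym q p)))
            (⟦⟧-idem (adj G p q))

      -- Summed over all x and y, the counts equated by `switchCount-≡` become `L` on graphs
      -- containing pq and `R` on graphs avoiding it. No approximation enters.
      switch-identity : 𝔼 (λ G → b G p q * L G) ≡ 𝔼 (λ G → (1ℚ - b G p q) * R G)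
      switch-identity = begin
        𝔼 (λ G → b G p q * L G)
          ≡⟨ 𝔼-cong (λ G wG → trans (sym (∑∑-*ˡ (b G p q) _)) (∑∑-cong (λ x y → sym (left-pointwise G wG x y)))) ⟩
        𝔼 (λ G → ∑ λ x → ∑ λ y → gate x y * (a G p q * (a G x y * ((1ℚ - a G p x) * (1ℚ - a G q y)))))
          ≡⟨ 𝔼-∑∑ _ ⟩
        (∑ λ x → ∑ λ y → 𝔼 (λ G → gate x y * (a G p q * (a G x y * ((1ℚ - a G p x) * (1ℚ - a G q y))))))
          ≡⟨ ∑∑-cong (λ x y → trans (sym (gate-𝔼 x y (λ G → adj G p q) (λ G → adj G x y) (λ G → adj G p x) (λ G → adj G q y)))
               (trans (*-comm _ (gate x y)) (trans (switchCount-≡ x y) (trans (*-comm (gate x y) _)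
               (gate-𝔼 x y (λ G → adj G p x) (λ G → adj G q y) (λ G → adj G p q) (λ G → adj G x y)))))) ⟩
        (∑ λ x → ∑ λ y → 𝔼 (λ G → gate x y * (a G p x * (a G q y * ((1ℚ - a G p q) * (1ℚ - a G x y))))))
          ≡⟨ 𝔼-∑∑ _ ⟨
        𝔼 (λ G → ∑ λ x → ∑ λ y → gate x y * (a G p x * (a G q y * ((1ℚ - a G p q) * (1ℚ - a G x y)))))
          ≡⟨ 𝔼-cong (λ G wG → trans (∑∑-cong (λ x y → right-pointwise G wG x y)) (∑∑-*ˡ (1ℚ - b G p q) _)) ⟩
        𝔼 (λ G → (1ℚ - b G p q) * R G) ∎
        where
        open ≡-Reasoning
        ∑∑-cong : {f g : Fin n → Fin n → ℚ} → (∀ x y → f x y ≡ g x y) → (∑ λ x → ∑ λ y → f x y) ≡ (∑ λ x → ∑ λ y → g x y)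
        ∑∑-cong e = sum-cong (allFin n) (λ x → sum-cong (allFin n) (e x))
        ∑∑-*ˡ : ∀ k (f : Fin n → Fin n → ℚ) → (∑ λ x → ∑ λ y → k * f x y) ≡ k * (∑ λ x → ∑ λ y → f x y)
        ∑∑-*ˡ k f = trans (sum-cong (allFin n) (λ x → sum-*ˡ k (f x) (allFin n))) (sum-*ˡ k _ (allFin n)) 

-- First upper bound for the probability of one edge.

module UpperBounds where
  open Arithmetic
  open Switching
  open Expectations

  ∑∑ : ∀ {n} → (Fin n → Fin n → ℚ) → ℚ
  ∑∑ f = ∑ λ x → ∑ λ y → f x y

  module _ {n : ℕ} where

    ∑-cong : {f g : Fin n → ℚ} → (∀ x → f x ≡ g x) → ∑ f ≡ ∑ g
    ∑-cong = sum-cong (allFin n)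

    ∑-mono : {f g : Fin n → ℚ} → (∀ x → f x ≤ g x) → ∑ f ≤ ∑ g
    ∑-mono = sum-mono (allFin n)

    ∑-nonneg : {f : Fin n → ℚ} → (∀ x → 0ℚ ≤ f x) → 0ℚ ≤ ∑ f
    ∑-nonneg = sum-nonneg (allFin n)

    ∑-+ : (f g : Fin n → ℚ) → ∑ (λ x → f x + g x) ≡ ∑ f + ∑ g
    ∑-+ f g = sum-+ f g (allFin n)

    ∑-- : (f g : Fin n → ℚ) → ∑ (λ x → f x - g x) ≡ ∑ f - ∑ g
    ∑-- f g = sum-- f g (allFin n)

    ∑-*ˡ : ∀ k (f : Fin n → ℚ) → ∑ (λ x → k * f x) ≡ k * ∑ f
    ∑-*ˡ k f = sum-*ˡ k f (allFin n)

    ∑-*ʳ : ∀ k (f : Fin n → ℚ) → ∑ (λ x → f x * k) ≡ ∑ f * k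
    ∑-*ʳ k f = sum-*ʳ k f (allFin n)

    ∑∑-cong : {f g : Fin n → Fin n → ℚ} → (∀ x y → f x y ≡ g x y) → ∑∑ f ≡ ∑∑ g
    ∑∑-cong e = ∑-cong (λ x → ∑-cong (e x))

    ∑∑-mono : {f g : Fin n → Fin n → ℚ} → (∀ x y → f x y ≤ g x y) → ∑∑ f ≤ ∑∑ g
    ∑∑-mono e = ∑-mono (λ x → ∑-mono (e x))

    ∑∑-nonneg : {f : Fin n → Fin n → ℚ} → (∀ x y → 0ℚ ≤ f x y) → 0ℚ ≤ ∑∑ f
    ∑∑-nonneg e = ∑-nonneg (λ x → ∑-nonneg (e x))

    ∑∑-+ : (f g : Fin n → Fin n → ℚ) → ∑∑ (λ x y → f x y + g x y) ≡ ∑∑ f + ∑∑ g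
    ∑∑-+ f g = trans (∑-cong (λ x → ∑-+ (f x) (g x))) (∑-+ _ _)

    ∑∑-- : (f g : Fin n → Fin n → ℚ) → ∑∑ (λ x y → f x y - g x y) ≡ ∑∑ f - ∑∑ g
    ∑∑-- f g = trans (∑-cong (λ x → ∑-- (f x) (g x))) (∑-- _ _)

    ∑∑-*ˡ : ∀ k (f : Fin n → Fin n → ℚ) → ∑∑ (λ x y → k * f x y) ≡ k * ∑∑ f
    ∑∑-*ˡ k f = trans (∑-cong (λ x → ∑-*ˡ k (f x))) (∑-*ˡ k _)

    ∑∑-swap : (f : Fin n → Fin n → ℚ) → ∑∑ f ≡ ∑∑ (λ x y → f y x)
    ∑∑-swap f = sum-swap f (allFin n) (allFin n)

    ∑∑-× : (f g : Fin n → ℚ) → ∑∑ (λ x y → f x * g y) ≡ ∑ f * ∑ g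
    ∑∑-× f g = trans (∑-cong (λ x → ∑-*ˡ (f x) g)) (∑-*ʳ (∑ g) f)

  δ+δ≤1 : ∀ {n} {p q : Fin n} → p ≢ q → ∀ x → δ x p + δ x q ≤ 1ℚ
  δ+δ≤1 {p = p} {q} p≢q x with x FP.≟ p
  ... | yes refl = ≤-reflexive (trans (cong₂ _+_ (δ-refl x) (δ-≢ p≢q)) (+-identityʳ 1ℚ))
  ... | no h = ≤-resp (sym (trans (cong (_+ δ x q) (δ-≢ h)) (+-identityˡ _))) refl (⟦⟧≤1 _)

  δ≥0 : ∀ {n} (x y : Fin n) → 0ℚ ≤ δ x y
  δ≥0 x y = ⟦⟧≥0 _

  opaque
    unfolding _+_ _*_ _-_ -_ ι ⟦_⟧

    zero⁺ : ∀ {a} → a ≡ 0ℚ → 0ℚ ≤ a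
    zero⁺ e = ≤-reflexive (sym e)

    -- Bookkeeping for Π (1 - sᵢ) ≥ 1 - Σ sᵢ with all sᵢ in [0, 1].
    Under : ℚ → ℚ → Set
    Under X s = (0ℚ ≤ X × X ≤ 1ℚ) × 1ℚ - s ≤ X

    under-≥ : ∀ {X s} → Under X s → 1ℚ - s ≤ X
    under-≥ = proj₂

    under-≤ : ∀ {X s} → Under X s → X ≤ 1ℚ
    under-≤ u = proj₂ (proj₁ u)

    under-unit : ∀ {t} → 0ℚ ≤ t → t ≤ 1ℚ → Under (1ℚ - t) t
    under-unit {t} h k = (gap k , certify h (solve (t ∷ []) ℚ-ring)) , ≤-refl

    under-* : ∀ {X Y s t} → Under X s → Under Y t → Under (X * Y) (s + t)
    under-* {X} {Y} {s} {t} ((x0 , x1) , xs) ((y0 , y1) , yt) =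
      (x0 ⊗ y0 , certify (gap x1 ⊕ x0 ⊗ gap y1) (solve (X ∷ Y ∷ []) ℚ-ring)) ,
      certify (gap xs ⊕ gap yt ⊕ gap x1 ⊗ gap y1) (solve (X ∷ Y ∷ s ∷ t ∷ []) ℚ-ring)

    reorder-L : ∀ s t b u → s * t * b * u ≡ b * (s * t * u)
    reorder-L = solve-∀ ℚ-ring

    expand-1-+ : ∀ b f g → b * (1ℚ - (f + g)) ≡ b - (b * f + b * g)
    expand-1-+ = solve-∀ ℚ-ring

    L-lower-arith : ∀ D m X Y → 1ℚ ≤ D → X ≤ D * ((1ℚ + 1ℚ) + (D + D)) → Y ≤ D * ((1ℚ + 1ℚ) + (D + D)) → m - ι 8 * (D * D) ≤ m - (X + Y)
    L-lower-arith D m X Y D≥1 hX hY = certify (gap hX ⊕ gap hY ⊕ # 2 ⊗ (gap D≥1 ⊗ (0≤1 ⊕ gap D≥1)) ⊕ # 2 ⊗ (gap D≥1 ⊗ (0≤1 ⊕ gap D≥1)))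
      (solve (D ∷ m ∷ X ∷ Y ∷ []) ℚ-ring)

    R-term-split : ∀ δ b h s t → s * t * ((1ℚ - δ) - (b + h)) ≡ s * t - δ * (s * t) - h * (s * t) - s * (t * b)
    R-term-split = solve-∀ ℚ-ring

    -- With ε = D²r: since 8D² + 12 ≤ 20D², the factor m - 8D² is at least (1 - 20ε)m₀, and for ε ≤
    -- 1/1000 dividing by 1 - 20ε costs at most the factor 1 + 40ε.
    edge-up-arith : ∀ D m₀ r m P X → 1ℚ ≤ D → 0ℚ ≤ r → m₀ * r ≡ 1ℚ → ι 1000 * (D * D * r) ≤ 1ℚ → m₀ ≤ m + ι 12 → 0ℚ ≤ P →
      (m - ι 8 * (D * D)) * P ≤ X → P ≤ (1ℚ + ι 40 * (D * D * r)) * (r * X)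
    edge-up-arith D m₀ r m P X D≥1 r≥0 mr small m≥ P≥0 key = invert (D * D * r) P (r * X) (D≥0 ⊗ D≥0 ⊗ r≥0) P≥0 small
      (certify (r≥0 ⊗ gap key ⊕ r≥0 ⊗ P≥0 ⊗ gap m≥ ⊕ # 12 ⊗ (r≥0 ⊗ P≥0) ⊗ (gap D≥1 ⊗ D≥0 ⊕ gap D≥1) ⊕ zero⁺ (P ⊠ mr))
        (solve (D ∷ m₀ ∷ r ∷ m ∷ P ∷ X ∷ []) ℚ-ring))
      where
      D≥0 : 0ℚ ≤ D
      D≥0 = ≤-trans 0≤1 D≥1
      invert : ∀ ε P X → 0ℚ ≤ ε → 0ℚ ≤ P → ι 1000 * ε ≤ 1ℚ → (1ℚ - ι 20 * ε) * P ≤ X → P ≤ (1ℚ + ι 40 * ε) * X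
      invert ε P X e p s h = certify (((0≤1 ⊕ # 40 ⊗ e) ⊗ gap h) ⊕ # 20 ⊗ e ⊗ gap s ⊗ p ⊕ # 19200 ⊗ e ⊗ e ⊗ p) (solve (ε ∷ P ∷ X ∷ []) ℚ-ring)

  open Expectation

  -- D bounds the residual degrees and the degrees of H, and r = 1 / m₀.
  module Bounds (D m₀ r : ℚ) (D≥1 : 1ℚ ≤ D) (r≥0 : 0ℚ ≤ r) (m₀r≡1 : m₀ * r ≡ 1ℚ) (small : ι 1000 * (D * D * r) ≤ 1ℚ) where

    D≥0 : 0ℚ ≤ D
    D≥0 = ≤-trans 0≤1 D≥1

    ε : ℚ
    ε = D * D * r

    ε≥0 : 0ℚ ≤ ε
    ε≥0 = D≥0 ⊗ D≥0 ⊗ r≥0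

    -- k is the number of pairs that may still be conditioned on: each of them raises
    -- the degrees of H by at most 1 and lowers m by at most 2.
    record Bounded {n : ℕ} (I : Instance n) (k : ℕ) : Set where
      field
        deg≤  : ∀ x → deg⁻ I x ≤ D
        hdeg≤ : ∀ x → ∑ (h I x) + ι k ≤ D
        m≤    : m I ≤ m₀
        m≥    : m₀ + ι 2 * ι k ≤ m I + ι 12

    module FirstOrder {n : ℕ} (I : Instance n) {k : ℕ} (B : Bounded I k) where
      open Bounded B

      hdeg : Fin n → ℚ
      hdeg x = ∑ (h I x)

      hdeg≤D : ∀ x → hdeg x ≤ D
      hdeg≤D x = ≤-trans (≤-resp (+-identityʳ _) refl (+-mono-≤ ≤-refl (# k))) (hdeg≤ x)

      m₀≤m+12 : m₀ ≤ m I + ι 12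
      m₀≤m+12 = ≤-trans (≤-resp (+-identityʳ _) refl (+-mono-≤ ≤-refl (# 2 ⊗ # k))) m≥

      ∑c≤ : ∀ G → w I G ≡ true → ∀ x → ∑ (c I G x) ≤ D + D
      ∑c≤ G wG x = ≤-resp (sym (trans (∑-+ (b I G x) (h I x)) (cong (_+ hdeg x) (row-sum I G wG x)))) refl (+-mono-≤ (deg≤ x) (hdeg≤D x))

      weighted≤ : ∀ {f} K → (∀ x → 0ℚ ≤ f x) → ∑ f ≤ K → ∑ (λ x → f x * deg⁻ I x) ≤ D * K
      weighted≤ {f} K f≥0 h = ≤-trans (∑-mono (λ x → *-monoˡ (f≥0 x) (deg≤ x)))
        (≤-resp (sym (∑-*ʳ D f)) (*-comm K D) (*-monoʳ D≥0 h))

      ∑∑b : ∀ G → w I G ≡ true → ∑∑ (b I G) ≡ m I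
      ∑∑b G wG = ∑-cong (row-sum I G wG)

      ∑∑b-row : ∀ G → w I G ≡ true → (f : Fin n → ℚ) → ∑∑ (λ x y → b I G x y * f x) ≡ ∑ (λ x → f x * deg⁻ I x)
      ∑∑b-row G wG f = ∑-cong (λ x → trans (∑-*ʳ (f x) (b I G x)) (trans (*-comm _ (f x)) (cong (f x *_) (row-sum I G wG x))))

      ∑∑b-col : ∀ G → w I G ≡ true → (f : Fin n → ℚ) → ∑∑ (λ x y → b I G x y * f y) ≡ ∑ (λ y → f y * deg⁻ I y)
      ∑∑b-col G wG f = trans (∑∑-swap _) (∑-cong (λ y → trans (∑-*ʳ (f y) (λ x → b I G x y))
        (trans (*-comm _ (f y)) (cong (f y *_) (col-sum I G wG y)))))

      module Pair (p q : Fin n) (p≢q : p ≢ q) (Hpq : H I p q ≡ false) where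
        open SwitchIdentity I p q p≢q Hpq public

        P : ℚ
        P = 𝔼 I (λ G → b I G p q)

        P≥0 : 0ℚ ≤ P
        P≥0 = 𝔼-nonneg I (λ G _ → b≥0 I G p q)

        A : ℚ
        A = deg⁻ I p * deg⁻ I q

        A≥0 : 0ℚ ≤ A
        A≥0 = deg⁻≥0 I p ⊗ deg⁻≥0 I q

        module _ (G : Adj n) (wG : w I G ≡ true) where

          F : Fin n → Fin n → ℚ
          F s x = (δ x p + δ x q) + c I G s x

          F≥0 : ∀ s x → 0ℚ ≤ F s x
          F≥0 s x = δ≥0 x p ⊕ δ≥0 x q ⊕ c≥0 I G s x

          F-weighted : ∀ s → ∑ (λ x → F s x * deg⁻ I x) ≤ D * ((1ℚ + 1ℚ) + (D + D))
          F-weighted s = weighted≤ _ (F≥0 s) (≤-resp (sym (trans (∑-+ _ _) (cong (_+ ∑ (c I G s)) (trans (∑-+ _ _) (cong₂ _+_ (∑-δ1 p) (∑-δ1 q)))))) refl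
            (+-mono-≤ ≤-refl (∑c≤ G wG s)))

          inner : ∀ x y → Under (ν x * ν y * ((1ℚ - c I G p x) * (1ℚ - c I G q y)))
            (((δ x p + δ x q) + (δ y p + δ y q)) + (c I G p x + c I G q y))
          inner x y = under-* (under-* (under-* (u _) (u _)) (under-* (u _) (u _))) (under-* (v p x) (v q y))
            where
            u : ∀ s → Under (1ℚ - ⟦ s ⟧) ⟦ s ⟧
            u s = under-unit (⟦⟧≥0 s) (⟦⟧≤1 s)
            v : ∀ s z → Under (1ℚ - c I G s z) (c I G s z)
            v s z = under-unit (c≥0 I G s z) (c≤1 I G s z)

          L≤m : L G ≤ m I
          L≤m = ≤-resp refl (∑∑b G wG) (∑∑-mono (λ x y → ≤-resp (sym (reorder-L (ν x) (ν y) (b I G x y) _)) (*-identityʳ _)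
            (*-monoˡ (b≥0 I G x y) (under-≤ (inner x y)))))

          -- Union bound over blocked choices: x is p or q or is joined to p in G or H, at most 2 +
          -- 2D vertices with at most D edges each, and likewise for y and q. Altogether 2D(2 + 2D)
          -- ≤ 8D².
          m-8D²≤L : m I - ι 8 * (D * D) ≤ L G
          m-8D²≤L = ≤-trans (L-lower-arith D (m I) _ _ D≥1 (F-weighted p) (F-weighted q))
            (≤-resp (trans (∑∑-- _ _) (cong₂ _-_ (∑∑b G wG) (trans (∑∑-+ _ _) (cong₂ _+_ (∑∑b-row G wG (F p)) (∑∑b-col G wG (F q)))))) refl
              (∑∑-mono (λ x y → ≤-resp (trans (cong (λ t → b I G x y * (1ℚ - t)) (+-swap _ _ _ _)) (expand-1-+ (b I G x y) (F p x) (F q y)))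
                (sym (reorder-L (ν x) (ν y) (b I G x y) _)) (*-monoˡ (b≥0 I G x y) (under-≥ (inner x y))))))

          R≤A : (1ℚ - b I G p q) * R G ≤ A
          R≤A = ≤-trans (*-monoˡ (gap (b≤1 I G p q)) R≤) (≤-resp refl (*-identityˡ A) (*-monoʳ A≥0 1-b≤1))
            where
            1-b≤1 : 1ℚ - b I G p q ≤ 1ℚ
            1-b≤1 = under-≤ (under-unit (b≥0 I G p q) (b≤1 I G p q))
            t≤1 : ∀ x y → (1ℚ - δ x y) - c I G x y ≤ 1ℚ
            t≤1 x y = certify (δ≥0 x y ⊕ c≥0 I G x y) (lem _ _)
              where
              opaque
                unfolding _+_ _*_ _-_ -_
                lem : ∀ s t → 1ℚ - ((1ℚ - s) - t) ≡ s + t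
                lem = solve-∀ ℚ-ring
            R≤ : R G ≤ A
            R≤ = ≤-resp refl (trans (∑∑-× _ _) (cong₂ _*_ (row-sum I G wG p) (row-sum I G wG q)))
              (∑∑-mono (λ x y → ≤-resp refl (*-identityʳ _) (*-monoˡ (b≥0 I G p x ⊗ b≥0 I G q y) (t≤1 x y))))

        edge-up′ : P ≤ (1ℚ + ι 40 * ε) * (r * (A * N I))
        edge-up′ = edge-up-arith D m₀ r (m I) P (A * N I) D≥1 r≥0 m₀r≡1 small m₀≤m+12 P≥0
          (≤-trans (≤-resp (𝔼-*ʳ I (m I - ι 8 * (D * D)) (λ G → b I G p q)) refl
             (𝔼-mono I {f = λ G → b I G p q * (m I - ι 8 * (D * D))} (λ G wG → *-monoˡ (b≥0 I G p q) (m-8D²≤L G wG))))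
           (≤-resp (sym switch-identity) (𝔼-const I A) (𝔼-mono I R≤A)))

      -- For p = q and for pairs of `H` the expectation vanishes; including them lets later sums run
      -- over all pairs of vertices.
      edge-up : ∀ p q → 𝔼 I (λ G → b I G p q) ≤ (1ℚ + ι 40 * ε) * (r * (deg⁻ I p * deg⁻ I q)) * N I
      edge-up p q with p FP.≟ q
      ... | yes refl = ≤-resp (sym (trans (𝔼-cong I (λ G wG → b-irr I G wG p)) (𝔼-0 I))) refl
                        ((0≤1 ⊕ # 40 ⊗ ε≥0) ⊗ (r≥0 ⊗ (deg⁻≥0 I p ⊗ deg⁻≥0 I p)) ⊗ N≥0 I)
      ... | no p≢q = go (H I p q) refl
        where
        go : ∀ t → H I p q ≡ t → 𝔼 I (λ G → b I G p q) ≤ (1ℚ + ι 40 * ε) * (r * (deg⁻ I p * deg⁻ I q)) * N I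
        go true e = ≤-resp (sym (trans (𝔼-cong I (λ G wG → b≡0 I G e)) (𝔼-0 I))) refl
                        ((0≤1 ⊕ # 40 ⊗ ε≥0) ⊗ (r≥0 ⊗ (deg⁻≥0 I p ⊗ deg⁻≥0 I q)) ⊗ N≥0 I)
        go false e = ≤-resp refl (trans (cong ((1ℚ + ι 40 * ε) *_) (sym (*-assoc r _ (N I)))) (sym (*-assoc _ _ (N I)))) (Pair.edge-up′ p q p≢q e) 

-- Conditioning on successive edges: upper bounds for two and three edges.

module EdgeChains where
  open Arithmetic
  open Switching
  open Expectations
  open UpperBounds

  lower-≤ : ∀ {n} (d : Fin n → ℕ) p q x → lower d p q x ℕ.≤ d x
  lower-≤ d p q x with (x == p) ∨ (x == q)
  ... | true = ℕP.m∸n≤m (d x) 1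
  ... | false = ℕP.≤-refl

  lower-away : ∀ {n} (d : Fin n → ℕ) {p q x} → x ≢ p → x ≢ q → lower d p q x ≡ d x
  lower-away d h k rewrite ==-≢ h | ==-≢ k = refl

  lower-at : ∀ {n} (d : Fin n → ℕ) p x → lower d p x x ≡ d x ∸ 1
  lower-at d p x rewrite ==-refl x | ∨-zeroʳ (x == p) = refl

  lower-first : ∀ {n} (d : Fin n → ℕ) p x → lower d p x p ≡ d p ∸ 1
  lower-first d p x rewrite ==-refl p = refl

  -- The degree left at y after an edge px has been contracted, for y other than p. It drops only
  -- for y = x, the wedge case.
  pred : ∀ {n} → (Fin n → ℕ) → Fin n → Fin n → ℕ
  pred d x y = if y == x then d y ∸ 1 else d y

  pred-≤ : ∀ {n} (d : Fin n → ℕ) x y → pred d x y ℕ.≤ d y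
  pred-≤ d x y with y == x
  ... | true = ℕP.m∸n≤m (d y) 1
  ... | false = ℕP.≤-refl

  pred-same : ∀ {n} (d : Fin n → ℕ) x → pred d x x ≡ d x ∸ 1
  pred-same d x rewrite ==-refl x = refl

  pred-≢ : ∀ {n} (d : Fin n → ℕ) {x y} → x ≢ y → pred d x y ≡ d y
  pred-≢ d h rewrite ==-≢ (≢-sym h) = refl

  lower-pred : ∀ {n} (d : Fin n → ℕ) {p x y} → y ≢ p → lower d p x y ≡ pred d x y
  lower-pred d h rewrite ==-≢ h = refl

  opaque
    unfolding _+_ _*_ _-_ -_ ι ⟦_⟧

    ι-∸1 : ∀ k → ι k - 1ℚ ≤ ι (k ∸ 1)
    ι-∸1 zero = ℚP.≤ᵇ⇒≤ {ι 0 - 1ℚ} {ι 0} _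
    ι-∸1 (suc k) = ≤-reflexive (trans (cong (_- 1ℚ) (trans (ι-+ 1 k) (cong (_+ ι k) ι1))) (lem (ι k)))
      where
      lem : ∀ z → 1ℚ + z - 1ℚ ≡ z
      lem = solve-∀ ℚ-ring

    hdeg-arith : ∀ s t k D → s ≤ 1ℚ → t + (1ℚ + k) ≤ D → t + s + k ≤ D
    hdeg-arith s t k D h h′ = certify (gap h ⊕ gap h′) (solve (s ∷ t ∷ k ∷ D ∷ []) ℚ-ring)

    m-arith : ∀ m₀ k m m′ → m₀ + ι 2 * (1ℚ + k) ≤ m + ι 12 → m - (1ℚ + 1ℚ) ≤ m′ → m₀ + ι 2 * k ≤ m′ + ι 12
    m-arith m₀ k m m′ h h′ = certify (gap h ⊕ gap h′) (solve (m₀ ∷ k ∷ m ∷ m′ ∷ []) ℚ-ring)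

    m-arith′ : ∀ m₀ k m → m₀ + ι 2 * (1ℚ + k) ≤ m + ι 12 → m₀ + ι 2 * k ≤ m + ι 12
    m-arith′ m₀ k m h = certify (gap h ⊕ # 2) (solve (m₀ ∷ k ∷ m ∷ []) ℚ-ring)

    1-40ε≥0 : ∀ ε → 0ℚ ≤ ε → ι 1000 * ε ≤ 1ℚ → 0ℚ ≤ 1ℚ - ι 40 * ε
    1-40ε≥0 ε e s = gap {ι 40 * ε} {1ℚ} (certify (gap s ⊕ # 960 ⊗ e) (solve (ε ∷ []) ℚ-ring))

    1+40ε≤2 : ∀ ε → 0ℚ ≤ ε → ι 1000 * ε ≤ 1ℚ → 1ℚ + ι 40 * ε ≤ ι 2
    1+40ε≤2 ε e s = certify (gap s ⊕ # 960 ⊗ e) (solve (ε ∷ []) ℚ-ring)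

    *-swap₃ : ∀ x y z → x * (y * z) ≡ y * (x * z)
    *-swap₃ = solve-∀ ℚ-ring

    path-regroup : ∀ r A₁ A₂ x y N → (ι 2 * (r * (A₂ * y))) * ((ι 2 * (r * (A₁ * x))) * N) ≡ (ι 4 * (r * r) * (A₁ * A₂) * N) * (x * y)
    path-regroup = solve-∀ ℚ-ring

    tri-regroup : ∀ r A₁ A₂ x y N → (ι 2 * (r * (x * y))) * ((ι 2 * (r * (A₂ * y))) * ((ι 2 * (r * (A₁ * x))) * N))
      ≡ (ι 8 * (r * r * r) * (A₁ * A₂) * N) * ((x * x) * (y * y))
    tri-regroup = solve-∀ ℚ-ring

    -- The three obstructions cost at most 4ε, 4ε and 8ε relative to A N, and the graphs containing
    -- the pair, the difference between N and M, another 2ε: 18ε in all, within the allowed 40ε.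
    edge-lo-arith : ∀ D r m₀ m A N P M T₁ T₂ T₃ → 1ℚ ≤ D → 0ℚ ≤ r → m₀ * r ≡ 1ℚ → 0ℚ ≤ m → m ≤ m₀ → 0ℚ ≤ A → A ≤ D * D → 0ℚ ≤ P → M ≡ N - P → 0ℚ ≤ M →
      P ≤ ι 2 * (r * A) * N →
      T₁ ≤ (ι 4 * (r * r) * A * M) * (D * m) → T₂ ≤ (ι 4 * (r * r) * A * M) * (D * D * m) → T₃ ≤ (ι 8 * (r * r * r) * A * M) * ((D * m) * (D * m)) →
      A * M - T₁ - T₂ - T₃ ≤ m * P → (1ℚ - ι 40 * (D * D * r)) * (r * A) * N ≤ P
    edge-lo-arith D r m₀ m A N P M T₁ T₂ T₃ D≥1 r≥0 mr m≥0 m≤ A≥0 A≤ P≥0 refl M≥0 P≤ h₁ h₂ h₃ key =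
      finish (gap t₁ ⊕ gap t₂ ⊕ gap t₃)
      where
      D≥0 : 0ℚ ≤ D
      D≥0 = ≤-trans 0≤1 D≥1
      N≥0 : 0ℚ ≤ N
      N≥0 = ≤-trans M≥0 (certify P≥0 (solve (N ∷ P ∷ []) ℚ-ring))
      rm≤1 : 0ℚ ≤ 1ℚ - m * r
      rm≤1 = gap (subst (m * r ≤_) mr (*-monoʳ r≥0 m≤))
      t₁ : T₁ ≤ ι 4 * (r * (D * D) * A * N)
      t₁ = ≤-trans h₁ (certify (# 4 ⊗ (r≥0 ⊗ D≥0 ⊗ A≥0 ⊗ M≥0) ⊗ rm≤1 ⊕ # 4 ⊗ (r≥0 ⊗ D≥0 ⊗ A≥0) ⊗ P≥0 ⊕ # 4 ⊗ (r≥0 ⊗ A≥0 ⊗ N≥0 ⊗ D≥0) ⊗ gap D≥1)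
        (solve (D ∷ r ∷ m ∷ A ∷ N ∷ P ∷ []) ℚ-ring))
      t₂ : T₂ ≤ ι 4 * (r * (D * D) * A * N)
      t₂ = ≤-trans h₂ (certify (# 4 ⊗ (r≥0 ⊗ (D≥0 ⊗ D≥0) ⊗ A≥0 ⊗ M≥0) ⊗ rm≤1 ⊕ # 4 ⊗ (r≥0 ⊗ (D≥0 ⊗ D≥0) ⊗ A≥0) ⊗ P≥0)
        (solve (D ∷ r ∷ m ∷ A ∷ N ∷ P ∷ []) ℚ-ring))
      t₃ : T₃ ≤ ι 8 * (r * (D * D) * A * N)
      t₃ = ≤-trans h₃ (certify (# 8 ⊗ (r≥0 ⊗ (D≥0 ⊗ D≥0) ⊗ A≥0 ⊗ M≥0) ⊗ (rm≤1 ⊗ (0≤1 ⊕ m≥0 ⊗ r≥0)) ⊕ # 8 ⊗ (r≥0 ⊗ (D≥0 ⊗ D≥0) ⊗ A≥0) ⊗ P≥0)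
        (solve (D ∷ r ∷ m ∷ A ∷ N ∷ P ∷ []) ℚ-ring))
      finish : 0ℚ ≤ (ι 4 * (r * (D * D) * A * N) - T₁) + (ι 4 * (r * (D * D) * A * N) - T₂) + (ι 8 * (r * (D * D) * A * N) - T₃) →
        (1ℚ - ι 40 * (D * D * r)) * (r * A) * N ≤ P
      finish t = certify (r≥0 ⊗ t ⊕ r≥0 ⊗ gap key ⊕ r≥0 ⊗ P≥0 ⊗ gap m≤ ⊕ zero⁺ ((- P) ⊠ mr) ⊕ r≥0 ⊗ A≥0 ⊗ gap P≤ ⊕ # 2 ⊗ (r≥0 ⊗ r≥0 ⊗ A≥0 ⊗ N≥0) ⊗ gap A≤ ⊕ # 22 ⊗ (r≥0 ⊗ r≥0 ⊗ A≥0 ⊗ N≥0 ⊗ D≥0 ⊗ D≥0))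
        (solve (D ∷ r ∷ m₀ ∷ m ∷ A ∷ N ∷ P ∷ T₁ ∷ T₂ ∷ T₃ ∷ []) ℚ-ring)

  open Expectation

  module _ {n : ℕ} (I : Instance n) (p q : Fin n) (p≢q : p ≢ q) where

    𝔼-contract : ∀ Hpq f → 𝔼 (contract I p q p≢q Hpq) f ≡ 𝔼 I (λ G → b I G p q * f G)
    𝔼-contract Hpq f = sum-cong (allAdj n) (λ G → trans (cong (_* f G) (⟦∧⟧ (w I G) (adj G p q)))
      (trans (*-assoc _ _ (f G)) (cong (λ t → ⟦ w I G ⟧ * (t * f G)) (sym (b≡a I G Hpq)))))

    N-contract : ∀ Hpq → N (contract I p q p≢q Hpq) ≡ 𝔼 I (λ G → b I G p q)
    N-contract Hpq = trans (𝔼-contract Hpq (λ _ → 1ℚ)) (𝔼-cong I (λ G _ → *-identityʳ (b I G p q)))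

    𝔼-delete : H I p q ≡ false → ∀ f → 𝔼 (delete I p q p≢q) f ≡ 𝔼 I (λ G → (1ℚ - b I G p q) * f G)
    𝔼-delete Hpq f = sum-cong (allAdj n) (λ G → trans (cong (_* f G) (trans (⟦∧⟧ (w I G) (not (adj G p q))) (cong (⟦ w I G ⟧ *_) (⟦not⟧ (adj G p q)))))
      (trans (*-assoc _ _ (f G)) (cong (λ t → ⟦ w I G ⟧ * ((1ℚ - t) * f G)) (sym (b≡a I G Hpq)))))

    b-contract-away : ∀ {Hpq s t} → isE p q s t ≡ false → ∀ G → b I G s t ≡ b (contract I p q p≢q Hpq) G s t
    b-contract-away {s = s} {t} e G rewrite e = cong (λ z → ⟦ adj G s t ∧ not z ⟧) (sym (∨-identityʳ (H I s t)))

    b-delete : ∀ G → w (delete I p q p≢q) G ≡ true → ∀ s t → b I G s t ≡ b (delete I p q p≢q) G s t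
    b-delete G wG s t with isE p q s t in e
    ... | false = cong (λ z → ⟦ adj G s t ∧ not z ⟧) (sym (∨-identityʳ (H I s t)))
    ... | true = off (absent (isE-true⁻ e)) (H I s t) (H I s t ∨ true)
      where
      pq : adj G p q ≡ false
      pq = not-true⁻ (proj₂ (∧-true⁻ {w I G} wG))
      absent : ∀ {s t} → SamePair p q s t → adj G s t ≡ false
      absent (inj₁ (refl , refl)) = pq
      absent (inj₂ (refl , refl)) = trans (G-sym I G (proj₁ (∧-true⁻ wG)) q p) pq
      off : ∀ {z} → z ≡ false → ∀ x y → ⟦ z ∧ not x ⟧ ≡ ⟦ z ∧ not y ⟧
      off refl x y = refl

    h⁺-sum : ∀ x → ∑ (λ y → ⟦ H I x y ∨ isE p q x y ⟧) ≤ ∑ (h I x) + (δ x p + δ x q)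
    h⁺-sum x = ≤-resp refl (trans (∑-+ _ _) (cong (∑ (h I x) +_) (∑-isE p≢q x))) (∑-mono (λ y → ⟦∨⟧-≤ (H I x y) (isE p q x y)))

  module UpperEstimates (D m₀ r : ℚ) (D≥1 : 1ℚ ≤ D) (r≥0 : 0ℚ ≤ r) (m₀r≡1 : m₀ * r ≡ 1ℚ) (small : ι 1000 * (D * D * r) ≤ 1ℚ) where
    open Bounds D m₀ r D≥1 r≥0 m₀r≡1 small public

    module _ {n : ℕ} {I : Instance n} {k : ℕ} (B : Bounded I (suc k)) {p q : Fin n} (p≢q : p ≢ q) where
      open Bounded B

      private
        hdeg⁺ : ∀ x → ∑ (λ y → ⟦ H I x y ∨ isE p q x y ⟧) + ι k ≤ D
        hdeg⁺ x = ≤-trans (+-mono-≤ (h⁺-sum I p q p≢q x) ≤-refl) (hdeg-arith _ (∑ (h I x)) (ι k) D (δ+δ≤1 p≢q x)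
          (subst (λ t → ∑ (h I x) + t ≤ D) (trans (ι-+ 1 k) (cong (_+ ι k) ι1)) (hdeg≤ x)))

        m≥′ : m₀ + ι 2 * (1ℚ + ι k) ≤ m I + ι 12
        m≥′ = subst (λ t → m₀ + ι 2 * t ≤ m I + ι 12) (trans (ι-+ 1 k) (cong (_+ ι k) ι1)) m≥

      Bounded-delete : Bounded (delete I p q p≢q) k
      Bounded-delete = record { deg≤ = deg≤ ; hdeg≤ = hdeg⁺ ; m≤ = m≤ ; m≥ = m-arith′ m₀ (ι k) (m I) m≥′ }

      Bounded-contract : (Hpq : H I p q ≡ false) → Bounded (contract I p q p≢q Hpq) k
      Bounded-contract Hpq = record
        { deg≤ = λ x → ≤-trans (ι-mono (lower-≤ (d I) p q x)) (deg≤ x)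
        ; hdeg≤ = hdeg⁺
        ; m≤ = ≤-trans (∑-mono (λ x → ι-mono (lower-≤ (d I) p q x))) m≤
        ; m≥ = m-arith m₀ (ι k) (m I) _ m≥′ (≤-resp (trans (∑-- _ _) (cong (λ t → m I - t) (trans (∑-+ _ _) (cong₂ _+_ (∑-δ1 p) (∑-δ1 q))))) refl (∑-mono drop))
        }
        where
        drop : ∀ x → deg⁻ I x - (δ x p + δ x q) ≤ ι (lower (d I) p q x)
        drop x with x FP.≟ p
        ... | yes refl rewrite δ-refl x | δ-≢ p≢q | +-identityʳ 1ℚ | lower-first (d I) x q = ι-∸1 (d I x)
        ... | no h with x FP.≟ q
        ...   | yes refl rewrite δ-refl x | δ-≢ h | +-identityˡ 1ℚ | lower-at (d I) p x = ι-∸1 (d I x)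
        ...   | no h′ rewrite δ-≢ h | δ-≢ h′ | +-identityˡ 0ℚ | lower-away (d I) h h′ = ≤-reflexive (x-0≡x _)

    λ⁺ λ⁻ : ℚ
    λ⁺ = 1ℚ + ι 40 * ε
    λ⁻ = 1ℚ - ι 40 * ε

    λ⁺≥0 : 0ℚ ≤ λ⁺
    λ⁺≥0 = 0≤1 ⊕ # 40 ⊗ ε≥0

    λ⁻≥0 : 0ℚ ≤ λ⁻
    λ⁻≥0 = 1-40ε≥0 ε ε≥0 small

    up lo : ℚ → ℚ
    up A = λ⁺ * (r * A)
    lo A = λ⁻ * (r * A)

    up≥0 : ∀ {A} → 0ℚ ≤ A → 0ℚ ≤ up A
    up≥0 h = λ⁺≥0 ⊗ (r≥0 ⊗ h)

    lo≥0 : ∀ {A} → 0ℚ ≤ A → 0ℚ ≤ lo A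
    lo≥0 h = λ⁻≥0 ⊗ (r≥0 ⊗ h)

    up≤ : ∀ {A A′} → 0ℚ ≤ A → A ≤ A′ → up A ≤ ι 2 * (r * A′)
    up≤ {A} {A′} h k = *-mono λ⁺≥0 (r≥0 ⊗ ≤-trans h k) (1+40ε≤2 ε ε≥0 small) (*-monoˡ r≥0 k)

    module _ {n : ℕ} (I : Instance n) where

      vanish : ∀ {f X} → 0ℚ ≤ X → (∀ G → w I G ≡ true → f G ≡ 0ℚ) → 𝔼 I f ≤ X
      vanish h e = ≤-resp (sym (trans (𝔼-cong I e) (𝔼-0 I))) refl h

      deg² : Fin n → Fin n → ℚ
      deg² p q = deg⁻ I p * deg⁻ I q

      deg²≥0 : ∀ p q → 0ℚ ≤ deg² p q
      deg²≥0 p q = deg⁻≥0 I p ⊗ deg⁻≥0 I q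

      module _ {k : ℕ} (B : Bounded I k) where
        open FirstOrder I B

        -- Chain rule: a bound `K` for `f` given pq, multiplied by the one-edge bound for pq. The
        -- conditional bound is asked only where pq can be contracted, as otherwise the left side
        -- vanishes.
        chain-up : ∀ p q f K → 0ℚ ≤ K →
          (∀ p≢q Hpq → 𝔼 (contract I p q p≢q Hpq) f ≤ K * N (contract I p q p≢q Hpq)) →
          𝔼 I (λ G → b I G p q * f G) ≤ K * (up (deg² p q) * N I)
        chain-up p q f K K≥0 step with p FP.≟ q
        ... | yes refl = vanish (K≥0 ⊗ (up≥0 (deg²≥0 p p) ⊗ N≥0 I)) (λ G wG → trans (cong (_* f G) (b-irr I G wG p)) (*-zeroˡ (f G)))
        ... | no p≢q = go (H I p q) refl
          where
          go : ∀ t → H I p q ≡ t → 𝔼 I (λ G → b I G p q * f G) ≤ K * (up (deg² p q) * N I)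
          go true e = vanish (K≥0 ⊗ (up≥0 (deg²≥0 p q) ⊗ N≥0 I)) (λ G wG → trans (cong (_* f G) (b≡0 I G e)) (*-zeroˡ (f G)))
          go false e = ≤-trans (≤-resp (𝔼-contract I p q p≢q e f) (cong (K *_) (N-contract I p q p≢q e)) (step p≢q e)) (*-monoˡ K≥0 (edge-up p q))

    module _ {n : ℕ} (J : Instance n) {k : ℕ} (B : Bounded J (2 ℕ.+ k)) (p q : Fin n) (p≢q : p ≢ q) (Hpq : H J p q ≡ true) where

      private
        Hqp : H J q p ≡ true
        Hqp = trans (H-sym J q p) Hpq

      sep : ∀ {x y} → x ≢ q → isE p x q y ≡ false
      sep {x} {y} x≢q = isE-false⁺ λ { (inj₁ (e , _)) → p≢q (sym e) ; (inj₂ (e , _)) → x≢q (sym e) }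

      -- Because pq lies in `H`, the cases x = q and y = p vanish. Otherwise contracting px leaves
      -- the degree of q unchanged and lowers that of y only when y = x, as `pred` records.
      path-up : ∀ x y → 𝔼 J (λ G → b J G p x * b J G q y) ≤ up (deg⁻ J q * ι (pred (d J) x y)) * (up (deg² J p x) * N J)
      path-up x y with x FP.≟ q | y FP.≟ p
      ... | yes refl | _ = vanish J (up≥0 (deg⁻≥0 J q ⊗ # _) ⊗ (up≥0 (deg²≥0 J p x) ⊗ N≥0 J))
                             (λ G _ → trans (cong (_* b J G q y) (b≡0 J G Hpq)) (*-zeroˡ _))
      ... | no _ | yes refl = vanish J (up≥0 (deg⁻≥0 J q ⊗ # _) ⊗ (up≥0 (deg²≥0 J p x) ⊗ N≥0 J))
                             (λ G _ → trans (cong (b J G p x *_) (b≡0 J G Hqp)) (*-zeroʳ _))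
      ... | no x≢q | no y≢p = chain-up J B p x (λ G → b J G q y) _ (up≥0 (deg⁻≥0 J q ⊗ # _)) λ p≢x Hpx →
        ≤-resp (sym (𝔼-cong (contract J p x p≢x Hpx) (λ G _ → b-contract-away J p x p≢x {Hpx} (sep x≢q) G)))
          (cong₂ (λ s t → up (ι s * ι t) * N (contract J p x p≢x Hpx)) (lower-away (d J) (≢-sym p≢q) (≢-sym x≢q)) (lower-pred (d J) y≢p))
          (FirstOrder.edge-up (contract J p x p≢x Hpx) (Bounded-contract B p≢x Hpx) q y)

      -- Contracting px and then qy uses up one degree at x and one at y, so the last edge xy sees
      -- both degrees lowered by 1. In the excluded cases x = q, y = p and x = y the product is
      -- zero.
      tri-up : ∀ x y → 𝔼 J (λ G → b J G p x * (b J G q y * b J G x y)) ≤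
        up (ι (d J x ∸ 1) * ι (d J y ∸ 1)) * (up (deg² J q y) * (up (deg² J p x) * N J))
      tri-up x y with x FP.≟ q | y FP.≟ p | x FP.≟ y
      ... | yes refl | _ | _ = vanish J (up≥0 (# _ ⊗ # _) ⊗ (up≥0 (deg²≥0 J q y) ⊗ (up≥0 (deg²≥0 J p x) ⊗ N≥0 J)))
                             (λ G _ → trans (cong (_* (b J G q y * b J G x y)) (b≡0 J G Hpq)) (*-zeroˡ _))
      ... | no _ | yes refl | _ = vanish J (up≥0 (# _ ⊗ # _) ⊗ (up≥0 (deg²≥0 J q y) ⊗ (up≥0 (deg²≥0 J p x) ⊗ N≥0 J)))
                             (λ G _ → trans (cong (λ t → b J G p x * (t * b J G x y)) (b≡0 J G Hqp)) (trans (cong (b J G p x *_) (*-zeroˡ _)) (*-zeroʳ _)))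
      ... | no _ | no _ | yes refl = vanish J (up≥0 (# _ ⊗ # _) ⊗ (up≥0 (deg²≥0 J q y) ⊗ (up≥0 (deg²≥0 J p x) ⊗ N≥0 J)))
                             (λ G wG → trans (cong (λ t → b J G p x * (b J G q y * t)) (b-irr J G wG x)) (trans (cong (b J G p x *_) (*-zeroʳ _)) (*-zeroʳ _)))
      ... | no x≢q | no y≢p | no x≢y = subst (_ ≤_) (*-assoc _ _ _) (chain-up J B p x (λ G → b J G q y * b J G x y) _
            (up≥0 (# (d J x ∸ 1) ⊗ # (d J y ∸ 1)) ⊗ up≥0 (deg²≥0 J q y)) step)
        where
        step : ∀ p≢x Hpx → 𝔼 (contract J p x p≢x Hpx) (λ G → b J G q y * b J G x y) ≤
          up (ι (d J x ∸ 1) * ι (d J y ∸ 1)) * up (deg² J q y) * N (contract J p x p≢x Hpx)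
        step p≢x Hpx = ≤-resp
            (sym (𝔼-cong K (λ G _ → cong (_* b J G x y) (b-contract-away J p x p≢x {Hpx} (sep x≢q) G))))
            (trans (cong (λ t → up (ι (d J x ∸ 1) * ι (d J y ∸ 1)) * (up t * N K)) (cong₂ (λ s t → ι s * ι t) (lower-away (d J) (≢-sym p≢q) (≢-sym x≢q)) (lower-away (d J) y≢p (≢-sym x≢y))))
              (sym (*-assoc _ _ _)))
            (chain-up K BK q y (λ G → b J G x y) _ (up≥0 (# (d J x ∸ 1) ⊗ # (d J y ∸ 1))) step′)
          where
          K = contract J p x p≢x Hpx
          BK = Bounded-contract B p≢x Hpx
          step′ : ∀ q≢y Hqy → 𝔼 (contract K q y q≢y Hqy) (λ G → b J G x y) ≤ up (ι (d J x ∸ 1) * ι (d J y ∸ 1)) * N (contract K q y q≢y Hqy)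
          step′ q≢y Hqy = ≤-resp
            (sym (𝔼-cong K₂ (λ G _ → trans (b-contract-away J p x p≢x {Hpx} sep₁ G) (b-contract-away K q y q≢y {Hqy} sep₂ G))))
            (cong₂ (λ s t → up (ι s * ι t) * N K₂) (trans (lower-away (lower (d J) p x) x≢q x≢y) (lower-at (d J) p x))
               (trans (lower-at (lower (d J) p x) q y) (cong (_∸ 1) (lower-away (d J) y≢p (≢-sym x≢y)))))
            (FirstOrder.edge-up K₂ (Bounded-contract BK q≢y Hqy) x y)
            where
            K₂ = contract K q y q≢y Hqy
            sep₁ : isE p x x y ≡ false
            sep₁ = isE-false⁺ λ { (inj₁ (_ , e)) → x≢y (sym e) ; (inj₂ (_ , e)) → y≢p e }
            sep₂ : isE q y x y ≡ false
            sep₂ = isE-false⁺ λ { (inj₁ (e , _)) → x≢q e ; (inj₂ (e , _)) → x≢y e }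

      path≤ : ∀ x y → 𝔼 J (λ G → b J G p x * b J G q y) ≤ (ι 4 * (r * r) * deg² J p q * N J) * (deg⁻ J x * deg⁻ J y)
      path≤ x y = ≤-trans (path-up x y) (≤-resp refl (path-regroup r _ _ _ _ (N J))
        (*-mono (up≥0 (deg⁻≥0 J q ⊗ # _)) (# 2 ⊗ (r≥0 ⊗ deg²≥0 J p x) ⊗ N≥0 J) (up≤ (deg⁻≥0 J q ⊗ # _) (*-monoˡ (deg⁻≥0 J q) (ι-mono (pred-≤ (d J) x y))))
          (*-monoʳ (N≥0 J) (up≤ (deg²≥0 J p x) ≤-refl))))

      tri≤ : ∀ x y → 𝔼 J (λ G → b J G p x * (b J G q y * b J G x y)) ≤
        (ι 8 * (r * r * r) * deg² J p q * N J) * ((deg⁻ J x * deg⁻ J x) * (deg⁻ J y * deg⁻ J y))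
      tri≤ x y = ≤-trans (tri-up x y) (≤-resp refl (tri-regroup r _ _ _ _ (N J))
        (*-mono (up≥0 (# (d J x ∸ 1) ⊗ # (d J y ∸ 1))) (# 2 ⊗ (r≥0 ⊗ deg²≥0 J q y) ⊗ (# 2 ⊗ (r≥0 ⊗ deg²≥0 J p x) ⊗ N≥0 J))
           (up≤ (# (d J x ∸ 1) ⊗ # (d J y ∸ 1)) (*-mono (# (d J x ∸ 1)) (deg⁻≥0 J y) (ι-mono (ℕP.m∸n≤m (d J x) 1)) (ι-mono (ℕP.m∸n≤m (d J y) 1))))
           (*-mono (up≥0 (deg²≥0 J q y)) (# 2 ⊗ (r≥0 ⊗ deg²≥0 J p x) ⊗ N≥0 J) (up≤ (deg²≥0 J q y) ≤-refl)
             (*-monoʳ (N≥0 J) (up≤ (deg²≥0 J p x) ≤-refl))))) 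

-- Lower bounds for one, two and three edges.

module LowerBounds where
  open Arithmetic
  open Switching
  open Expectations
  open UpperBounds
  open EdgeChains

  opaque
    unfolding _+_ _*_ _-_ -_

    *-distribˡ-- : ∀ a b c → a * (b - c) ≡ a * b - a * c
    *-distribˡ-- = solve-∀ ℚ-ring

    1-x-x : ∀ x → (1ℚ - x) * 1ℚ ≡ 1ℚ - x
    1-x-x = solve-∀ ℚ-ring

    regroup₃ : ∀ k h x y → h * (k * (x * y)) ≡ k * (x * (h * y))
    regroup₃ = solve-∀ ℚ-ring

  open Expectation

  𝔼-- : ∀ {n} (I : Instance n) f g → 𝔼 I (λ G → f G - g G) ≡ 𝔼 I f - 𝔼 I g
  𝔼-- {n} I f g = trans (sum-cong (allAdj n) (λ G → *-distribˡ-- ⟦ w I G ⟧ (f G) (g G))) (sum-- _ _ (allAdj n))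

  ∑∑-δ : ∀ {n} (f : Fin n → Fin n → ℚ) → ∑∑ (λ x y → δ x y * f x y) ≡ ∑ (λ x → f x x)
  ∑∑-δ f = ∑-cong (λ x → trans (∑-cong (λ y → cong (_* f x y) (δ-sym x y))) (∑-δ (f x) x))

  module Delete {n : ℕ} (I : Instance n) (p q : Fin n) (p≢q : p ≢ q) (Hpq : H I p q ≡ false) where
    open SwitchIdentity I p q p≢q Hpq

    J : Instance n
    J = delete I p q p≢q

    HJpq : H J p q ≡ true
    HJpq = trans (cong (H I p q ∨_) (isE-true⁺ (inj₁ (refl , refl)))) (∨-zeroʳ (H I p q))

    N-delete : N J ≡ N I - 𝔼 I (λ G → b I G p q)
    N-delete = trans (𝔼-delete I p q p≢q Hpq (λ _ → 1ℚ)) (trans (𝔼-cong I (λ G _ → 1-x-x (b I G p q))) (𝔼-- I _ _))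

    -- The pairs of edges px, qy that admit no inverse switching: x = y, or xy is
    -- in H, or xy is already an edge.
    wedges paths triangles : ℚ
    wedges = ∑ λ x → 𝔼 J (λ G → b J G p x * b J G q x)
    paths = ∑∑ λ x y → h I x y * 𝔼 J (λ G → b J G p x * b J G q y)
    triangles = ∑∑ λ x y → 𝔼 J (λ G → b J G p x * (b J G q y * b J G x y))

    R-pointwise : ∀ G → w J G ≡ true → R G ≡ deg⁻ I p * deg⁻ I q - ∑ (λ x → b J G p x * b J G q x)
      - ∑∑ (λ x y → h I x y * (b J G p x * b J G q y)) - ∑∑ (λ x y → b J G p x * (b J G q y * b J G x y))
    R-pointwise G wG = trans (∑∑-cong split) (trans (∑∑-- _ _) (cong₂ _-_ (trans (∑∑-- _ _) (cong₂ _-_ (trans (∑∑-- _ _) (cong₂ _-_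
        (trans (∑∑-× (b J G p) (b J G q)) (cong₂ _*_ (row-sum J G wG p) (row-sum J G wG q)))
        (∑∑-δ (λ x y → b J G p x * b J G q y)))) refl)) refl))
      where
      split : ∀ x y → b I G p x * b I G q y * ((1ℚ - δ x y) - (b I G x y + h I x y)) ≡
        b J G p x * b J G q y - δ x y * (b J G p x * b J G q y) - h I x y * (b J G p x * b J G q y) - b J G p x * (b J G q y * b J G x y)
      split x y = trans (cong₂ _*_ (cong₂ _*_ (b-delete I p q p≢q G wG p x) (b-delete I p q p≢q G wG q y)) (cong (λ t → (1ℚ - δ x y) - (t + h I x y)) (b-delete I p q p≢q G wG x y)))
        (R-term-split (δ x y) (b J G x y) (h I x y) (b J G p x) (b J G q y))

    -- The weight 1 - b restricts to graphs avoiding pq, which is the class `J`. There pq belongs to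
    -- `H`, as the two- and three-edge bounds require.
    R-expansion : 𝔼 I (λ G → (1ℚ - b I G p q) * R G) ≡ deg⁻ I p * deg⁻ I q * N J - wedges - paths - triangles
    R-expansion = trans (sym (𝔼-delete I p q p≢q Hpq R)) (trans (𝔼-cong J R-pointwise)
      (trans (𝔼-- J _ _) (cong₂ _-_ (trans (𝔼-- J _ _) (cong₂ _-_ (trans (𝔼-- J _ _) (cong₂ _-_ (𝔼-const J _) (𝔼-sum J _ (allFin n))))
        (trans (𝔼-∑∑ J _) (∑∑-cong (λ x y → 𝔼-*ˡ J (h I x y) _))))) (𝔼-∑∑ J _))))

  module LowerEstimates (D m₀ r : ℚ) (D≥1 : 1ℚ ≤ D) (r≥0 : 0ℚ ≤ r) (m₀r≡1 : m₀ * r ≡ 1ℚ) (small : ι 1000 * (D * D * r) ≤ 1ℚ) where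
    open UpperEstimates D m₀ r D≥1 r≥0 m₀r≡1 small public

    module _ {n : ℕ} (I : Instance n) where

      m≥0 : 0ℚ ≤ m I
      m≥0 = ∑-nonneg (deg⁻≥0 I)

      module _ {k : ℕ} (B : Bounded I k) where
        open Bounded B
        open FirstOrder I B using (hdeg≤D; weighted≤)

        deg²≤ : ∀ p q → deg² I p q ≤ D * D
        deg²≤ p q = *-mono (deg⁻≥0 I p) D≥0 (deg≤ p) (deg≤ q)

        ∑-squares≤ : ∑ (λ x → deg⁻ I x * deg⁻ I x) ≤ D * m I
        ∑-squares≤ = weighted≤ (m I) (deg⁻≥0 I) ≤-refl

        ∑h≤ : ∀ x → ∑ (λ y → h I x y * deg⁻ I y) ≤ D * D
        ∑h≤ x = weighted≤ D (h≥0 I x) (hdeg≤D x)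

        ∑∑h≤ : ∑∑ (λ x y → deg⁻ I x * (h I x y * deg⁻ I y)) ≤ D * D * m I
        ∑∑h≤ = ≤-trans (∑-mono (λ x → ≤-resp (sym (∑-*ˡ (deg⁻ I x) _)) refl (*-monoˡ (deg⁻≥0 I x) (∑h≤ x))))
          (≤-reflexive (trans (∑-*ʳ (D * D) (deg⁻ I)) (*-comm (m I) (D * D))))

      module _ {k : ℕ} (B : Bounded I (3 ℕ.+ k)) (p q : Fin n) (p≢q : p ≢ q) (Hpq : H I p q ≡ false) where
        open Bounded B
        open FirstOrder.Pair I B p q p≢q Hpq
        open Delete I p q p≢q Hpq

        private
          BJ : Bounded J (2 ℕ.+ k)
          BJ = Bounded-delete B p≢q

        wedges≤ : wedges ≤ (ι 4 * (r * r) * A * N J) * (D * m I)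
        wedges≤ = ≤-trans (∑-mono (λ x → path≤ J BJ p q p≢q HJpq x x)) (≤-resp (sym (∑-*ˡ (ι 4 * (r * r) * A * N J) _)) refl
          (*-monoˡ (# 4 ⊗ (r≥0 ⊗ r≥0) ⊗ A≥0 ⊗ N≥0 J) (∑-squares≤ B)))

        paths≤ : paths ≤ (ι 4 * (r * r) * A * N J) * (D * D * m I)
        paths≤ = ≤-trans (∑∑-mono (λ x y → ≤-resp refl (regroup₃ _ (h I x y) (deg⁻ I x) (deg⁻ I y)) (*-monoˡ (h≥0 I x y) (path≤ J BJ p q p≢q HJpq x y))))
          (≤-resp (sym (∑∑-*ˡ (ι 4 * (r * r) * A * N J) _)) refl (*-monoˡ (# 4 ⊗ (r≥0 ⊗ r≥0) ⊗ A≥0 ⊗ N≥0 J) (∑∑h≤ B)))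

        triangles≤ : triangles ≤ (ι 8 * (r * r * r) * A * N J) * ((D * m I) * (D * m I))
        triangles≤ = ≤-trans (∑∑-mono (λ x y → tri≤ J BJ p q p≢q HJpq x y)) (≤-resp (sym (∑∑-*ˡ (ι 8 * (r * r * r) * A * N J) _)) refl
          (*-monoˡ (# 8 ⊗ (r≥0 ⊗ r≥0 ⊗ r≥0) ⊗ A≥0 ⊗ N≥0 J) (≤-resp (sym (∑∑-× _ _)) refl
            (*-mono squares≥0 (D≥0 ⊗ m≥0) (∑-squares≤ B) (∑-squares≤ B)))))
          where
          squares≥0 : 0ℚ ≤ ∑ (λ x → deg⁻ I x * deg⁻ I x)
          squares≥0 = ∑-nonneg (λ x → deg⁻≥0 I x ⊗ deg⁻≥0 I x)

        𝔼L≤ : 𝔼 I (λ G → b I G p q * L G) ≤ m I * P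
        𝔼L≤ = ≤-resp refl (𝔼-*ʳ I (m I) _) (𝔼-mono I (λ G wG → *-monoˡ (b≥0 I G p q) (L≤m G wG)))

        -- In the identity, `L` is replaced by its trivial maximum m, and the obstructions to `R` by
        -- their two- and three-edge upper bounds. The budget of 3 pays for deleting pq and
        -- contracting two more pairs.
        edge-lo : lo A * N I ≤ P
        edge-lo = edge-lo-arith D r m₀ (m I) A (N I) P (N J) wedges paths triangles D≥1 r≥0 m₀r≡1 m≥0 m≤ A≥0 (deg²≤ B p q) P≥0 N-delete (N≥0 J)
          (≤-trans edge-up′ (≤-resp refl (sym (*-assoc _ _ _)) (≤-resp refl (cong (ι 2 *_) (sym (*-assoc r A (N I)))) (*-monoʳ (r≥0 ⊗ (A≥0 ⊗ N≥0 I)) (1+40ε≤2 ε ε≥0 small)))))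
          wedges≤ paths≤ triangles≤
          (≤-trans (≤-reflexive (sym (trans switch-identity R-expansion))) 𝔼L≤)

        chain-lo : ∀ f K → 0ℚ ≤ K → K * N (contract I p q p≢q Hpq) ≤ 𝔼 (contract I p q p≢q Hpq) f →
          K * (lo A * N I) ≤ 𝔼 I (λ G → b I G p q * f G)
        chain-lo f K K≥0 step = ≤-trans (*-monoˡ K≥0 edge-lo) (≤-resp (cong (K *_) (N-contract I p q p≢q Hpq)) (𝔼-contract I p q p≢q Hpq f) step)

    module _ {n : ℕ} (J : Instance n) {p q : Fin n} (p≢q : p ≢ q) {x y : Fin n} (x≢p : x ≢ p) (x≢q : x ≢ q) (y≢p : y ≢ p) (y≢q : y ≢ q)
      (Hpx : H J p x ≡ false) (Hqy : H J q y ≡ false) where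

      private
        K : Instance n
        K = contract J p x (≢-sym x≢p) Hpx

        sepK : isE p x q y ≡ false
        sepK = isE-false⁺ λ { (inj₁ (e , _)) → p≢q (sym e) ; (inj₂ (e , _)) → x≢q (sym e) }

        HKqy : H K q y ≡ false
        HKqy rewrite Hqy = sepK

      -- Budget 4 is one contraction plus the 3 of `edge-lo`. The case x = y is allowed, so wedges
      -- are covered as well.
      path-lo : ∀ {k} → Bounded J (4 ℕ.+ k) → lo (deg⁻ J q * ι (pred (d J) x y)) * (lo (deg² J p x) * N J) ≤ 𝔼 J (λ G → b J G p x * b J G q y)
      path-lo {k} B = chain-lo J {suc k} B p x (≢-sym x≢p) Hpx (λ G → b J G q y) _ (lo≥0 (deg⁻≥0 J q ⊗ # _))
        (≤-resp (cong₂ (λ s t → lo (ι s * ι t) * N K) (lower-away (d J) (≢-sym p≢q) (≢-sym x≢q)) (lower-pred (d J) y≢p))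
          (sym (𝔼-cong K (λ G _ → b-contract-away J p x (≢-sym x≢p) {Hpx} sepK G)))
          (edge-lo K {k} (Bounded-contract B (≢-sym x≢p) Hpx) q y (≢-sym y≢q) HKqy))

      -- Budget 5 is two contractions plus the 3 of `edge-lo`.
      tri-lo : ∀ {k} → Bounded J (5 ℕ.+ k) → x ≢ y → H J x y ≡ false →
        lo (ι (d J x ∸ 1) * ι (d J y ∸ 1)) * (lo (deg² J q y) * (lo (deg² J p x) * N J)) ≤ 𝔼 J (λ G → b J G p x * (b J G q y * b J G x y))
      tri-lo {k} B x≢y Hxy = subst (_≤ 𝔼 J (λ G → b J G p x * (b J G q y * b J G x y))) (*-assoc _ _ _)
        (chain-lo J {suc (suc k)} B p x (≢-sym x≢p) Hpx (λ G → b J G q y * b J G x y) _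
          (lo≥0 (# (d J x ∸ 1) ⊗ # (d J y ∸ 1)) ⊗ lo≥0 (deg²≥0 J q y))
          (≤-resp (trans (cong (λ t → lo (ι (d J x ∸ 1) * ι (d J y ∸ 1)) * (lo t * N K)) (cong₂ (λ s t → ι s * ι t) (lower-away (d J) (≢-sym p≢q) (≢-sym x≢q)) (lower-away (d J) y≢p (≢-sym x≢y))))
              (sym (*-assoc _ _ _)))
            (sym (𝔼-cong K (λ G _ → cong (_* b J G x y) (b-contract-away J p x (≢-sym x≢p) {Hpx} sepK G))))
            (chain-lo K {suc k} BK q y (≢-sym y≢q) HKqy (λ G → b J G x y) _ (lo≥0 (# (d J x ∸ 1) ⊗ # (d J y ∸ 1)))
              (≤-resp (cong₂ (λ s t → lo (ι s * ι t) * N K₂) (trans (lower-away (lower (d J) p x) x≢q x≢y) (lower-at (d J) p x))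
                  (trans (lower-at (lower (d J) p x) q y) (cong (_∸ 1) (lower-away (d J) y≢p (≢-sym x≢y)))))
                (sym (𝔼-cong K₂ (λ G _ → trans (b-contract-away J p x (≢-sym x≢p) {Hpx} sep₁ G) (b-contract-away K q y (≢-sym y≢q) {HKqy} sep₂ G))))
                (edge-lo K₂ {k} (Bounded-contract BK (≢-sym y≢q) HKqy) x y x≢y HK₂xy)))))
        where
        BK : Bounded K (4 ℕ.+ k)
        BK = Bounded-contract B (≢-sym x≢p) Hpx
        K₂ : Instance n
        K₂ = contract K q y (≢-sym y≢q) HKqy
        sep₁ : isE p x x y ≡ false
        sep₁ = isE-false⁺ λ { (inj₁ (_ , e)) → x≢y (sym e) ; (inj₂ (_ , e)) → y≢p e }
        sep₂ : isE q y x y ≡ false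
        sep₂ = isE-false⁺ λ { (inj₁ (e , _)) → x≢q e ; (inj₂ (e , _)) → x≢y e }
        HK₂xy : H K₂ x y ≡ false
        HK₂xy rewrite Hxy | sep₁ = sep₂ 

-- Inverse switchings evaluated to second order.

module BackwardSwitchings where
  open Arithmetic
  open Switching
  open Expectations
  open UpperBounds
  open EdgeChains
  open LowerBounds

  opaque
    unfolding _+_ _*_ _-_ -_ ι ⟦_⟧

    λ⁺²≤ : ∀ e → 0ℚ ≤ e → ι 1000 * e ≤ 1ℚ → (1ℚ + ι 40 * e) * (1ℚ + ι 40 * e) ≤ 1ℚ + ι 120 * e
    λ⁺²≤ e e≥0 s = certify (# 40 ⊗ e≥0 ⊗ 1-40ε≥0 e e≥0 s) (solve (e ∷ []) ℚ-ring)

    λ⁺³≤ : ∀ e → 0ℚ ≤ e → ι 1000 * e ≤ 1ℚ → (1ℚ + ι 40 * e) * ((1ℚ + ι 40 * e) * (1ℚ + ι 40 * e)) ≤ 1ℚ + ι 280 * e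
    λ⁺³≤ e e≥0 s = certify (e≥0 ⊗ (# 155 ⊕ # 5 ⊗ gap s ⊕ # 136 ⊗ e≥0 ⊕ # 64 ⊗ e≥0 ⊗ gap s)) (solve (e ∷ []) ℚ-ring)

    λ⁻²≥ : ∀ e → 0ℚ ≤ e → ι 1000 * e ≤ 1ℚ → 1ℚ - ι 120 * e ≤ (1ℚ - ι 40 * e) * (1ℚ - ι 40 * e)
    λ⁻²≥ e e≥0 s = certify (# 40 ⊗ e≥0 ⊕ # 1600 ⊗ e≥0 ⊗ e≥0) (solve (e ∷ []) ℚ-ring)

    λ⁻³≥ : ∀ e → 0ℚ ≤ e → ι 1000 * e ≤ 1ℚ → 1ℚ - ι 280 * e ≤ (1ℚ - ι 40 * e) * ((1ℚ - ι 40 * e) * (1ℚ - ι 40 * e))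
    λ⁻³≥ e e≥0 s = certify (# 160 ⊗ e≥0 ⊕ # 4736 ⊗ e≥0 ⊗ e≥0 ⊕ # 64 ⊗ e≥0 ⊗ e≥0 ⊗ gap s) (solve (e ∷ []) ℚ-ring)

    factor-path : ∀ l r a b c d N → (l * (r * (b * d))) * ((l * (r * (a * c))) * N) ≡ (l * l) * ((r * r * (a * b) * N) * (c * d))
    factor-path = solve-∀ ℚ-ring

    factor-tri : ∀ l r a b x y x′ y′ N → (l * (r * (x′ * y′))) * ((l * (r * (b * y))) * ((l * (r * (a * x))) * N))
      ≡ (l * (l * l)) * ((r * r * r * (a * b) * N) * ((x * x′) * (y * y′)))
    factor-tri = solve-∀ ℚ-ring

    unless-sum : ∀ Z f t → Z * f * (1ℚ - t) ≡ Z * (f - t * f)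
    unless-sum = solve-∀ ℚ-ring

    1-false : ∀ z → z * (1ℚ - ⟦ false ⟧) ≡ z
    1-false = solve-∀ ℚ-ring

    1-true : ∀ z → z * (1ℚ - ⟦ true ⟧) ≡ 0ℚ
    1-true = solve-∀ ℚ-ring

    -- Source of the second-order accuracy: the main term Y is itself at most e, so a relative error
    -- k e in it is an absolute error of only k e² G.
    rel-up : ∀ k e G Y t → 0ℚ ≤ k → 0ℚ ≤ e → 0ℚ ≤ G → Y ≤ e → t ≤ (1ℚ + k * e) * (G * Y) → t ≤ G * Y + k * (e * e) * G
    rel-up k e G Y t k≥0 e≥0 G≥0 Y≤e h = certify (gap h ⊕ k≥0 ⊗ e≥0 ⊗ G≥0 ⊗ gap Y≤e) (solve (k ∷ e ∷ G ∷ Y ∷ t ∷ []) ℚ-ring)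

    -- Here a part X of the main term may be missing altogether, provided that it is already O(e²).
    rel-lo : ∀ k j e G Y X t → 0ℚ ≤ k → 0ℚ ≤ e → 0ℚ ≤ G → Y ≤ e → 0ℚ ≤ X → X ≤ j * (e * e) → (1ℚ - k * e) * (G * (Y - X)) ≤ t →
      G * Y ≤ t + (k + j) * (e * e) * G
    rel-lo k j e G Y X t k≥0 e≥0 G≥0 Y≤e X≥0 X≤ h = certify (gap h ⊕ k≥0 ⊗ e≥0 ⊗ G≥0 ⊗ gap Y≤e ⊕ G≥0 ⊗ gap X≤ ⊕ k≥0 ⊗ e≥0 ⊗ (G≥0 ⊗ X≥0))
      (solve (k ∷ j ∷ e ∷ G ∷ Y ∷ X ∷ t ∷ []) ℚ-ring)

    wedge-ratio≤ : ∀ D r m M → 1ℚ ≤ D → 0ℚ ≤ r → m * r ≡ 1ℚ → M ≤ D * m → r * r * M ≤ D * D * r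
    wedge-ratio≤ D r m M D≥1 r≥0 mr h = certify (r≥0 ⊗ r≥0 ⊗ gap h ⊕ zero⁺ ((- (r * D)) ⊠ mr) ⊕ r≥0 ⊗ ≤-trans 0≤1 D≥1 ⊗ gap D≥1) (solve (D ∷ r ∷ m ∷ M ∷ []) ℚ-ring)

    path-ratio≤ : ∀ D r m Ω → 0ℚ ≤ r → m * r ≡ 1ℚ → Ω ≤ D * D * m → r * r * Ω ≤ D * D * r
    path-ratio≤ D r m Ω r≥0 mr h = certify (r≥0 ⊗ r≥0 ⊗ gap h ⊕ zero⁺ ((- (r * D * D)) ⊠ mr)) (solve (D ∷ r ∷ m ∷ Ω ∷ []) ℚ-ring)

    tri-ratio≤ : ∀ D r m M → 1ℚ ≤ D → 0ℚ ≤ r → m * r ≡ 1ℚ → 0ℚ ≤ M → M ≤ D * m → r * r * r * (M * M) ≤ D * D * r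
    tri-ratio≤ D r m M D≥1 r≥0 mr M≥0 h = certify (r≥0 ⊗ (≤-trans 0≤1 D≥1 ⊕ r≥0 ⊗ M≥0) ⊗ (r≥0 ⊗ gap h) ⊕ zero⁺ ((- (r * (D + r * M) * D)) ⊠ mr)) (solve (D ∷ r ∷ m ∷ M ∷ []) ℚ-ring)

    wedge-loss≤ : ∀ D r X → 1ℚ ≤ D → 0ℚ ≤ r → X ≤ D * D * ((1ℚ + 1ℚ) + (D + D)) → r * r * X ≤ ι 4 * ((D * D * r) * (D * D * r))
    wedge-loss≤ D r X D≥1 r≥0 h = certify (r≥0 ⊗ r≥0 ⊗ gap h ⊕ # 2 ⊗ (r≥0 ⊗ r≥0 ⊗ D≥0 ⊗ D≥0) ⊗ (gap D≥1 ⊗ (D≥0 ⊕ D≥0 ⊕ 0≤1))) (solve (D ∷ r ∷ X ∷ []) ℚ-ring)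
      where
      D≥0 : 0ℚ ≤ D
      D≥0 = ≤-trans 0≤1 D≥1

    tri-loss≤ : ∀ D r m X → 0ℚ ≤ r → m * r ≡ 1ℚ → X ≤ ι 8 * (D * D * D * D * m) → r * r * r * X ≤ ι 8 * ((D * D * r) * (D * D * r))
    tri-loss≤ D r m X r≥0 mr h = certify (r≥0 ⊗ r≥0 ⊗ r≥0 ⊗ gap h ⊕ zero⁺ ((- (ι 8 * (r * r * D * D * D * D))) ⊠ mr)) (solve (D ∷ r ∷ m ∷ X ∷ []) ℚ-ring)

    -- The four kinds of bad pairs, namely x near u, y near v, x = y and xy in H, weigh at most (5D²
    -- + 3D³)M, which is at most 8D⁴m because M ≤ D m.
    tri-bad-arith : ∀ D m M a b s t → 1ℚ ≤ D → 0ℚ ≤ m → 0ℚ ≤ M → M ≤ D * m → a ≤ D * D * ((1ℚ + 1ℚ) + D) → b ≤ D * D * ((1ℚ + 1ℚ) + D) →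
      s ≤ D * D * M → t ≤ M * (D * D * D) → (a * M + M * b) + (s + t) ≤ ι 8 * (D * D * D * D * m)
    tri-bad-arith D m M a b s t D≥1 m≥0 M≥0 M≤ ha hb hs ht = certify (M≥0 ⊗ gap ha ⊕ M≥0 ⊗ gap hb ⊕ gap hs ⊕ gap ht
        ⊕ (D≥0 ⊗ D≥0 ⊗ (# 5 ⊕ # 3 ⊗ D≥0)) ⊗ gap M≤ ⊕ # 5 ⊗ (D≥0 ⊗ D≥0 ⊗ D≥0 ⊗ m≥0) ⊗ gap D≥1)
      (solve (D ∷ m ∷ M ∷ a ∷ b ∷ s ∷ t ∷ []) ℚ-ring)
      where
      D≥0 : 0ℚ ≤ D
      D≥0 = ≤-trans 0≤1 D≥1

    ratio-comm : ∀ k r A Q M → k * ((r * r * A * Q) * M) ≡ k * ((A * Q) * (r * r * M))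
    ratio-comm = solve-∀ ℚ-ring

    ratio-comm₃ : ∀ k r A Q M → k * ((r * r * r * A * Q) * M) ≡ k * ((A * Q) * (r * r * r * M))
    ratio-comm₃ = solve-∀ ℚ-ring

    scale-out : ∀ k g f → k * (g * f) ≡ (k * g) * f
    scale-out = solve-∀ ℚ-ring

    ratio-sub : ∀ r M X → r * (M - X) ≡ r * M - r * X
    ratio-sub = solve-∀ ℚ-ring

    expand-bad : ∀ a b δ h f g → ((a + b) + (δ + h)) * (f * g) ≡ ((a * f) * g + f * (b * g)) + (δ * (f * g) + f * (h * g))
    expand-bad = solve-∀ ℚ-ring

  unless : ∀ t {Z E} → (t ≡ false → Z ≤ E) → 0ℚ ≤ E → Z * (1ℚ - ⟦ t ⟧) ≤ E
  unless true {Z} good E≥0 = ≤-resp (sym (1-true Z)) refl E≥0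
  unless false {Z} good E≥0 = ≤-resp (sym (1-false Z)) refl (good refl)

  open Expectation

  -- From here on m₀ is the residual degree sum itself. The budget 6 is that of the longest chain:
  -- delete uv, contract ux and vy, then 3 for the lower bound on xy.
  module BackwardCount (D r : ℚ) {n : ℕ} (I : Instance n) (D≥1 : 1ℚ ≤ D) (r≥0 : 0ℚ ≤ r) (mr≡1 : m I * r ≡ 1ℚ) (small : ι 1000 * (D * D * r) ≤ 1ℚ)
    (B : Bounds.Bounded D (m I) r D≥1 r≥0 mr≡1 small I 6) (u v : Fin n) (u≢v : u ≢ v) (Huv : H I u v ≡ false) where

    open LowerEstimates D (m I) r D≥1 r≥0 mr≡1 small
    open FirstOrder I B using (hdeg; hdeg≤D)
    open FirstOrder.Pair I B u v u≢v Huv using (A; A≥0; P; P≥0)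
    open Delete I u v u≢v Huv

    private
      BJ : Bounded J 5
      BJ = Bounded-delete B u≢v

    dq : Fin n → ℚ
    dq = deg⁻ I

    F : Fin n → ℚ
    F x = dq x * ι (d I x ∸ 1)

    M₂ : ℚ
    M₂ = ∑ F

    Q : ℚ
    Q = N J

    AQ≥0 : 0ℚ ≤ A * Q
    AQ≥0 = A≥0 ⊗ N≥0 J

    F≥0 : ∀ x → 0ℚ ≤ F x
    F≥0 x = deg⁻≥0 I x ⊗ # _

    ι-pred≤ : ∀ x → ι (d I x ∸ 1) ≤ dq x
    ι-pred≤ x = ι-mono (ℕP.m∸n≤m (d I x) 1)

    F≤ : ∀ x → F x ≤ D * D
    F≤ x = *-mono (deg⁻≥0 I x) D≥0 (Bounded.deg≤ B x) (≤-trans (ι-pred≤ x) (Bounded.deg≤ B x))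

    M₂≥0 : 0ℚ ≤ M₂
    M₂≥0 = ∑-nonneg F≥0

    M₂≤ : M₂ ≤ D * m I
    M₂≤ = ≤-trans (∑-mono (λ x → *-monoˡ (deg⁻≥0 I x) (ι-pred≤ x))) (∑-squares≤ I B)

    weightedF≤ : ∀ (t : Fin n → ℚ) K → (∀ x → 0ℚ ≤ t x) → ∑ t ≤ K → ∑ (λ x → t x * F x) ≤ D * D * K
    weightedF≤ t K t≥0 h = ≤-trans (∑-mono (λ x → *-monoˡ (t≥0 x) (F≤ x))) (≤-resp (sym (∑-*ʳ (D * D) t)) (*-comm K (D * D)) (*-monoʳ (D≥0 ⊗ D≥0) h))

    ∑-unless : ∀ Z (t : Fin n → ℚ) → ∑ (λ x → Z * F x * (1ℚ - t x)) ≡ Z * (M₂ - ∑ (λ x → t x * F x))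
    ∑-unless Z t = trans (∑-cong (λ x → unless-sum Z (F x) (t x))) (trans (∑-*ˡ Z _) (cong (Z *_) (∑-- F _)))

    -- Terms with near s x vanish, whereas their main terms are only negligible.
    near : Fin n → Fin n → Bool
    near s x = (x == u) ∨ ((x == v) ∨ H I s x)

    near-sum : ∀ s → ∑ (λ x → ⟦ near s x ⟧) ≤ (1ℚ + 1ℚ) + hdeg s
    near-sum s = ≤-resp refl (trans (∑-+ _ _) (trans (cong₂ _+_ (∑-δ1 u) (trans (∑-+ _ _) (cong (_+ hdeg s) (∑-δ1 v)))) (sym (+-assoc 1ℚ 1ℚ (hdeg s)))))
      (∑-mono (λ x → ≤-trans (⟦∨⟧-≤ (x == u) ((x == v) ∨ H I s x)) (+-mono-≤ ≤-refl (⟦∨⟧-≤ (x == v) (H I s x)))))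

    far : ∀ {s x} → near s x ≡ false → x ≢ u × x ≢ v × H I s x ≡ false
    far {s} {x} e = ==-false (proj₁ e₁) , ==-false (proj₁ e₂) , proj₂ e₂
      where
      e₁ = ∨-false⁻ {x == u} e
      e₂ = ∨-false⁻ {x == v} (proj₂ e₁)

    HJ-false : ∀ {s x} → x ≢ u → x ≢ v → H I s x ≡ false → H J s x ≡ false
    HJ-false x≢u x≢v e rewrite e = isE-false⁺ λ { (inj₁ (_ , k)) → x≢v k ; (inj₂ (_ , k)) → x≢u k }

    HJ-true : ∀ {s x} → H I s x ≡ true → H J s x ≡ true
    HJ-true e rewrite e = refl

    G₂ G₃ : ℚ
    G₂ = r * r * A * Q
    G₃ = r * r * r * A * Q

    G₂≥0 : 0ℚ ≤ G₂
    G₂≥0 = r≥0 ⊗ r≥0 ⊗ A≥0 ⊗ N≥0 J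

    G₃≥0 : 0ℚ ≤ G₃
    G₃≥0 = r≥0 ⊗ r≥0 ⊗ r≥0 ⊗ A≥0 ⊗ N≥0 J

    path-up′ : ∀ x y {t} → dq x * ι (pred (d I) x y) ≡ t → 𝔼 J (λ G → b J G u x * b J G v y) ≤ (1ℚ + ι 120 * ε) * (G₂ * t)
    path-up′ x y {t} e = ≤-trans (path-up J BJ u v u≢v HJpq x y) (≤-resp (sym (trans (factor-path λ⁺ r (dq u) (dq v) (dq x) _ Q) (cong (λ z → λ⁺ * λ⁺ * (G₂ * z)) e))) refl
      (*-monoʳ (G₂≥0 ⊗ subst (0ℚ ≤_) e (deg⁻≥0 I x ⊗ # _)) (λ⁺²≤ ε ε≥0 small)))

    path-lo′ : ∀ x y {t} → dq x * ι (pred (d I) x y) ≡ t → near u x ≡ false → near v y ≡ false → (1ℚ - ι 120 * ε) * (G₂ * t) ≤ 𝔼 J (λ G → b J G u x * b J G v y)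
    path-lo′ x y {t} e nx ny = ≤-trans (≤-resp refl (sym (trans (factor-path λ⁻ r (dq u) (dq v) (dq x) _ Q) (cong (λ z → λ⁻ * λ⁻ * (G₂ * z)) e)))
        (*-monoʳ (G₂≥0 ⊗ subst (0ℚ ≤_) e (deg⁻≥0 I x ⊗ # _)) (λ⁻²≥ ε ε≥0 small)))
      (path-lo J u≢v (proj₁ (far nx)) (proj₁ (proj₂ (far nx))) (proj₁ (far ny)) (proj₁ (proj₂ (far ny)))
        (HJ-false (proj₁ (far nx)) (proj₁ (proj₂ (far nx))) (proj₂ (proj₂ (far nx)))) (HJ-false (proj₁ (far ny)) (proj₁ (proj₂ (far ny))) (proj₂ (proj₂ (far ny)))) {1} BJ)

    path≥0 : ∀ x y → 0ℚ ≤ 𝔼 J (λ G → b J G u x * b J G v y)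
    path≥0 x y = 𝔼-nonneg J (λ G _ → b≥0 J G u x ⊗ b≥0 J G v y)

    -- A wedge at x has probability about r d(u) d(x) times r d(v) (d(x) - 1), where the second edge
    -- finds one degree of x used up. Summation over x produces `M₂`.
    wedges-up : wedges ≤ A * Q * (r * r * M₂) + ι 120 * (ε * ε) * (A * Q)
    wedges-up = rel-up (ι 120) ε (A * Q) (r * r * M₂) wedges (# 120) ε≥0 AQ≥0 (wedge-ratio≤ D r (m I) M₂ D≥1 r≥0 mr≡1 M₂≤)
      (≤-trans (∑-mono (λ x → path-up′ x x (cong (λ t → dq x * ι t) (pred-same (d I) x))))
        (≤-reflexive (trans (∑-cong (λ x → scale-out (1ℚ + ι 120 * ε) G₂ (F x))) (trans (∑-*ˡ _ F) (trans (sym (scale-out _ G₂ M₂)) (ratio-comm _ r A Q M₂))))))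

    wedges-lo : A * Q * (r * r * M₂) ≤ wedges + (ι 120 + ι 4) * (ε * ε) * (A * Q)
    wedges-lo = rel-lo (ι 120) (ι 4) ε (A * Q) (r * r * M₂) (r * r * X) wedges (# 120) ε≥0 AQ≥0 (wedge-ratio≤ D r (m I) M₂ D≥1 r≥0 mr≡1 M₂≤)
        (r≥0 ⊗ r≥0 ⊗ X≥0) (wedge-loss≤ D r X D≥1 r≥0 (weightedF≤ _ _ (λ x → ⟦⟧≥0 (bad x)) bad-sum))
        (≤-trans (≤-reflexive (trans (cong (λ t → (1ℚ - ι 120 * ε) * (A * Q * t)) (sym (ratio-sub (r * r) M₂ X))) (trans (sym (ratio-comm _ r A Q (M₂ - X)))
            (trans (scale-out _ G₂ (M₂ - X)) (sym (∑-unless ((1ℚ - ι 120 * ε) * G₂) (λ x → ⟦ bad x ⟧)))))))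
          (∑-mono (λ x → unless (bad x) (good x) (path≥0 x x))))
      where
      bad : Fin n → Bool
      bad x = near u x ∨ H I v x
      X : ℚ
      X = ∑ (λ x → ⟦ bad x ⟧ * F x)
      X≥0 : 0ℚ ≤ X
      X≥0 = ∑-nonneg (λ x → ⟦⟧≥0 (bad x) ⊗ F≥0 x)
      bad-sum : ∑ (λ x → ⟦ bad x ⟧) ≤ (1ℚ + 1ℚ) + (D + D)
      bad-sum = ≤-trans (∑-mono (λ x → ⟦∨⟧-≤ (near u x) (H I v x))) (≤-trans (≤-reflexive (∑-+ _ _))
        (≤-trans (+-mono-≤ (≤-trans (near-sum u) (+-mono-≤ ≤-refl (hdeg≤D u))) (hdeg≤D v)) (≤-reflexive (+-assoc _ D D))))
      good : ∀ x → bad x ≡ false → (1ℚ - ι 120 * ε) * G₂ * F x ≤ 𝔼 J (λ G → b J G u x * b J G v x)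
      good x e = ≤-trans (≤-reflexive (sym (scale-out _ G₂ (F x)))) (path-lo′ x x (cong (λ t → dq x * ι t) (pred-same (d I) x)) e₁ nv)
        where
        e₁ = proj₁ (∨-false⁻ {near u x} e)
        nv : near v x ≡ false
        nv rewrite ==-≢ (proj₁ (far e₁)) | ==-≢ (proj₁ (proj₂ (far e₁))) = proj₂ (∨-false⁻ {near u x} e)

    W : Fin n → Fin n → Bool
    W x y = H I x y ∧ (not (H I x u) ∧ (not (H I y v) ∧ (not (x == u) ∧ (not (x == v) ∧ (not (y == u) ∧ not (y == v))))))

    -- Origin of the set W: for xy in H, its conditions say exactly that neither x is near u nor y
    -- near v, so that ux and vy are not ruled out as free edges.
    W-near : ∀ x y → H I x y ≡ true → W x y ≡ not (near u x ∨ near v y)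
    W-near x y e rewrite e | H-sym I x u | H-sym I y v = bool (H I u x) (H I v y) (x == u) (x == v) (y == u) (y == v)
      where
      bool : ∀ a b c e f g → not a ∧ (not b ∧ (not c ∧ (not e ∧ (not f ∧ not g)))) ≡ not ((c ∨ (e ∨ a)) ∨ (f ∨ (g ∨ b)))
      bool a b true e f g = trans (cong (not a ∧_) (∧-zeroʳ (not b))) (∧-zeroʳ (not a))
      bool a b false true f g = trans (cong (not a ∧_) (∧-zeroʳ (not b))) (∧-zeroʳ (not a))
      bool true b false false f g = refl
      bool false true false false true g = refl
      bool false true false false false true = refl
      bool false true false false false false = refl
      bool false false false false true g = refl
      bool false false false false false true = refl
      bool false false false false false false = refl

    Ω : ℚ
    Ω = ∑∑ λ x y → ⟦ W x y ⟧ * (dq x * dq y)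

    Ω≥0 : 0ℚ ≤ Ω
    Ω≥0 = ∑∑-nonneg (λ x y → ⟦⟧≥0 (W x y) ⊗ (deg⁻≥0 I x ⊗ deg⁻≥0 I y))

    Ω≤ : Ω ≤ D * D * m I
    Ω≤ = ≤-trans (∑∑-mono (λ x y → ≤-resp refl (*-swap₃ _ _ _) (*-monoʳ (deg⁻≥0 I x ⊗ deg⁻≥0 I y) (⟦⟧-mono (λ e → proj₁ (∧-true⁻ {H I x y} e)))))) (∑∑h≤ I B)

    path-dead : ∀ x y → near u x ∨ near v y ≡ true → ∀ G → w J G ≡ true → b J G u x * b J G v y ≡ 0ℚ
    path-dead x y e G wG with ∨-true⁻ {near u x} e
    ... | inj₁ e₁ = trans (cong (_* b J G v y) (dead x e₁)) (*-zeroˡ _)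
      where
      dead : ∀ x → near u x ≡ true → b J G u x ≡ 0ℚ
      dead x e with ∨-true⁻ {x == u} e
      ... | inj₁ k rewrite ==-true k = b-irr J G wG u
      ... | inj₂ e′ with ∨-true⁻ {x == v} e′
      ...   | inj₁ k rewrite ==-true k = b≡0 J G HJpq
      ...   | inj₂ k = b≡0 J G (HJ-true k)
    ... | inj₂ e₁ = trans (cong (b J G u x *_) (dead y e₁)) (*-zeroʳ _)
      where
      dead : ∀ y → near v y ≡ true → b J G v y ≡ 0ℚ
      dead y e with ∨-true⁻ {y == u} e
      ... | inj₁ k rewrite ==-true k = b≡0 J G (trans (H-sym J v u) HJpq)
      ... | inj₂ e′ with ∨-true⁻ {y == v} e′
      ...   | inj₁ k rewrite ==-true k = b-irr J G wG v
      ...   | inj₂ k = b≡0 J G (HJ-true k)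

    -- `H` has no loops, so xy in `H` forces x ≠ y, and y keeps its full degree.
    pred-H : ∀ x y → H I x y ≡ true → dq x * ι (pred (d I) x y) ≡ dq x * dq y
    pred-H x y e = cong (λ t → dq x * ι t) (pred-≢ (d I) (λ { refl → true≢false e (H-irr I x) }))

    W-off : ∀ x y → H I x y ≡ false → W x y ≡ false
    W-off x y e rewrite e = refl

    paths-up : paths ≤ A * Q * (r * r * Ω) + ι 120 * (ε * ε) * (A * Q)
    paths-up = rel-up (ι 120) ε (A * Q) (r * r * Ω) paths (# 120) ε≥0 AQ≥0 (path-ratio≤ D r (m I) Ω r≥0 mr≡1 Ω≤)
      (≤-trans (∑∑-mono (λ x y → each x y (H I x y) refl)) (≤-reflexive (trans (∑∑-*ˡ _ _) (trans (sym (scale-out _ G₂ Ω)) (ratio-comm _ r A Q Ω)))))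
      where
      each : ∀ x y t → H I x y ≡ t → ⟦ t ⟧ * 𝔼 J (λ G → b J G u x * b J G v y) ≤ (1ℚ + ι 120 * ε) * G₂ * (⟦ W x y ⟧ * (dq x * dq y))
      each x y false e rewrite W-off x y e | ⟦false⟧ = ≤-reflexive (trans (*-zeroˡ _) (sym (trans (cong (_ *_) (*-zeroˡ _)) (*-zeroʳ _))))
      each x y true e rewrite W-near x y e | ⟦true⟧ = ≤-trans (≤-reflexive (*-identityˡ _)) (go (near u x ∨ near v y) refl)
        where
        go : ∀ t → near u x ∨ near v y ≡ t → 𝔼 J (λ G → b J G u x * b J G v y) ≤ (1ℚ + ι 120 * ε) * G₂ * (⟦ not t ⟧ * (dq x * dq y))
        go true k = vanish J ((0≤1 ⊕ # 120 ⊗ ε≥0) ⊗ G₂≥0 ⊗ (⟦⟧≥0 _ ⊗ (deg⁻≥0 I x ⊗ deg⁻≥0 I y))) (path-dead x y k)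
        go false k rewrite ⟦true⟧ = ≤-trans (path-up′ x y (pred-H x y e)) (≤-reflexive (trans (scale-out _ G₂ _) (cong (_ *_) (sym (*-identityˡ _)))))

    -- `Ω` contains no near pairs, so nothing of the main term has to be discarded: the missing part
    -- is 0, and `ι 0` is its coefficient.
    paths-lo : A * Q * (r * r * Ω) ≤ paths + (ι 120 + ι 0) * (ε * ε) * (A * Q)
    paths-lo = rel-lo (ι 120) (ι 0) ε (A * Q) (r * r * Ω) 0ℚ paths (# 120) ε≥0 AQ≥0 (path-ratio≤ D r (m I) Ω r≥0 mr≡1 Ω≤)
      ≤-refl (# 0 ⊗ (ε≥0 ⊗ ε≥0))
      (≤-trans (≤-reflexive (sym (trans (∑∑-*ˡ _ _) (trans (sym (scale-out _ G₂ Ω)) (trans (ratio-comm _ r A Q Ω) (cong (λ t → (1ℚ - ι 120 * ε) * (A * Q * t)) (sym (x-0≡x (r * r * Ω)))))))))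
        (∑∑-mono (λ x y → each x y (H I x y) refl)))
      where
      each : ∀ x y t → H I x y ≡ t → (1ℚ - ι 120 * ε) * G₂ * (⟦ W x y ⟧ * (dq x * dq y)) ≤ ⟦ t ⟧ * 𝔼 J (λ G → b J G u x * b J G v y)
      each x y false e rewrite W-off x y e | ⟦false⟧ = ≤-reflexive (trans (trans (cong (_ *_) (*-zeroˡ _)) (*-zeroʳ _)) (sym (*-zeroˡ _)))
      each x y true e rewrite W-near x y e | ⟦true⟧ = ≤-trans (go (near u x ∨ near v y) refl) (≤-reflexive (sym (*-identityˡ _)))
        where
        go : ∀ t → near u x ∨ near v y ≡ t → (1ℚ - ι 120 * ε) * G₂ * (⟦ not t ⟧ * (dq x * dq y)) ≤ 𝔼 J (λ G → b J G u x * b J G v y)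
        go true k rewrite ⟦false⟧ = ≤-trans (≤-reflexive (trans (cong (_ *_) (*-zeroˡ _)) (*-zeroʳ _))) (path≥0 x y)
        go false k rewrite ⟦true⟧ = ≤-trans (≤-reflexive (sym (trans (scale-out _ G₂ _) (cong (_ *_) (sym (*-identityˡ _))))))
          (path-lo′ x y (pred-H x y e) (proj₁ (∨-false⁻ {near u x} k)) (proj₂ (∨-false⁻ {near u x} k)))

    -- The edges ux, vy, xy together have probability about r³ d(u) d(v) times d(x)(d(x) - 1)
    -- d(y)(d(y) - 1), so the double sum factors as the square of `M₂`.
    triangles-up : triangles ≤ A * Q * (r * r * r * (M₂ * M₂)) + ι 280 * (ε * ε) * (A * Q)
    triangles-up = rel-up (ι 280) ε (A * Q) (r * r * r * (M₂ * M₂)) triangles (# 280) ε≥0 AQ≥0 (tri-ratio≤ D r (m I) M₂ D≥1 r≥0 mr≡1 M₂≥0 M₂≤)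
      (≤-trans (∑∑-mono each) (≤-reflexive (trans (∑∑-*ˡ _ _) (trans (cong ((1ℚ + ι 280 * ε) * G₃ *_) (∑∑-× F F)) (trans (sym (scale-out _ G₃ (M₂ * M₂))) (ratio-comm₃ _ r A Q (M₂ * M₂)))))))
      where
      each : ∀ x y → 𝔼 J (λ G → b J G u x * (b J G v y * b J G x y)) ≤ (1ℚ + ι 280 * ε) * G₃ * (F x * F y)
      each x y = ≤-trans (tri-up J BJ u v u≢v HJpq x y) (≤-resp (sym (factor-tri λ⁺ r (dq u) (dq v) (dq x) (dq y) _ _ Q)) (scale-out _ G₃ _)
        (*-monoʳ (G₃≥0 ⊗ (F≥0 x ⊗ F≥0 y)) (λ⁺³≤ ε ε≥0 small)))

    triangles-lo : A * Q * (r * r * r * (M₂ * M₂)) ≤ triangles + (ι 280 + ι 8) * (ε * ε) * (A * Q)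
    triangles-lo = rel-lo (ι 280) (ι 8) ε (A * Q) (r * r * r * (M₂ * M₂)) (r * r * r * X) triangles (# 280) ε≥0 AQ≥0 (tri-ratio≤ D r (m I) M₂ D≥1 r≥0 mr≡1 M₂≥0 M₂≤)
        (r≥0 ⊗ r≥0 ⊗ r≥0 ⊗ X≥0) (tri-loss≤ D r (m I) X r≥0 mr≡1 X≤)
        (≤-trans (≤-reflexive (trans (cong (λ t → (1ℚ - ι 280 * ε) * (A * Q * t)) (sym (ratio-sub (r * r * r) (M₂ * M₂) X))) (trans (sym (ratio-comm₃ _ r A Q (M₂ * M₂ - X)))
            (trans (scale-out _ G₃ (M₂ * M₂ - X)) (sym (trans (∑∑-cong (λ x y → unless-sum _ (F x * F y) ⟦ bad x y ⟧)) (trans (∑∑-*ˡ _ _) (cong ((1ℚ - ι 280 * ε) * G₃ *_) (trans (∑∑-- _ _) (cong (λ t → t - X) (∑∑-× F F)))))))))))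
          (∑∑-mono (λ x y → unless (bad x y) (good x y) (𝔼-nonneg J (λ G _ → b≥0 J G u x ⊗ (b≥0 J G v y ⊗ b≥0 J G x y))))))
      where
      bad : Fin n → Fin n → Bool
      bad x y = (near u x ∨ near v y) ∨ ((x == y) ∨ H I x y)
      X : ℚ
      X = ∑∑ (λ x y → ⟦ bad x y ⟧ * (F x * F y))
      X≥0 : 0ℚ ≤ X
      X≥0 = ∑∑-nonneg (λ x y → ⟦⟧≥0 (bad x y) ⊗ (F≥0 x ⊗ F≥0 y))
      near-F : ∀ s → ∑ (λ x → ⟦ near s x ⟧ * F x) ≤ D * D * ((1ℚ + 1ℚ) + D)
      near-F s = weightedF≤ _ _ (λ x → ⟦⟧≥0 (near s x)) (≤-trans (near-sum s) (+-mono-≤ ≤-refl (hdeg≤D s)))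
      X≤ : X ≤ ι 8 * (D * D * D * D * m I)
      X≤ = ≤-trans (∑∑-mono (λ x y → ≤-trans (*-monoʳ (F≥0 x ⊗ F≥0 y)
              (≤-trans (⟦∨⟧-≤ (near u x ∨ near v y) ((x == y) ∨ H I x y)) (+-mono-≤ (⟦∨⟧-≤ (near u x) (near v y)) (⟦∨⟧-≤ (x == y) (H I x y)))))
              (≤-reflexive (expand-bad ⟦ near u x ⟧ ⟦ near v y ⟧ (δ x y) (h I x y) (F x) (F y)))))
        (≤-trans (≤-reflexive (trans (∑∑-+ _ _) (cong₂ _+_ (trans (∑∑-+ _ _) (cong₂ _+_ (∑∑-× _ F) (∑∑-× F _))) (trans (∑∑-+ _ _) (cong₂ _+_ (∑∑-δ (λ x y → F x * F y)) refl)))))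
          (tri-bad-arith D (m I) M₂ _ _ _ _ D≥1 (m≥0 I) M₂≥0 M₂≤ (near-F u) (near-F v) (weightedF≤ F M₂ F≥0 ≤-refl)
            (≤-trans (∑-mono (λ x → ≤-resp (sym (∑-*ˡ (F x) _)) refl (*-monoˡ (F≥0 x) (weightedF≤ (h I x) D (h≥0 I x) (hdeg≤D x))))) (≤-reflexive (∑-*ʳ _ F)))))
      good : ∀ x y → bad x y ≡ false → (1ℚ - ι 280 * ε) * G₃ * (F x * F y) ≤ 𝔼 J (λ G → b J G u x * (b J G v y * b J G x y))
      good x y e = ≤-trans (≤-resp (scale-out _ G₃ _) (sym (factor-tri λ⁻ r (dq u) (dq v) (dq x) (dq y) _ _ Q)) (*-monoʳ (G₃≥0 ⊗ (F≥0 x ⊗ F≥0 y)) (λ⁻³≥ ε ε≥0 small)))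
        (tri-lo J u≢v (proj₁ (far nx)) (proj₁ (proj₂ (far nx))) (proj₁ (far ny)) (proj₁ (proj₂ (far ny)))
          (HJ-false (proj₁ (far nx)) (proj₁ (proj₂ (far nx))) (proj₂ (proj₂ (far nx)))) (HJ-false (proj₁ (far ny)) (proj₁ (proj₂ (far ny))) (proj₂ (proj₂ (far ny)))) {0} BJ
          (==-false (proj₁ (∨-false⁻ {x == y} e₂))) (HJ-false (proj₁ (far ny)) (proj₁ (proj₂ (far ny))) (proj₂ (∨-false⁻ {x == y} e₂))))
        where
        e₁ = proj₁ (∨-false⁻ {near u x ∨ near v y} e)
        e₂ = proj₂ (∨-false⁻ {near u x ∨ near v y} e)
        nx = proj₁ (∨-false⁻ {near u x} e₁)
        ny = proj₂ (∨-false⁻ {near u x} e₁)   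

-- Forward switchings evaluated to second order.

module ForwardSwitchings where
  open Arithmetic
  open Switching
  open Expectations
  open UpperBounds
  open EdgeChains
  open LowerBounds
  open BackwardSwitchings

  open Expectation

  opaque
    unfolding _+_ _*_ _-_ -_ ι ⟦_⟧

    1-c-split : ∀ νx νy b c c′ → νx * νy * b * ((1ℚ - c) * (1ℚ - c′)) ≡ νx * (νy * b) - (νx * c) * (νy * b) - (νy * c′) * (νx * b) + νx * νy * b * (c * c′)
    1-c-split = solve-∀ ℚ-ring

    ν-linear : ∀ s t f → s * t ≡ 0ℚ → (1ℚ - s) * (1ℚ - t) * f ≡ f - (s * f + t * f)
    ν-linear s t f z = equate (f ⊠ z) (solve (s ∷ t ∷ f ∷ []) ℚ-ring)

    side-term : ∀ ν b h d bt → ν * h ≡ h → h * b ≡ 0ℚ → b * b ≡ b → ν * (b * bt) ≡ b * bt →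
      ν * (b + h) * (d - (b + bt)) ≡ (h * d - h * bt) + (ν * (b * (d - 1ℚ)) - b * bt)
    side-term ν b h d bt νh hb bb νbb = equate ((d - bt - b) ⊠ νh ⊞ (- 1ℚ) ⊠ hb ⊞ (- ν) ⊠ bb ⊞ (- 1ℚ) ⊠ νbb) (solve (ν ∷ b ∷ h ∷ d ∷ bt ∷ []) ℚ-ring)

    -- Of the m ordered edges xy, du + dv have y among u, v. A further (du - 1) + (dv - 1) have x
    -- among u, v but y not, the edge uv itself being already removed.
    S₀-arith : ∀ m du dv uu uv vu vv → uu ≡ 0ℚ → vv ≡ 0ℚ → uv ≡ 1ℚ → vu ≡ 1ℚ →
      (m - (du + dv)) - ((du - (uu + uv)) + (dv - (vu + vv))) ≡ m - ι 2 * (du + dv) + ι 2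
    S₀-arith m du dv _ _ _ _ refl refl refl refl = solve (m ∷ du ∷ dv ∷ []) ℚ-ring

    L-collect : ∀ s n₁ a₁ U₁ e₁ n₂ a₂ U₂ e₂ s₃ → s - ((n₁ - a₁) + (U₁ - e₁)) - ((n₂ - a₂) + (U₂ - e₂)) + s₃ ≡
      (s - n₁ - n₂) - (U₁ + U₂) + (((a₁ + e₁) + (a₂ + e₂)) + s₃)
    L-collect = solve-∀ ℚ-ring

    expand-s₃ : ∀ b bu hu bv hv → b * ((bu + hu) * (bv + hv)) ≡ (bu * (bv * b) + (hu * hv) * b) + (hv * (bu * b) + hu * (bv * b))
    expand-s₃ = solve-∀ ℚ-ring

    hinge-regroup : ∀ r P du dx dy h → h * ((ι 2 * (r * (dx * dy))) * ((ι 2 * (r * (du * dx))) * P)) ≡ (ι 4 * (r * r) * du * P) * ((dx * dx) * (h * dy))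
    hinge-regroup = solve-∀ ℚ-ring

    single-regroup : ∀ r P dv dx h → h * ((ι 2 * (r * (dv * dx))) * P) ≡ (ι 2 * r * dv * P) * (h * dx)
    single-regroup = solve-∀ ℚ-ring

    double-regroup : ∀ r P dx dy h h′ → (h * h′) * ((ι 2 * (r * (dx * dy))) * P) ≡ (ι 2 * r * P) * ((h * dx) * (h′ * dy))
    double-regroup = solve-∀ ℚ-ring

    U-scale : ∀ r k g P M → r * (k * ((r * g * P) * M)) ≡ k * (P * (r * (r * g * M)))
    U-scale = solve-∀ ℚ-ring

    U-ratio≤ : ∀ D r m g M → 0ℚ ≤ D → 0ℚ ≤ r → m * r ≡ 1ℚ → 0ℚ ≤ g → g ≤ D → 0ℚ ≤ m → M ≤ D * m → r * (r * g * M) ≤ D * D * r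
    U-ratio≤ D r m g M D≥0 r≥0 mr g≥0 g≤ m≥0 h = certify (r≥0 ⊗ r≥0 ⊗ g≥0 ⊗ gap h ⊕ r≥0 ⊗ r≥0 ⊗ D≥0 ⊗ m≥0 ⊗ gap g≤ ⊕ zero⁺ ((- (r * D * D)) ⊠ mr)) (solve (D ∷ r ∷ m ∷ g ∷ M ∷ []) ℚ-ring)

    U-loss≤ : ∀ D r g X → 1ℚ ≤ D → 0ℚ ≤ r → 0ℚ ≤ g → g ≤ D → X ≤ D * D * ((1ℚ + 1ℚ) + D) → r * (r * g * X) ≤ ι 3 * ((D * D * r) * (D * D * r))
    U-loss≤ D r g X D≥1 r≥0 g≥0 g≤ h = certify (r≥0 ⊗ r≥0 ⊗ g≥0 ⊗ gap h ⊕ (r≥0 ⊗ r≥0 ⊗ (D≥0 ⊗ D≥0 ⊗ (# 2 ⊕ D≥0))) ⊗ gap g≤ ⊕ # 2 ⊗ (r≥0 ⊗ r≥0 ⊗ D≥0 ⊗ D≥0 ⊗ D≥0) ⊗ gap D≥1) (solve (D ∷ r ∷ g ∷ X ∷ []) ℚ-ring)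
      where
      D≥0 : 0ℚ ≤ D
      D≥0 = ≤-trans 0≤1 D≥1

    U-sub : ∀ r g M X → r * (r * g * (M - X)) ≡ r * (r * g * M) - r * (r * g * X)
    U-sub = solve-∀ ℚ-ring

  opaque
    unfolding _+_ _*_ _-_ -_ ι ⟦_⟧

    ν-zeroˡ : ∀ t → (1ℚ - 1ℚ) * t ≡ 0ℚ
    ν-zeroˡ = solve-∀ ℚ-ring

    ν-zeroʳ : ∀ t → t * (1ℚ - 1ℚ) ≡ 0ℚ
    ν-zeroʳ = solve-∀ ℚ-ring

    ν-one : (1ℚ - 0ℚ) * (1ℚ - 0ℚ) ≡ 1ℚ
    ν-one = refl

    ι-suc-1 : ∀ k → ι (suc k) - 1ℚ ≡ ι k
    ι-suc-1 k = trans (cong (_- 1ℚ) (trans (ι-+ 1 k) (cong (_+ ι k) ι1))) (lem (ι k))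
      where
      lem : ∀ z → 1ℚ + z - 1ℚ ≡ z
      lem = solve-∀ ℚ-ring

    T-regroup : ∀ l r g d P p → p * (l * (r * (g * d)) * P) ≡ l * ((r * g * P) * (d * p))
    T-regroup = solve-∀ ℚ-ring

    -- The coefficients add up to 2 + 2 + 2·4 + 8 + 2 + 4 + 4 = 30. The α and β terms carry only D³,
    -- which D ≥ 1 raises to D⁴.
    err-arith : ∀ D r m m′ P aᶜ → 1ℚ ≤ D → 0ℚ ≤ r → m * r ≡ 1ℚ → 0ℚ ≤ m′ → m′ ≤ m → 0ℚ ≤ P → 0ℚ ≤ aᶜ → aᶜ ≤ D * D → ∀ α₁ α₂ β s₁ s₂ s₃ s₄ →
      α₁ ≤ (ι 2 * r * D * P) * (D * D) → α₂ ≤ (ι 2 * r * D * P) * (D * D) → β ≤ (ι 4 * (r * r) * aᶜ * P) * (D * m′) →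
      s₁ ≤ (ι 8 * (r * r * r) * aᶜ * P) * ((D * m′) * (D * m′)) → s₂ ≤ (ι 2 * r * P) * ((D * D) * (D * D)) →
      s₃ ≤ (ι 4 * (r * r) * D * P) * ((D * m) * (D * D)) → s₄ ≤ (ι 4 * (r * r) * D * P) * ((D * m) * (D * D)) →
      r * (((α₁ + β) + (α₂ + β)) + ((s₁ + s₂) + (s₃ + s₄))) ≤ ι 30 * ((D * D * r) * (D * D * r)) * P
    err-arith D r m m′ P aᶜ D≥1 r≥0 mr m′≥0 m′≤ P≥0 a≥0 a≤ α₁ α₂ β s₁ s₂ s₃ s₄ h₁ h₂ hβ k₁ k₂ k₃ k₄ =
      certify (r≥0 ⊗ gap h₁ ⊕ r≥0 ⊗ gap h₂ ⊕ # 2 ⊗ r≥0 ⊗ gap β≤ ⊕ r≥0 ⊗ gap s₁≤ ⊕ r≥0 ⊗ gap k₂ ⊕ r≥0 ⊗ gap s₃≤ ⊕ r≥0 ⊗ gap s₄≤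
          ⊕ # 12 ⊗ (r≥0 ⊗ r≥0 ⊗ (D≥0 ⊗ D≥0 ⊗ D≥0) ⊗ P≥0) ⊗ gap D≥1)
        (solve (D ∷ r ∷ P ∷ α₁ ∷ α₂ ∷ β ∷ s₁ ∷ s₂ ∷ s₃ ∷ s₄ ∷ []) ℚ-ring)
      where
      D≥0 : 0ℚ ≤ D
      D≥0 = ≤-trans 0≤1 D≥1
      u≥0 : 0ℚ ≤ 1ℚ - m′ * r
      u≥0 = gap {m′ * r} {1ℚ} (subst (m′ * r ≤_) mr (*-monoʳ r≥0 m′≤))
      β≤ : β ≤ ι 4 * r * (D * D * D) * P
      β≤ = ≤-trans hβ (certify (# 4 ⊗ (r≥0 ⊗ D≥0 ⊗ P≥0 ⊗ a≥0) ⊗ u≥0 ⊕ # 4 ⊗ (r≥0 ⊗ D≥0 ⊗ P≥0) ⊗ gap a≤) (solve (D ∷ r ∷ m′ ∷ P ∷ aᶜ ∷ []) ℚ-ring))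
      s₁≤ : s₁ ≤ ι 8 * r * (D * D * D * D) * P
      s₁≤ = ≤-trans k₁ (certify (# 8 ⊗ (r≥0 ⊗ D≥0 ⊗ D≥0 ⊗ P≥0 ⊗ a≥0) ⊗ (u≥0 ⊗ (0≤1 ⊕ m′≥0 ⊗ r≥0)) ⊕ # 8 ⊗ (r≥0 ⊗ D≥0 ⊗ D≥0 ⊗ P≥0) ⊗ gap a≤) (solve (D ∷ r ∷ m′ ∷ P ∷ aᶜ ∷ []) ℚ-ring))
      s₃≤ : s₃ ≤ ι 4 * r * (D * D * D * D) * P
      s₃≤ = ≤-trans k₃ (≤-reflexive (equate ((ι 4 * r * (D * D * D * D) * P) ⊠ mr) (solve (D ∷ r ∷ m ∷ P ∷ []) ℚ-ring)))
      s₄≤ : s₄ ≤ ι 4 * r * (D * D * D * D) * P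
      s₄≤ = ≤-trans k₄ (≤-reflexive (equate ((ι 4 * r * (D * D * D * D) * P) ⊠ mr) (solve (D ∷ r ∷ m ∷ P ∷ []) ℚ-ring)))

  ∑-single≤ : ∀ {n} (f : Fin n → ℚ) → (∀ x → 0ℚ ≤ f x) → ∀ x → f x ≤ ∑ f
  ∑-single≤ f f≥0 x = ≤-resp (∑-δ f x) refl (∑-mono (λ y → ≤-resp refl (*-identityˡ (f y)) (*-monoʳ (f≥0 y) (⟦⟧≤1 _))))

  module ForwardCount (D r : ℚ) {n : ℕ} (I : Instance n) (D≥1 : 1ℚ ≤ D) (r≥0 : 0ℚ ≤ r) (mr≡1 : m I * r ≡ 1ℚ) (small : ι 1000 * (D * D * r) ≤ 1ℚ)
    (B : Bounds.Bounded D (m I) r D≥1 r≥0 mr≡1 small I 6) (u v : Fin n) (u≢v : u ≢ v) (Huv : H I u v ≡ false) where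

    open LowerEstimates D (m I) r D≥1 r≥0 mr≡1 small
    open FirstOrder I B using (hdeg; hdeg≤D; ∑∑b-row; ∑∑b-col)
    open FirstOrder.Pair I B u v u≢v Huv using (A; A≥0; P; P≥0)
    open SwitchIdentity I u v u≢v Huv using (ν; L)
    open BackwardCount D r I D≥1 r≥0 mr≡1 small B u v u≢v Huv using (dq; F; F≥0; M₂; M₂≥0; M₂≤; weightedF≤; ∑-unless; near; near-sum; far)

    C : Instance n
    C = contract I u v u≢v Huv

    BC : Bounded C 5
    BC = Bounded-contract B u≢v Huv

    NC≡P : N C ≡ P
    NC≡P = N-contract I u v u≢v Huv

    HCuv : H C u v ≡ true
    HCuv = trans (cong (H I u v ∨_) (isE-true⁺ (inj₁ (refl , refl)))) (∨-zeroʳ (H I u v))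

    Hvu : H I v u ≡ false
    Hvu = trans (H-sym I v u) Huv

    δδ : ∀ x → δ x u * δ x v ≡ 0ℚ
    δδ x = trans (δ-replace (λ z → δ z v) x u) (trans (cong (δ x u *_) (δ-≢ u≢v)) (*-zeroʳ _))

    ν-sum : ∀ (f : Fin n → ℚ) → ∑ (λ x → ν x * f x) ≡ ∑ f - (f u + f v)
    ν-sum f = trans (∑-cong (λ x → ν-linear (δ x u) (δ x v) (f x) (δδ x))) (trans (∑-- _ _) (cong (λ t → ∑ f - t) (trans (∑-+ _ _) (cong₂ _+_ (∑-δ f u) (∑-δ f v)))))

    ν-view : ∀ x → ((ν x ≡ 0ℚ) × (x ≡ u ⊎ x ≡ v)) ⊎ ((ν x ≡ 1ℚ) × (x ≢ u × x ≢ v))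
    ν-view x with x FP.≟ u
    ... | yes refl = inj₁ (trans (cong (λ t → (1ℚ - t) * (1ℚ - δ x v)) (δ-refl x)) (ν-zeroˡ _) , inj₁ refl)
    ... | no x≢u with x FP.≟ v
    ...   | yes refl = inj₁ (trans (cong (λ t → (1ℚ - δ x u) * (1ℚ - t)) (δ-refl x)) (ν-zeroʳ _) , inj₂ refl)
    ...   | no x≢v = inj₂ (trans (cong₂ (λ s t → (1ℚ - s) * (1ℚ - t)) (δ-≢ x≢u) (δ-≢ x≢v)) ν-one , x≢u , x≢v)

    ν≥0 : ∀ x → 0ℚ ≤ ν x
    ν≥0 x with ν-view x
    ... | inj₁ (e , _) = ≤-reflexive (sym e)
    ... | inj₂ (e , _) = subst (0ℚ ≤_) (sym e) 0≤1

    away-uv : ∀ {s x} → x ≢ u → x ≢ v → isE u v s x ≡ false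
    away-uv x≢u x≢v = isE-false⁺ λ { (inj₁ (_ , e)) → x≢v e ; (inj₂ (_ , e)) → x≢u e }

    b≡bC : ∀ G {s x} → x ≢ u → x ≢ v → b I G s x ≡ b C G s x
    b≡bC G x≢u x≢v = b-contract-away I u v u≢v {Huv} (away-uv x≢u x≢v) G

    -- If d x = 0 then the row of x is empty and the indicator vanishes, so truncation at 0 never
    -- shows.
    b-pred : ∀ G → w I G ≡ true → ∀ s x → b I G s x * (dq x - 1ℚ) ≡ b I G s x * ι (d I x ∸ 1)
    b-pred G wG s x = go (d I x) refl
      where
      go : ∀ k → d I x ≡ k → b I G s x * (ι k - 1ℚ) ≡ b I G s x * ι (k ∸ 1)
      go (suc k) e = cong (b I G s x *_) (ι-suc-1 k)
      go zero e = trans (cong (_* (ι 0 - 1ℚ)) bsx≡0) (trans (*-zeroˡ _) (sym (trans (cong (_* ι 0) bsx≡0) (*-zeroˡ _))))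
        where
        bsx≡0 : b I G s x ≡ 0ℚ
        bsx≡0 = ≤-antisym (≤-resp (b-sym I G wG x s) (trans (row-sum I G wG x) (trans (cong ι e) ι0)) (∑-single≤ (b I G x) (b≥0 I G x) s)) (b≥0 I G s x)

    nbr : Fin n → ℚ
    nbr s = ∑ λ x → h I s x * dq x

    -- Edges sx continued by one of the d x - 1 other edges at x. This has the size of a main term,
    -- whereas α, β and `S₃` need one more coincidence and are negligible.
    U : Fin n → Adj n → ℚ
    U s G = ∑ λ x → ν x * (b I G s x * (dq x - 1ℚ))

    α β : Fin n → Fin n → Adj n → ℚ
    α s t G = ∑ λ x → h I s x * b I G t x
    β s t G = ∑ λ x → b I G s x * b I G t x

    S₃ : Adj n → ℚ
    S₃ G = ∑∑ λ x y → ν x * ν y * b I G x y * (c I G u x * c I G v y)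

    Ends : Fin n → Fin n → Set
    Ends s t = (s ≡ u × t ≡ v) ⊎ (s ≡ v × t ≡ u)

    module _ {s t : Fin n} (st : Ends s t) where

      h-end : ∀ {x} → x ≡ u ⊎ x ≡ v → h I s x ≡ 0ℚ
      h-end {x} e = trans (cong ⟦_⟧ (go st e)) ⟦false⟧
        where
        go : Ends s t → x ≡ u ⊎ x ≡ v → H I s x ≡ false
        go (inj₁ (refl , _)) (inj₁ refl) = H-irr I u
        go (inj₁ (refl , _)) (inj₂ refl) = Huv
        go (inj₂ (refl , _)) (inj₁ refl) = Hvu
        go (inj₂ (refl , _)) (inj₂ refl) = H-irr I v

      νh : ∀ x → ν x * h I s x ≡ h I s x
      νh x with ν-view x
      ... | inj₁ (_ , e) = trans (cong (ν x *_) (h-end e)) (trans (*-zeroʳ _) (sym (h-end e)))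
      ... | inj₂ (e , _) = trans (cong (_* h I s x) e) (*-identityˡ _)

      module _ (G : Adj n) (wG : w I G ≡ true) where

        bb-end : ∀ {x} → x ≡ u ⊎ x ≡ v → b I G s x * b I G t x ≡ 0ℚ
        bb-end {x} = go st
          where
          left : x ≡ s → b I G s x * b I G t x ≡ 0ℚ
          left refl = trans (cong (_* b I G t x) (b-irr I G wG x)) (*-zeroˡ _)
          right : x ≡ t → b I G s x * b I G t x ≡ 0ℚ
          right refl = trans (cong (b I G s x *_) (b-irr I G wG x)) (*-zeroʳ _)
          go : Ends s t → x ≡ u ⊎ x ≡ v → b I G s x * b I G t x ≡ 0ℚ
          go (inj₁ (e , _)) (inj₁ f) = left (trans f (sym e))
          go (inj₁ (_ , e)) (inj₂ f) = right (trans f (sym e))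
          go (inj₂ (_ , e)) (inj₁ f) = right (trans f (sym e))
          go (inj₂ (e , _)) (inj₂ f) = left (trans f (sym e))

        νbb : ∀ x → ν x * (b I G s x * b I G t x) ≡ b I G s x * b I G t x
        νbb x with ν-view x
        ... | inj₁ (_ , e) = trans (cong (ν x *_) (bb-end e)) (trans (*-zeroʳ _) (sym (bb-end e)))
        ... | inj₂ (e , _) = trans (cong₂ _*_ e refl) (*-identityˡ _)

        -- For fixed x, the vertex y runs over the neighbours of x other than u and v, and there are
        -- `dq x - (b I G s x + b I G t x)` of these. The indicator for sx is 0 if sx is in H and 1
        -- if sx is a free edge, which separates the two causes of blocking.
        side : ∑ (λ x → ν x * c I G s x * (dq x - (b I G s x + b I G t x))) ≡ (nbr s - α s t G) + (U s G - β s t G)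
        side = trans (∑-cong (λ x → side-term (ν x) (b I G s x) (h I s x) (dq x) (b I G t x) (νh x) (trans (*-comm _ _) (bh≡0 I G s x)) (⟦⟧-idem _) (νbb x)))
          (trans (∑-+ _ _) (cong₂ _+_ (∑-- _ _) (∑-- _ _)))

    S₀ : ℚ
    S₀ = m I - ι 2 * (dq u + dq v) + ι 2

    -- S₀ counts the choices of xy disjoint from uv; U, nbr correct for ux or vy being an
    -- edge of G or of H, and the last group is negligible.
    L-expansion : ∀ G → w I G ≡ true → b I G u v ≡ 1ℚ →
      L G ≡ (S₀ - nbr u - nbr v) - (U u G + U v G) + (((α u v G + β u v G) + (α v u G + β v u G)) + S₃ G)
    L-expansion G wG uv = begin
      L G
        ≡⟨ ∑∑-cong (λ x y → 1-c-split (ν x) (ν y) (b I G x y) (c I G u x) (c I G v y)) ⟩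
      ∑∑ (λ x y → ν x * (ν y * b I G x y) - (ν x * c I G u x) * (ν y * b I G x y) - (ν y * c I G v y) * (ν x * b I G x y) + ν x * ν y * b I G x y * (c I G u x * c I G v y))
        ≡⟨ trans (∑∑-+ _ _) (cong (_+ S₃ G) (trans (∑∑-- _ _) (cong₂ _-_ (trans (∑∑-- _ _) (cong₂ _-_ main sideᵘ)) sideᵛ))) ⟩
      S₀ - ((nbr u - α u v G) + (U u G - β u v G)) - ((nbr v - α v u G) + (U v G - β v u G)) + S₃ G
        ≡⟨ L-collect S₀ (nbr u) (α u v G) (U u G) (β u v G) (nbr v) (α v u G) (U v G) (β v u G) (S₃ G) ⟩
      (S₀ - nbr u - nbr v) - (U u G + U v G) + (((α u v G + β u v G) + (α v u G + β v u G)) + S₃ G) ∎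
      where
      open ≡-Reasoning
      inner : ∀ x → ∑ (λ y → ν y * b I G x y) ≡ dq x - (b I G x u + b I G x v)
      inner x = trans (ν-sum (b I G x)) (cong₂ _-_ (row-sum I G wG x) refl)
      main : ∑∑ (λ x y → ν x * (ν y * b I G x y)) ≡ S₀
      main = trans (∑-cong (λ x → trans (∑-*ˡ (ν x) _) (cong (ν x *_) (inner x)))) (trans (ν-sum _)
        (trans (cong₂ _-_ (trans (∑-- _ _) (cong (λ t → m I - t) (trans (∑-+ _ _) (cong₂ _+_ (col-sum I G wG u) (col-sum I G wG v))))) refl)
          (S₀-arith (m I) (dq u) (dq v) (b I G u u) (b I G u v) (b I G v u) (b I G v v) (b-irr I G wG u) (b-irr I G wG v) uv (trans (b-sym I G wG v u) uv))))
      sideᵘ : ∑∑ (λ x y → (ν x * c I G u x) * (ν y * b I G x y)) ≡ (nbr u - α u v G) + (U u G - β u v G)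
      sideᵘ = trans (∑-cong (λ x → trans (∑-*ˡ (ν x * c I G u x) _) (cong (ν x * c I G u x *_) (trans (inner x) (cong₂ (λ s t → dq x - (s + t)) (b-sym I G wG x u) (b-sym I G wG x v))))))
        (side (inj₁ (refl , refl)) G wG)
      sideᵛ : ∑∑ (λ x y → (ν y * c I G v y) * (ν x * b I G x y)) ≡ (nbr v - α v u G) + (U v G - β v u G)
      sideᵛ = trans (∑∑-swap _) (trans (∑-cong (λ y → trans (∑-*ˡ (ν y * c I G v y) _) (cong (ν y * c I G v y *_)
          (trans (ν-sum (λ x → b I G x y)) (cong₂ _-_ (col-sum I G wG y) (+-comm _ _))))))
        (side (inj₂ (refl , refl)) G wG))

    wI : ∀ {G} → w C G ≡ true → w I G ≡ true
    wI {G} e = proj₁ (∧-true⁻ {w I G} e)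

    uv-in : ∀ {G} → w C G ≡ true → b I G u v ≡ 1ℚ
    uv-in {G} e = trans (b≡a I G Huv) (trans (cong ⟦_⟧ (proj₂ (∧-true⁻ {w I G} e))) ⟦true⟧)

    Err : Adj n → ℚ
    Err G = ((α u v G + β u v G) + (α v u G + β v u G)) + S₃ G

    𝔼L : 𝔼 I (λ G → b I G u v * L G) ≡ (S₀ - nbr u - nbr v) * P - (𝔼 C (U u) + 𝔼 C (U v)) + 𝔼 C Err
    𝔼L = trans (sym (𝔼-contract I u v u≢v Huv L)) (trans (𝔼-cong C (λ G wG → L-expansion G (wI wG) (uv-in wG)))
      (trans (𝔼-+ C _ Err) (cong (_+ 𝔼 C Err) (trans (𝔼-- C _ _) (cong₂ _-_ (trans (𝔼-const C _) (cong₂ _*_ refl NC≡P)) (𝔼-+ C (U u) (U v)))))))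

    Err≥0 : 0ℚ ≤ 𝔼 C Err
    Err≥0 = 𝔼-nonneg C (λ G wG → (α≥0 u v G ⊕ β≥0 u v G) ⊕ (α≥0 v u G ⊕ β≥0 v u G) ⊕ ∑∑-nonneg (λ x y → ν≥0 x ⊗ ν≥0 y ⊗ b≥0 I G x y ⊗ (c≥0 I G u x ⊗ c≥0 I G v y)))
      where
      α≥0 : ∀ s t G → 0ℚ ≤ α s t G
      α≥0 s t G = ∑-nonneg (λ x → h≥0 I s x ⊗ b≥0 I G t x)
      β≥0 : ∀ s t G → 0ℚ ≤ β s t G
      β≥0 s t G = ∑-nonneg (λ x → b≥0 I G s x ⊗ b≥0 I G t x)

    module _ {s t : Fin n} (st : Ends s t) where

      private
        g : ℚ
        g = ι (d I s ∸ 1)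

        lower-s : lower (d I) u v s ≡ d I s ∸ 1
        lower-s = go st
          where
          go : Ends s t → lower (d I) u v s ≡ d I s ∸ 1
          go (inj₁ (refl , _)) = lower-first (d I) u v
          go (inj₂ (refl , _)) = lower-at (d I) u v

        T : Fin n → ℚ
        T x = 𝔼 C (λ G → ν x * (b I G s x * (dq x - 1ℚ)))

        T-far : ∀ x → ν x ≡ 1ℚ → x ≢ u → x ≢ v → T x ≡ ι (d I x ∸ 1) * 𝔼 C (λ G → b C G s x)
        T-far x e x≢u x≢v = trans (𝔼-cong C (λ G wG → trans (cong₂ _*_ e refl) (trans (*-identityˡ _) (trans (b-pred G (wI wG) s x) (cong (_* ι (d I x ∸ 1)) (b≡bC G x≢u x≢v))))))
          (𝔼-*ʳ C (ι (d I x ∸ 1)) _)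

        bound-eq : ∀ l x → x ≢ u → x ≢ v → ι (d I x ∸ 1) * (l * (r * (deg⁻ C s * deg⁻ C x)) * N C) ≡ l * ((r * g * P) * F x)
        bound-eq l x x≢u x≢v rewrite lower-s | lower-away (d I) x≢u x≢v | NC≡P = T-regroup l r g (dq x) P (ι (d I x ∸ 1))

        T≥0 : ∀ x → 0ℚ ≤ T x
        T≥0 x = 𝔼-nonneg C (λ G wG → ν≥0 x ⊗ subst (0ℚ ≤_) (sym (b-pred G (wI wG) s x)) (b≥0 I G s x ⊗ # _))

        gP≥0 : 0ℚ ≤ r * g * P
        gP≥0 = r≥0 ⊗ # _ ⊗ P≥0

        T-up : ∀ x → T x ≤ λ⁺ * ((r * g * P) * F x)
        T-up x with ν-view x
        ... | inj₁ (e , _) = vanish C (λ⁺≥0 ⊗ (gP≥0 ⊗ F≥0 x)) (λ G _ → trans (cong₂ _*_ e refl) (*-zeroˡ _))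
        ... | inj₂ (e , x≢u , x≢v) = ≤-resp (sym (T-far x e x≢u x≢v)) (bound-eq λ⁺ x x≢u x≢v) (*-monoˡ (# _) (FirstOrder.edge-up C BC s x))

        T-lo : ∀ x → λ⁻ * (r * g * P) * F x * (1ℚ - ⟦ near s x ⟧) ≤ T x
        T-lo x = unless (near s x) good (T≥0 x)
          where
          good : near s x ≡ false → λ⁻ * (r * g * P) * F x ≤ T x
          good e with ν-view x
          ... | inj₁ (_ , inj₁ k) = ⊥-elim (proj₁ (far e) k)
          ... | inj₁ (_ , inj₂ k) = ⊥-elim (proj₁ (proj₂ (far e)) k)
          ... | inj₂ (k , x≢u , x≢v) = ≤-resp (trans (bound-eq λ⁻ x x≢u x≢v) (scale-out λ⁻ _ _)) (sym (T-far x k x≢u x≢v)) (*-monoˡ (# _) (edge-lo C {2} BC s x s≢x HCsx))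
            where
            s≢x : s ≢ x
            s≢x refl = go st
              where
              go : Ends s t → ⊥
              go (inj₁ (a , _)) = x≢u a
              go (inj₂ (a , _)) = x≢v a
            HCsx : H C s x ≡ false
            HCsx rewrite proj₂ (proj₂ (far e)) = away-uv x≢u x≢v

        g≤D : g ≤ D
        g≤D = ≤-trans (ι-mono (ℕP.m∸n≤m (d I s) 1)) (Bounds.Bounded.deg≤ B s)

      -- One half of the term (d̃ᵤ + d̃ᵥ - 2)M̃₂/M̃ of φ̄, scaled by r: once uv is contracted, the
      -- end s has d s - 1 free edges left.
      Y : ℚ
      Y = r * (r * g * M₂)

      Y≥0 : 0ℚ ≤ Y
      Y≥0 = r≥0 ⊗ (r≥0 ⊗ # _ ⊗ M₂≥0)

      Y≤ε : Y ≤ ε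
      Y≤ε = U-ratio≤ D r (m I) g M₂ D≥0 r≥0 mr≡1 (# _) g≤D (m≥0 I) M₂≤

      U-up : r * 𝔼 C (U s) ≤ P * Y + ι 40 * (ε * ε) * P
      U-up = rel-up (ι 40) ε P Y _ (# 40) ε≥0 P≥0 Y≤ε (≤-resp refl (U-scale r λ⁺ g P M₂)
        (*-monoˡ r≥0 (≤-resp (sym (𝔼-sum C _ (allFin n))) (trans (∑-*ˡ λ⁺ _) (cong (λ⁺ *_) (∑-*ˡ (r * g * P) F))) (∑-mono T-up))))

      U-lo : P * Y ≤ r * 𝔼 C (U s) + (ι 40 + ι 3) * (ε * ε) * P
      U-lo = rel-lo (ι 40) (ι 3) ε P Y (r * (r * g * X)) _ (# 40) ε≥0 P≥0 Y≤ε (r≥0 ⊗ (r≥0 ⊗ # _ ⊗ ∑-nonneg (λ x → ⟦⟧≥0 (near s x) ⊗ F≥0 x)))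
          (U-loss≤ D r g X D≥1 r≥0 (# _) g≤D (weightedF≤ _ _ (λ x → ⟦⟧≥0 (near s x)) (≤-trans (near-sum s) (+-mono-≤ ≤-refl (hdeg≤D s)))))
          (≤-resp (trans (U-scale r λ⁻ g P (M₂ - X)) (cong (λ z → λ⁻ * (P * z)) (U-sub r g M₂ X))) refl
            (*-monoˡ r≥0 (≤-resp (trans (∑-unless (λ⁻ * (r * g * P)) (λ x → ⟦ near s x ⟧)) (sym (scale-out λ⁻ (r * g * P) (M₂ - X)))) (sym (𝔼-sum C _ (allFin n))) (∑-mono T-lo))))
        where
        X : ℚ
        X = ∑ (λ x → ⟦ near s x ⟧ * F x)

    dC≤ : ∀ x → deg⁻ C x ≤ dq x
    dC≤ x = ι-mono (lower-≤ (d I) u v x)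

    mC≤ : m C ≤ m I
    mC≤ = ∑-mono dC≤

    single≤ : ∀ s x → 𝔼 C (λ G → b C G s x) ≤ ι 2 * (r * (dq s * dq x)) * P
    single≤ s x = ≤-trans (FirstOrder.edge-up C BC s x) (≤-resp refl (cong₂ _*_ refl NC≡P)
      (*-monoʳ (N≥0 C) (up≤ (deg²≥0 C s x) (*-mono (deg⁻≥0 C s) (deg⁻≥0 I x) (dC≤ s) (dC≤ x)))))

    -- `y ≢ p` makes xy a pair different from px, so its indicator is unchanged when px is
    -- contracted.
    hinge≤ : ∀ {p y} x → y ≢ p → 𝔼 C (λ G → b C G p x * b C G x y) ≤ (ι 2 * (r * (dq x * dq y))) * ((ι 2 * (r * (dq p * dq x))) * P)
    hinge≤ {p} {y} x y≢p = ≤-trans (chain-up C BC p x (λ G → b C G x y) (ι 2 * (r * (dq x * dq y))) (# 2 ⊗ (r≥0 ⊗ (deg⁻≥0 I x ⊗ deg⁻≥0 I y))) step)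
      (*-monoˡ (# 2 ⊗ (r≥0 ⊗ (deg⁻≥0 I x ⊗ deg⁻≥0 I y))) (≤-resp refl (cong₂ _*_ refl NC≡P)
        (*-monoʳ (N≥0 C) (up≤ (deg²≥0 C p x) (*-mono (deg⁻≥0 C p) (deg⁻≥0 I x) (dC≤ p) (dC≤ x))))))
      where
      sep′ : isE p x x y ≡ false
      sep′ = isE-false⁺ λ { (inj₁ (e , k)) → y≢p (trans k e) ; (inj₂ (_ , k)) → y≢p k }
      step : ∀ p≢x Hpx → 𝔼 (contract C p x p≢x Hpx) (λ G → b C G x y) ≤ ι 2 * (r * (dq x * dq y)) * N (contract C p x p≢x Hpx)
      step p≢x Hpx = ≤-trans (≤-reflexive (𝔼-cong K (λ G _ → b-contract-away C p x p≢x {Hpx} sep′ G)))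
        (≤-trans (FirstOrder.edge-up K (Bounded-contract BC p≢x Hpx) x y)
          (*-monoʳ (N≥0 K) (up≤ (deg²≥0 K x y) (*-mono (# _) (deg⁻≥0 I y) (≤-trans (ι-mono (lower-≤ (d C) p x x)) (dC≤ x)) (≤-trans (ι-mono (lower-≤ (d C) p x y)) (dC≤ y))))))
        where
        K : Instance n
        K = contract C p x p≢x Hpx

    α≤ : ∀ {s t} → Ends s t → 𝔼 C (α s t) ≤ (ι 2 * r * D * P) * (D * D)
    α≤ {s} {t} st = ≤-trans (𝔼-mono C (λ G wG → ∑-mono (pointwise G))) (≤-trans (≤-reflexive (𝔼-sum C _ (allFin n)))
      (≤-trans (∑-mono (λ x → ≤-trans (≤-reflexive (𝔼-*ˡ C (h I s x) _)) (≤-resp refl (single-regroup r P D (dq x) (h I s x)) (*-monoˡ (h≥0 I s x)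
          (≤-trans (single≤ t x) (*-monoʳ P≥0 (*-monoˡ (# 2) (*-monoˡ r≥0 (*-monoʳ (deg⁻≥0 I x) (Bounds.Bounded.deg≤ B t))))))))))
        (≤-resp (sym (∑-*ˡ _ _)) refl (*-monoˡ (# 2 ⊗ r≥0 ⊗ D≥0 ⊗ P≥0) (∑h≤ I B s)))))
      where
      pointwise : ∀ G x → h I s x * b I G t x ≤ h I s x * b C G t x
      pointwise G x with ν-view x
      ... | inj₁ (_ , e) = ≤-reflexive (trans (cong (_* b I G t x) (h-end st e)) (trans (*-zeroˡ _) (sym (trans (cong (_* b C G t x) (h-end st e)) (*-zeroˡ _)))))
      ... | inj₂ (_ , x≢u , x≢v) = ≤-reflexive (cong (h I s x *_) (b≡bC G x≢u x≢v))

    β≤ : 𝔼 C (β u v) ≤ (ι 4 * (r * r) * deg² C u v * P) * (D * m C)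
    β≤ = ≤-trans (𝔼-mono C (λ G wG → ∑-mono (pointwise G wG))) (≤-trans (≤-reflexive (𝔼-sum C _ (allFin n)))
      (≤-trans (∑-mono (λ x → path≤ C BC u v u≢v HCuv x x)) (≤-resp (sym (∑-*ˡ _ _)) (cong (λ z → (ι 4 * (r * r) * deg² C u v * z) * (D * m C)) NC≡P)
        (*-monoˡ (# 4 ⊗ (r≥0 ⊗ r≥0) ⊗ deg²≥0 C u v ⊗ N≥0 C) (∑-squares≤ C BC)))))
      where
      pointwise : ∀ G → w C G ≡ true → ∀ x → b I G u x * b I G v x ≤ b C G u x * b C G v x
      pointwise G wG x with ν-view x
      ... | inj₁ (_ , e) = ≤-resp (sym (bb-end (inj₁ (refl , refl)) G (wI wG) e)) refl (b≥0 C G u x ⊗ b≥0 C G v x)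
      ... | inj₂ (_ , x≢u , x≢v) = ≤-reflexive (cong₂ _*_ (b≡bC G x≢u x≢v) (b≡bC G x≢u x≢v))

    hinges : Fin n → Fin n → ℚ
    hinges s t = ∑∑ λ x y → h I t y * 𝔼 C (λ G → b C G s x * b C G x y)

    hinges≤ : ∀ {s t} → Ends t s → hinges s t ≤ (ι 4 * (r * r) * D * P) * ((D * m I) * (D * D))
    hinges≤ {s} {t} ts = ≤-trans (∑∑-mono (λ x y → each x y (H I t y) refl))
      (≤-resp (sym (trans (∑∑-*ˡ _ _) (cong ((ι 4 * (r * r) * D * P) *_) (∑∑-× _ _)))) refl
        (*-monoˡ (# 4 ⊗ (r≥0 ⊗ r≥0) ⊗ D≥0 ⊗ P≥0) (*-mono (∑-nonneg (λ x → deg⁻≥0 I x ⊗ deg⁻≥0 I x)) (D≥0 ⊗ D≥0) (∑-squares≤ I B) (∑h≤ I B t))))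
      where
      s-end : s ≡ u ⊎ s ≡ v
      s-end = go ts
        where
        go : Ends t s → s ≡ u ⊎ s ≡ v
        go (inj₁ (_ , e)) = inj₂ e
        go (inj₂ (_ , e)) = inj₁ e
      each : ∀ x y z → H I t y ≡ z → ⟦ z ⟧ * 𝔼 C (λ G → b C G s x * b C G x y) ≤ (ι 4 * (r * r) * D * P) * ((dq x * dq x) * (⟦ z ⟧ * dq y))
      each x y false e rewrite ⟦false⟧ = ≤-resp (sym (*-zeroˡ _)) refl (# 4 ⊗ (r≥0 ⊗ r≥0) ⊗ D≥0 ⊗ P≥0 ⊗ (deg⁻≥0 I x ⊗ deg⁻≥0 I x ⊗ (≤-refl ⊗ deg⁻≥0 I y)))
      each x y true e = ≤-resp refl (hinge-regroup r P D (dq x) (dq y) ⟦ true ⟧) (*-monoˡ (⟦⟧≥0 true) (≤-trans (hinge≤ x y≢s)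
          (*-monoˡ (# 2 ⊗ (r≥0 ⊗ (deg⁻≥0 I x ⊗ deg⁻≥0 I y))) (*-monoʳ P≥0 (*-monoˡ (# 2) (*-monoˡ r≥0 (*-monoʳ (deg⁻≥0 I x) (Bounds.Bounded.deg≤ B s))))))))
        where
        y≢s : y ≢ s
        y≢s refl = 1≢0 (trans (sym (trans (cong ⟦_⟧ e) ⟦true⟧)) (h-end ts s-end))
          where
          1≢0 : 1ℚ ≢ 0ℚ
          1≢0 ()

    tris pairs₂ : ℚ
    tris = ∑∑ λ x y → 𝔼 C (λ G → b C G u x * (b C G v y * b C G x y))
    pairs₂ = ∑∑ λ x y → (h I u x * h I v y) * 𝔼 C (λ G → b C G x y)

    tris≤ : tris ≤ (ι 8 * (r * r * r) * deg² C u v * P) * ((D * m C) * (D * m C))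
    tris≤ = ≤-trans (∑∑-mono (λ x y → tri≤ C BC u v u≢v HCuv x y))
      (≤-resp (sym (trans (∑∑-*ˡ _ _) (cong ((ι 8 * (r * r * r) * deg² C u v * N C) *_) (∑∑-× _ _)))) (cong (λ z → (ι 8 * (r * r * r) * deg² C u v * z) * ((D * m C) * (D * m C))) NC≡P)
        (*-monoˡ (# 8 ⊗ (r≥0 ⊗ r≥0 ⊗ r≥0) ⊗ deg²≥0 C u v ⊗ N≥0 C) (*-mono (∑-nonneg (λ x → deg⁻≥0 C x ⊗ deg⁻≥0 C x)) (D≥0 ⊗ m≥0 C) (∑-squares≤ C BC) (∑-squares≤ C BC))))

    pairs₂≤ : pairs₂ ≤ (ι 2 * r * P) * ((D * D) * (D * D))
    pairs₂≤ = ≤-trans (∑∑-mono (λ x y → ≤-resp refl (double-regroup r P (dq x) (dq y) (h I u x) (h I v y)) (*-monoˡ (h≥0 I u x ⊗ h≥0 I v y) (single≤ x y))))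
      (≤-resp (sym (trans (∑∑-*ˡ _ _) (cong ((ι 2 * r * P) *_) (∑∑-× _ _)))) refl
        (*-monoˡ (# 2 ⊗ r≥0 ⊗ P≥0) (*-mono (∑-nonneg (λ x → h≥0 I u x ⊗ deg⁻≥0 I x)) (D≥0 ⊗ D≥0) (∑h≤ I B u) (∑h≤ I B v))))

    -- Each of ux and vy is occupied either by an edge or by H: two edges give `tris`, two pairs of
    -- H give `pairs₂`, and the mixed cases give the two `hinges`.
    S₃≤ : 𝔼 C S₃ ≤ (tris + pairs₂) + (hinges u v + hinges v u)
    S₃≤ = ≤-trans (𝔼-mono C (λ G wG → ∑∑-mono (pointwise G wG)))
      (≤-reflexive (trans (𝔼-cong C (λ G wG → ∑∑-cong (λ x y → expand-s₃ (b C G x y) (b C G u x) (h I u x) (b C G v y) (h I v y))))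
        (trans (𝔼-∑∑ C _) (trans (∑∑-cong (λ x y → trans (𝔼-+ C _ _) (cong₂ _+_ (𝔼-+ C _ _) (𝔼-+ C _ _))))
          (trans (∑∑-+ _ _) (cong₂ _+_ (trans (∑∑-+ _ _) (cong₂ _+_ refl (∑∑-cong (λ x y → 𝔼-*ˡ C (h I u x * h I v y) _))))
            (trans (∑∑-+ _ _) (cong₂ _+_ (∑∑-cong (λ x y → 𝔼-*ˡ C (h I v y) _))
              (trans (∑∑-swap _) (∑∑-cong (λ y x → trans (𝔼-*ˡ C (h I u x) _) (cong (h I u x *_) (𝔼-cong C (λ G wG → cong (b C G v y *_) (b-sym C G wG x y)))))))))))))))
      where
      RHS : Adj n → Fin n → Fin n → ℚ
      RHS G x y = b C G x y * ((b C G u x + h I u x) * (b C G v y + h I v y))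
      RHS≥0 : ∀ G x y → 0ℚ ≤ RHS G x y
      RHS≥0 G x y = b≥0 C G x y ⊗ ((b≥0 C G u x ⊕ h≥0 I u x) ⊗ (b≥0 C G v y ⊕ h≥0 I v y))
      pointwise : ∀ G → w C G ≡ true → ∀ x y → ν x * ν y * b I G x y * (c I G u x * c I G v y) ≤ RHS G x y
      pointwise G wG x y with ν-view x | ν-view y
      ... | inj₁ (e , _) | _ = ≤-resp (sym (trans (cong (λ z → z * ν y * b I G x y * (c I G u x * c I G v y)) e) (zero₁ _ _ _))) refl (RHS≥0 G x y)
        where
        zero₁ : ∀ s t z → 0ℚ * s * t * z ≡ 0ℚ
        zero₁ s t z = trans (cong (λ k → k * t * z) (*-zeroˡ s)) (trans (cong (_* z) (*-zeroˡ t)) (*-zeroˡ z))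
      ... | inj₂ _ | inj₁ (e , _) = ≤-resp (sym (trans (cong (λ z → ν x * z * b I G x y * (c I G u x * c I G v y)) e) (zero₂ _ _ _))) refl (RHS≥0 G x y)
        where
        zero₂ : ∀ s t z → s * 0ℚ * t * z ≡ 0ℚ
        zero₂ s t z = trans (cong (λ k → k * t * z) (*-zeroʳ s)) (trans (cong (_* z) (*-zeroˡ t)) (*-zeroˡ z))
      ... | inj₂ (ex , x≢u , x≢v) | inj₂ (ey , y≢u , y≢v) = ≤-reflexive (trans
          (cong₂ (λ s t → s * t * b I G x y * (c I G u x * c I G v y)) ex ey)
          (trans (cong (λ k → k * b I G x y * (c I G u x * c I G v y)) (*-identityˡ 1ℚ)) (trans (cong (_* (c I G u x * c I G v y)) (*-identityˡ _))
            (cong₂ _*_ (b≡bC G y≢u y≢v) (cong₂ _*_ (cong (_+ h I u x) (b≡bC G x≢u x≢v)) (cong (_+ h I v y) (b≡bC G y≢u y≢v)))))))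

    Err≤ : r * 𝔼 C Err ≤ ι 30 * (ε * ε) * P
    Err≤ = ≤-trans (*-monoˡ r≥0 (≤-trans (≤-reflexive (trans (𝔼-+ C _ _) (cong (_+ 𝔼 C S₃) (trans (𝔼-+ C _ _) (cong₂ _+_ (𝔼-+ C _ _) (trans (𝔼-+ C _ _)
        (cong (𝔼 C (α v u) +_) (𝔼-cong C (λ G _ → ∑-cong (λ x → *-comm _ _))))))))))
        (+-mono-≤ ≤-refl S₃≤)))
      (err-arith D r (m I) (m C) P (deg² C u v) D≥1 r≥0 mr≡1 (m≥0 C) mC≤ P≥0 (deg²≥0 C u v) (deg²≤ C BC u v) _ _ _ _ _ _ _
        (α≤ (inj₁ (refl , refl))) (α≤ (inj₂ (refl , refl))) β≤ tris≤ pairs₂≤ (hinges≤ (inj₂ (refl , refl))) (hinges≤ (inj₁ (refl , refl))))  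

-- Balancing the two counts and solving for the probability.

module Balance where
  open Arithmetic
  open Switching
  open Expectations
  open UpperBounds
  open EdgeChains
  open LowerBounds
  open BackwardSwitchings
  open ForwardSwitchings

  open Expectation

  opaque
    unfolding _+_ _*_ _-_ -_ ι ⟦_⟧

    -- Cancelling a factor known to be at least 1/2 takes the place of dividing by V.
    cancel-half : ∀ V T → ι 1 ≤ ι 2 * V → 0ℚ ≤ V * T → 0ℚ ≤ T
    cancel-half V T hV hT = [ id , nonpositive ]′ (ℚP.≤-total 0ℚ T)
      where
      nonpositive : T ≤ 0ℚ → 0ℚ ≤ T
      nonpositive k = certify (gap k ⊗ gap hV ⊕ # 2 ⊗ hT) (solve (V ∷ T ∷ []) ℚ-ring)

    -- As Q = N - P, the term A Q contributes - A P, which moves to the left side as r A: this is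
    -- the d̃ᵤd̃ᵥ of φ̄. The leftover product of P with the corrections is of second order, since P
    -- is O(e) N. The constant 800 absorbs all such errors.
    balance-up : ∀ r e A N P Q K Uᵤ Uᵥ Er Yᵤ Yᵥ w p t y₂ ω y₃ → 0ℚ ≤ r → 0ℚ ≤ e → 0ℚ ≤ A → 0ℚ ≤ N → 0ℚ ≤ P → 0ℚ ≤ Er → Q ≡ N - P →
      K * P - (Uᵤ + Uᵥ) + Er ≡ A * Q - w - p - t →
      r * Uᵤ ≤ P * Yᵤ + ι 40 * (e * e) * P → r * Uᵥ ≤ P * Yᵥ + ι 40 * (e * e) * P →
      A * Q * y₂ ≤ w + (ι 120 + ι 4) * (e * e) * (A * Q) → A * Q * ω ≤ p + (ι 120 + ι 0) * (e * e) * (A * Q) → A * Q * y₃ ≤ t + (ι 280 + ι 8) * (e * e) * (A * Q) →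
      P ≤ ι 2 * (r * A) * N → r * A ≤ e → y₂ + ω + y₃ ≤ ι 3 * e →
      P * (r * K - (Yᵤ + Yᵥ) + r * A) ≤ r * A * N * (1ℚ - (y₂ + ω + y₃)) + ι 800 * (e * e) * (r * A * N)
    balance-up r e A N P _ K Uᵤ Uᵥ Er Yᵤ Yᵥ w p t y₂ ω y₃ r≥0 e≥0 A≥0 N≥0 P≥0 Er≥0 refl eq hu hv hw hp ht hP hz hS =
      certify (gap hu ⊕ gap hv ⊕ r≥0 ⊗ Er≥0 ⊕ r≥0 ⊗ gap hw ⊕ r≥0 ⊗ gap hp ⊕ r≥0 ⊗ gap ht ⊕ zero⁺ ((- r) ⊠ eq)
          ⊕ # 83 ⊗ (e≥0 ⊗ e≥0) ⊗ gap hP ⊕ r≥0 ⊗ A≥0 ⊗ P≥0 ⊗ gap hS ⊕ # 3 ⊗ e≥0 ⊗ P≥0 ⊗ gap hz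
          ⊕ # 102 ⊗ (e≥0 ⊗ e≥0) ⊗ (r≥0 ⊗ A≥0 ⊗ N≥0) ⊕ # 532 ⊗ (e≥0 ⊗ e≥0) ⊗ (r≥0 ⊗ A≥0 ⊗ P≥0))
        (solve (r ∷ e ∷ A ∷ N ∷ P ∷ K ∷ Uᵤ ∷ Uᵥ ∷ Er ∷ Yᵤ ∷ Yᵥ ∷ w ∷ p ∷ t ∷ y₂ ∷ ω ∷ y₃ ∷ []) ℚ-ring)

    balance-lo : ∀ r e A N P Q K Uᵤ Uᵥ Er Yᵤ Yᵥ w p t y₂ ω y₃ → 0ℚ ≤ r → 0ℚ ≤ e → 0ℚ ≤ A → 0ℚ ≤ N → 0ℚ ≤ P → r * Er ≤ ι 30 * (e * e) * P → Q ≡ N - P →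
      K * P - (Uᵤ + Uᵥ) + Er ≡ A * Q - w - p - t →
      P * Yᵤ ≤ r * Uᵤ + (ι 40 + ι 3) * (e * e) * P → P * Yᵥ ≤ r * Uᵥ + (ι 40 + ι 3) * (e * e) * P →
      w ≤ A * Q * y₂ + ι 120 * (e * e) * (A * Q) → p ≤ A * Q * ω + ι 120 * (e * e) * (A * Q) → t ≤ A * Q * y₃ + ι 280 * (e * e) * (A * Q) →
      P ≤ ι 2 * (r * A) * N → 0ℚ ≤ y₂ + ω + y₃ →
      r * A * N * (1ℚ - (y₂ + ω + y₃)) ≤ P * (r * K - (Yᵤ + Yᵥ) + r * A) + ι 800 * (e * e) * (r * A * N)
    balance-lo r e A N P _ K Uᵤ Uᵥ Er Yᵤ Yᵥ w p t y₂ ω y₃ r≥0 e≥0 A≥0 N≥0 P≥0 hE refl eq hu hv hw hp ht hP S≥0 =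
      certify (gap hu ⊕ gap hv ⊕ gap hE ⊕ r≥0 ⊗ gap hw ⊕ r≥0 ⊗ gap hp ⊕ r≥0 ⊗ gap ht ⊕ zero⁺ (r ⊠ eq)
          ⊕ # 116 ⊗ (e≥0 ⊗ e≥0) ⊗ gap hP ⊕ r≥0 ⊗ A≥0 ⊗ P≥0 ⊗ S≥0
          ⊕ # 48 ⊗ (e≥0 ⊗ e≥0) ⊗ (r≥0 ⊗ A≥0 ⊗ N≥0) ⊕ # 520 ⊗ (e≥0 ⊗ e≥0) ⊗ (r≥0 ⊗ A≥0 ⊗ P≥0))
        (solve (r ∷ e ∷ A ∷ N ∷ P ∷ K ∷ Uᵤ ∷ Uᵥ ∷ Er ∷ Yᵤ ∷ Yᵥ ∷ w ∷ p ∷ t ∷ y₂ ∷ ω ∷ y₃ ∷ []) ℚ-ring)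

    half≤ : ∀ e V → ι 1000 * e ≤ 1ℚ → 0ℚ ≤ e → 1ℚ - ι 11 * e ≤ V → ι 1 ≤ ι 2 * V
    half≤ e V s e≥0 h = certify (# 2 ⊗ gap h ⊕ gap s ⊕ # 978 ⊗ e≥0) (solve (e ∷ V ∷ []) ℚ-ring)

    half≤′ : ∀ e V → ι 1000 * e ≤ 1ℚ → 0ℚ ≤ e → V ≤ 1ℚ + ι 11 * e → ι 1 ≤ ι 2 * (ι 2 - V)
    half≤′ e V s e≥0 h = certify (# 2 ⊗ gap h ⊕ gap s ⊕ # 978 ⊗ e≥0) (solve (e ∷ V ∷ []) ℚ-ring)

    half≤″ : ∀ e S → ι 1000 * e ≤ 1ℚ → 0ℚ ≤ e → S ≤ ι 3 * e → ι 1 ≤ ι 2 * (1ℚ - S)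
    half≤″ e S s e≥0 h = certify (# 2 ⊗ gap h ⊕ gap s ⊕ # 994 ⊗ e≥0) (solve (e ∷ S ∷ []) ℚ-ring)

    half-nonneg : ∀ T → ι 1 ≤ ι 2 * T → 0ℚ ≤ T
    half-nonneg T h = cancel-half (ι 1) T (ℚP.≤ᵇ⇒≤ {ι 1} {ι 2 * ι 1} _)
      (cancel-half (ι 2) (ι 1 * T) (ℚP.≤ᵇ⇒≤ {ι 1} {ι 2 * ι 2} _) (certify (gap h ⊕ 0≤1) (solve (T ∷ []) ℚ-ring)))

    square≤ : ∀ e V → 1ℚ - ι 11 * e ≤ V → V ≤ 1ℚ + ι 11 * e → (V - 1ℚ) * (V - 1ℚ) ≤ ι 121 * (e * e)
    square≤ e V l u = certify (gap l ⊗ gap u) (solve (e ∷ V ∷ []) ℚ-ring)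

    -- Both parentheses of the formula are at least 1/2, so an error relative to Z becomes one
    -- relative to the full main term at the price of a factor 4.
    widen : ∀ e Z S V → 0ℚ ≤ Z → ι 1 ≤ ι 2 * (1ℚ - S) → ι 1 ≤ ι 2 * (ι 2 - V) → ι 2000 * (e * e) * Z ≤ ι 8000 * (e * e) * (Z * (1ℚ - S) * (ι 2 - V))
    widen e Z S V Z≥0 hS hV = certify (# 2000 ⊗ square≥0 e ⊗ Z≥0 ⊗ (gap hS ⊗ (# 2 ⊗ half-nonneg (ι 2 - V) hV) ⊕ gap hV)) (solve (e ∷ Z ∷ S ∷ V ∷ []) ℚ-ring)

    -- V(2 - V) = 1 - (V - 1)² lets 2 - V stand in for 1/V at a cost of 121e². Since V ≥ 1/2, an
    -- error of 2000e²Z in P is worth at least 1000e²Z in P V, which covers 800 + 121 and the small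
    -- remainder.
    ratio-up : ∀ e Z S V P → 0ℚ ≤ e → ι 1000 * e ≤ 1ℚ → 0ℚ ≤ Z → 0ℚ ≤ S → S ≤ ι 3 * e → 1ℚ - ι 11 * e ≤ V → V ≤ 1ℚ + ι 11 * e →
      P * V ≤ Z * (1ℚ - S) + ι 800 * (e * e) * Z → P ≤ Z * (1ℚ - S) * (ι 2 - V) + ι 2000 * (e * e) * Z
    ratio-up e Z S V P e≥0 s Z≥0 S≥0 S≤ lV uV h = ungap (cancel-half V _ hV (certify
        (gap h ⊕ # 1000 ⊗ (e≥0 ⊗ e≥0 ⊗ Z≥0) ⊗ gap hV ⊕ Z≥0 ⊗ half-nonneg (1ℚ - S) (half≤″ e S s e≥0 S≤) ⊗ gap (square≤ e V lV uV) ⊕ # 121 ⊗ (e≥0 ⊗ e≥0 ⊗ Z≥0 ⊗ S≥0) ⊕ # 79 ⊗ (e≥0 ⊗ e≥0 ⊗ Z≥0))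
        (solve (e ∷ Z ∷ S ∷ V ∷ P ∷ []) ℚ-ring)))
      where
      hV : ι 1 ≤ ι 2 * V
      hV = half≤ e V s e≥0 lV

    ratio-lo : ∀ e Z S V P → 0ℚ ≤ e → ι 1000 * e ≤ 1ℚ → 0ℚ ≤ Z → 0ℚ ≤ S → S ≤ ι 3 * e → 1ℚ - ι 11 * e ≤ V → V ≤ 1ℚ + ι 11 * e →
      Z * (1ℚ - S) ≤ P * V + ι 800 * (e * e) * Z → Z * (1ℚ - S) * (ι 2 - V) ≤ P + ι 2000 * (e * e) * Z
    ratio-lo e Z S V P e≥0 s Z≥0 S≥0 S≤ lV uV h = ungap (cancel-half V _ hV (certify
        (gap h ⊕ # 1000 ⊗ (e≥0 ⊗ e≥0 ⊗ Z≥0) ⊗ gap hV ⊕ Z≥0 ⊗ half-nonneg (1ℚ - S) (half≤″ e S s e≥0 S≤) ⊗ square≥0 (V - 1ℚ) ⊕ # 200 ⊗ (e≥0 ⊗ e≥0 ⊗ Z≥0))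
        (solve (e ∷ Z ∷ S ∷ V ∷ P ∷ []) ℚ-ring)))
      where
      hV : ι 1 ≤ ι 2 * V
      hV = half≤ e V s e≥0 lV

    -- Upwards only the constant 2 and A count, giving 3ε. Downwards the degrees, the neighbours in
    -- H and the two `Y` terms give 4 + 2 + 2 = 8 times ε. The coefficient 11 serves both sides.
    V-up : ∀ D r m du dv nu nv Yu Yv A → 1ℚ ≤ D → 0ℚ ≤ r → m * r ≡ 1ℚ → 0ℚ ≤ du → 0ℚ ≤ dv → 0ℚ ≤ nu → 0ℚ ≤ nv → 0ℚ ≤ Yu → 0ℚ ≤ Yv → A ≤ D * D →
      r * (m - ι 2 * (du + dv) + ι 2 - nu - nv) - (Yu + Yv) + r * A ≤ 1ℚ + ι 11 * (D * D * r)
    V-up D r m du dv nu nv Yu Yv A D≥1 r≥0 mr du≥0 dv≥0 nu≥0 nv≥0 Yu≥0 Yv≥0 A≤ =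
      certify (zero⁺ ((- 1ℚ) ⊠ mr) ⊕ # 2 ⊗ r≥0 ⊗ (du≥0 ⊕ dv≥0) ⊕ r≥0 ⊗ nu≥0 ⊕ r≥0 ⊗ nv≥0 ⊕ Yu≥0 ⊕ Yv≥0 ⊕ r≥0 ⊗ gap A≤ ⊕ # 2 ⊗ r≥0 ⊗ (gap D≥1 ⊗ D≥0 ⊕ gap D≥1) ⊕ # 8 ⊗ (D≥0 ⊗ D≥0 ⊗ r≥0))
        (solve (D ∷ r ∷ m ∷ du ∷ dv ∷ nu ∷ nv ∷ Yu ∷ Yv ∷ A ∷ []) ℚ-ring)
      where
      D≥0 : 0ℚ ≤ D
      D≥0 = ≤-trans 0≤1 D≥1

    V-lo : ∀ D r m du dv nu nv Yu Yv A → 1ℚ ≤ D → 0ℚ ≤ r → m * r ≡ 1ℚ → du ≤ D → dv ≤ D → nu ≤ D * D → nv ≤ D * D → Yu ≤ D * D * r → Yv ≤ D * D * r → 0ℚ ≤ A →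
      1ℚ - ι 11 * (D * D * r) ≤ r * (m - ι 2 * (du + dv) + ι 2 - nu - nv) - (Yu + Yv) + r * A
    V-lo D r m du dv nu nv Yu Yv A D≥1 r≥0 mr hu hv hnu hnv hYu hYv A≥0 =
      certify (zero⁺ (1ℚ ⊠ mr) ⊕ # 2 ⊗ r≥0 ⊗ (gap hu ⊕ gap hv) ⊕ r≥0 ⊗ gap hnu ⊕ r≥0 ⊗ gap hnv ⊕ gap hYu ⊕ gap hYv ⊕ r≥0 ⊗ A≥0 ⊕ # 4 ⊗ r≥0 ⊗ (gap D≥1 ⊗ D≥0) ⊕ # 2 ⊗ r≥0 ⊕ # 3 ⊗ (D≥0 ⊗ D≥0 ⊗ r≥0))
        (solve (D ∷ r ∷ m ∷ du ∷ dv ∷ nu ∷ nv ∷ Yu ∷ Yv ∷ A ∷ []) ℚ-ring)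
      where
      D≥0 : 0ℚ ≤ D
      D≥0 = ≤-trans 0≤1 D≥1

    sum≤3 : ∀ e a b c → a ≤ e → b ≤ e → c ≤ e → a + b + c ≤ ι 3 * e
    sum≤3 e a b c h k l = certify (gap h ⊕ gap k ⊕ gap l) (solve (e ∷ a ∷ b ∷ c ∷ []) ℚ-ring)

    A-ratio≤ : ∀ D r A → 0ℚ ≤ r → A ≤ D * D → r * A ≤ D * D * r
    A-ratio≤ D r A r≥0 h = certify (r≥0 ⊗ gap h) (solve (D ∷ r ∷ A ∷ []) ℚ-ring)

  module Asymptotics (D r : ℚ) {n : ℕ} (I : Instance n) (D≥1 : 1ℚ ≤ D) (r≥0 : 0ℚ ≤ r) (mr≡1 : m I * r ≡ 1ℚ) (small : ι 1000 * (D * D * r) ≤ 1ℚ)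
    (B : Bounds.Bounded D (m I) r D≥1 r≥0 mr≡1 small I 6) (u v : Fin n) (u≢v : u ≢ v) (Huv : H I u v ≡ false) where

    open LowerEstimates D (m I) r D≥1 r≥0 mr≡1 small
    open FirstOrder.Pair I B u v u≢v Huv using (A; A≥0; P; P≥0; edge-up′)
    open SwitchIdentity I u v u≢v Huv using (switch-identity)
    open Delete I u v u≢v Huv using (N-delete; R-expansion)
    open BackwardCount D r I D≥1 r≥0 mr≡1 small B u v u≢v Huv
    open ForwardCount D r I D≥1 r≥0 mr≡1 small B u v u≢v Huv using (Ends; nbr; S₀; Y; Y≥0; Y≤ε; U-up; U-lo; 𝔼L; Err≥0; Err≤)

    private
      eᵤ : Ends u v
      eᵤ = inj₁ (refl , refl)

      eᵥ : Ends v u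
      eᵥ = inj₂ (refl , refl)

    -- 1 - σ and 2 - V = 1 - φ̄ / M̃ are the two parentheses of the formula.
    σ : ℚ
    σ = r * r * M₂ + r * r * Ω + r * r * r * (M₂ * M₂)

    V : ℚ
    V = r * (S₀ - nbr u - nbr v) - (Y eᵤ + Y eᵥ) + r * A

    Z : ℚ
    Z = r * A * N I

    private
      Z≥0 : 0ℚ ≤ Z
      Z≥0 = r≥0 ⊗ A≥0 ⊗ N≥0 I

      σ≥0 : 0ℚ ≤ σ
      σ≥0 = r≥0 ⊗ r≥0 ⊗ M₂≥0 ⊕ r≥0 ⊗ r≥0 ⊗ Ω≥0 ⊕ r≥0 ⊗ r≥0 ⊗ r≥0 ⊗ (M₂≥0 ⊗ M₂≥0)

      σ≤3ε : σ ≤ ι 3 * ε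
      σ≤3ε = sum≤3 ε _ _ _ (wedge-ratio≤ D r (m I) M₂ D≥1 r≥0 mr≡1 M₂≤) (path-ratio≤ D r (m I) Ω r≥0 mr≡1 Ω≤) (tri-ratio≤ D r (m I) M₂ D≥1 r≥0 mr≡1 M₂≥0 M₂≤)

      nbr≥0 : ∀ s → 0ℚ ≤ nbr s
      nbr≥0 s = ∑-nonneg (λ x → h≥0 I s x ⊗ deg⁻≥0 I x)

      V≤ : V ≤ 1ℚ + ι 11 * ε
      V≤ = V-up D r (m I) _ _ _ _ _ _ A D≥1 r≥0 mr≡1 (deg⁻≥0 I u) (deg⁻≥0 I v) (nbr≥0 u) (nbr≥0 v) (Y≥0 eᵤ) (Y≥0 eᵥ) (deg²≤ I B u v)

      V≥ : 1ℚ - ι 11 * ε ≤ V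
      V≥ = V-lo D r (m I) _ _ _ _ _ _ A D≥1 r≥0 mr≡1 (Bounds.Bounded.deg≤ B u) (Bounds.Bounded.deg≤ B v) (∑h≤ I B u) (∑h≤ I B v) (Y≤ε eᵤ) (Y≤ε eᵥ) A≥0

      P≤2Z : P ≤ ι 2 * (r * A) * N I
      P≤2Z = ≤-trans edge-up′ (≤-resp refl (trans (cong (ι 2 *_) (sym (*-assoc r A (N I)))) (sym (*-assoc (ι 2) (r * A) (N I)))) (*-monoʳ (r≥0 ⊗ (A≥0 ⊗ N≥0 I)) (1+40ε≤2 ε ε≥0 small)))

      identity = trans (sym 𝔼L) (trans switch-identity R-expansion)

    1/2≤1-σ : ι 1 ≤ ι 2 * (1ℚ - σ)
    1/2≤1-σ = half≤″ ε σ small ε≥0 σ≤3ε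

    1/2≤2-V : ι 1 ≤ ι 2 * (ι 2 - V)
    1/2≤2-V = half≤′ ε V small ε≥0 V≤

    P-up : P ≤ Z * (1ℚ - σ) * (ι 2 - V) + ι 8000 * (ε * ε) * (Z * (1ℚ - σ) * (ι 2 - V))
    P-up = ≤-trans (ratio-up ε Z σ V P ε≥0 small Z≥0 σ≥0 σ≤3ε V≥ V≤
        (balance-up r ε A (N I) P Q _ _ _ _ _ _ _ _ _ _ _ _ r≥0 ε≥0 A≥0 (N≥0 I) P≥0 Err≥0 N-delete identity (U-up eᵤ) (U-up eᵥ) wedges-lo paths-lo triangles-lo
          P≤2Z (A-ratio≤ D r A r≥0 (deg²≤ I B u v)) σ≤3ε))
      (+-mono-≤ ≤-refl (widen ε Z σ V Z≥0 1/2≤1-σ 1/2≤2-V))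

    P-lo : Z * (1ℚ - σ) * (ι 2 - V) ≤ P + ι 8000 * (ε * ε) * (Z * (1ℚ - σ) * (ι 2 - V))
    P-lo = ≤-trans (ratio-lo ε Z σ V P ε≥0 small Z≥0 σ≥0 σ≤3ε V≥ V≤
        (balance-lo r ε A (N I) P Q _ _ _ _ _ _ _ _ _ _ _ _ r≥0 ε≥0 A≥0 (N≥0 I) P≥0 Err≤ N-delete identity (U-lo eᵤ) (U-lo eᵥ) wedges-up paths-up triangles-up
          P≤2Z σ≥0))
      (+-mono-≤ ≤-refl (widen ε Z σ V Z≥0 1/2≤1-σ 1/2≤2-V))   

-- The class of graphs of the theorem as an instance.

module GraphClass where
  open Arithmetic
  open Switching
  open Expectations
  open UpperBounds
  open EdgeChains
  open import Data.Vec using ([]; _∷_)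

  open Expectation hiding (c)

  module _ {A : Set} {p : A → Bool} where

    allB⁻ : ∀ {xs x} → allB p xs ≡ true → x ∈ xs → p x ≡ true
    allB⁻ {y ∷ xs} e (here refl) = proj₁ (∧-true⁻ e)
    allB⁻ {y ∷ xs} e (there k) = allB⁻ (proj₂ (∧-true⁻ {p y} e)) k

    allB⁺ : ∀ xs → (∀ x → p x ≡ true) → allB p xs ≡ true
    allB⁺ [] h = refl
    allB⁺ (x ∷ xs) h = ∧-true⁺ (h x) (allB⁺ xs h)

  ∈-pairs : ∀ {n} (i j : Fin n) → (i , j) ∈ pairs n
  ∈-pairs {n} i j = ∈-concatMap⁺ (λ i → map (λ j → (i , j)) (allFin n)) (lose (∈-allFin i) (∈-map⁺ (λ j → (i , j)) (∈-allFin j)))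

  opaque
    unfolding _+_ ι ⟦_⟧ sum

    ι-count : ∀ {A : Set} (p : A → Bool) xs → ι (countTrue (map p xs)) ≡ sum (λ x → ⟦ p x ⟧) xs
    ι-count p [] = refl
    ι-count p (x ∷ xs) with p x
    ... | true = trans (ι-+ 1 (countTrue (map p xs))) (cong (1ℚ +_) (ι-count p xs))
    ... | false = trans (ι-count p xs) (sym (+-identityˡ _))

    ι-sum : ∀ {n} (f : Fin n → ℕ) → ι (sumℕ f) ≡ ∑ (λ x → ι (f x))
    ι-sum {n} f = go (allFin n)
      where
      go : ∀ xs → ι (foldr ℕ._+_ 0 (map f xs)) ≡ sum (λ x → ι (f x)) xs
      go [] = refl
      go (x ∷ xs) = trans (ι-+ (f x) _) (cong (ι (f x) +_) (go xs))

  opaque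
    unfolding _+_ _*_ _-_ -_ ι ⟦_⟧

    ι-∸ : ∀ {a b} → b ℕ.≤ a → ι (a ∸ b) ≡ ι a - ι b
    ι-∸ {a} {b} h = trans (lem (ι (a ∸ b)) (ι b)) (cong (_- ι b) (trans (sym (ι-+ b (a ∸ b))) (cong ι (ℕP.m+[n∸m]≡n h))))
      where
      lem : ∀ x y → x ≡ y + x - y
      lem = solve-∀ ℚ-ring

    ι-<-absurd : ∀ {a b} → a ℕ.< b → ι b ≤ ι a → ⊥
    ι-<-absurd {a} {b} h k = 1≰0 (certify (gap (≤-trans (ι-mono h) k)) (trans (lem (ι a)) (cong (λ t → ι a - t) (sym (ι-+ 1 a)))))
      where
      1≰0 : 1ℚ ≤ 0ℚ → ⊥
      1≰0 (ℚ.*≤* (ℤ.+≤+ ()))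
      lem : ∀ x → 0ℚ - 1ℚ ≡ x - (ι 1 + x)
      lem = solve-∀ ℚ-ring

    residual-entry : ∀ g h₁ h₂ → not h₁ ∨ g ≡ true → not (h₂ ∧ g) ≡ true → ⟦ g ∧ not (h₁ ∨ h₂) ⟧ ≡ ⟦ g ⟧ - ⟦ h₁ ⟧
    residual-entry true true h₂ _ _ = refl
    residual-entry true false true _ ()
    residual-entry true false false _ _ = refl
    residual-entry false true h₂ () _
    residual-entry false false h₂ _ _ = refl

    halve : ∀ x → x + x ≡ ι 2 * x
    halve = solve-∀ ℚ-ring

    +-zero-both : ⟦ false ⟧ ≡ ⟦ false ⟧ + ⟦ false ⟧
    +-zero-both = refl

    +-true-left : ∀ b → ⟦ b ⟧ ≡ ⟦ b ⟧ + ⟦ false ⟧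
    +-true-left true = refl
    +-true-left false = refl

    +-true-right : ∀ b → ⟦ b ⟧ ≡ ⟦ false ⟧ + ⟦ b ⟧
    +-true-right true = refl
    +-true-right false = refl

  ι-injective : ∀ {a b} → ι a ≡ ι b → a ≡ b
  ι-injective {a} {b} e with ℕP.<-cmp a b
  ... | tri< k _ _ = ⊥-elim (ι-<-absurd k (≤-reflexive (sym e)))
  ... | tri≈ _ k _ = k
  ... | tri> _ _ k = ⊥-elim (ι-<-absurd k (≤-reflexive e))

  opaque
    unfolding adj

    adj≡edge : ∀ {n} (A : Adj n) i j → adj A i j ≡ edge A i j
    adj≡edge A i j = refl

    ι-deg : ∀ {n} (A : Adj n) i → ι (deg A i) ≡ ∑ (λ j → ⟦ adj A i j ⟧)
    ι-deg {n} A i = ι-count (edge A i) (allFin n)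

    adj-∪ : ∀ {n} (A B : Adj n) i j → adj (A ∪G B) i j ≡ adj A i j ∨ adj B i j
    adj-∪ {n} A B i j = rowwise A B i
      where
      cells : ∀ {m} (r s : Vec Bool m) k → lookup (zipOr r s) k ≡ lookup r k ∨ lookup s k
      cells (x ∷ r) (y ∷ s) zero = refl
      cells (x ∷ r) (y ∷ s) (suc k) = cells r s k
      rowwise : ∀ {k} (A B : Vec (Vec Bool n) k) i → lookup (lookup (unionRows A B) i) j ≡ lookup (lookup A i) j ∨ lookup (lookup B i) j
      rowwise (r ∷ A) (s ∷ B) zero = cells r s j
      rowwise (r ∷ A) (s ∷ B) (suc i) = rowwise A B i

    simple⁻ : ∀ {n} {A : Adj n} → isSimple A ≡ true → (∀ i j → adj A i j ≡ adj A j i) × (∀ i → adj A i i ≡ false)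
    simple⁻ {n} {A} e = symmetric , (λ i → not-true⁻ (allB⁻ (proj₂ (∧-true⁻ {allB _ (pairs n)} e)) (∈-allFin i)))
      where
      half : ∀ i j → not (edge A i j) ∨ edge A j i ≡ true
      half i j = allB⁻ (proj₁ (∧-true⁻ {allB _ (pairs n)} e)) (∈-pairs i j)
      symmetric : ∀ i j → edge A i j ≡ edge A j i
      symmetric i j with edge A i j | edge A j i | half i j | half j i
      ... | true | true | _ | _ = refl
      ... | false | false | _ | _ = refl

    simple⁺ : ∀ {n} {A : Adj n} → (∀ i j → adj A i j ≡ adj A j i) → (∀ i → adj A i i ≡ false) → isSimple A ≡ true
    simple⁺ {n} {A} s z = ∧-true⁺ (allB⁺ (pairs n) (λ { (i , j) → half i j })) (allB⁺ (allFin n) (λ i → cong not (z i)))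
      where
      half : ∀ i j → not (edge A i j) ∨ edge A j i ≡ true
      half i j rewrite s i j with edge A j i
      ... | true = refl
      ... | false = refl

    subgraph⁻ : ∀ {n} {A B : Adj n} → subgraph A B ≡ true → ∀ i j → not (adj A i j) ∨ adj B i j ≡ true
    subgraph⁻ e i j = allB⁻ e (∈-pairs i j)

    subgraph⁺ : ∀ {n} {A B : Adj n} → (∀ i j → not (adj A i j) ∨ adj B i j ≡ true) → subgraph A B ≡ true
    subgraph⁺ {n} h = allB⁺ (pairs n) (λ { (i , j) → h i j })

    disjoint⁻ : ∀ {n} {A B : Adj n} → disjoint A B ≡ true → ∀ i j → not (adj A i j ∧ adj B i j) ≡ true
    disjoint⁻ e i j = allB⁻ e (∈-pairs i j)

    disjoint⁺ : ∀ {n} {A B : Adj n} → (∀ i j → not (adj A i j ∧ adj B i j) ≡ true) → disjoint A B ≡ true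
    disjoint⁺ {n} h = allB⁺ (pairs n) (λ { (i , j) → h i j })

  T⇒true : ∀ {b} → 𝔹.T b → b ≡ true
  T⇒true {true} _ = refl

  true⇒T : ∀ {b} → b ≡ true → 𝔹.T b
  true⇒T refl = _

  module _ {n : ℕ} {A : Adj n} {d : Fin n → ℕ} where

    hasDegrees⁻ : hasDegrees A d ≡ true → ∀ i → deg A i ≡ d i
    hasDegrees⁻ e i = ℕP.≡ᵇ⇒≡ (deg A i) (d i) (true⇒T (allB⁻ e (∈-allFin i)))

    hasDegrees⁺ : (∀ i → deg A i ≡ d i) → hasDegrees A d ≡ true
    hasDegrees⁺ h = allB⁺ (allFin n) (λ i → T⇒true (ℕP.≡⇒≡ᵇ (deg A i) (d i) (h i)))

  module Base {n : ℕ} (d : Fin n → ℕ) (H₁ H₂ : Adj n) (S₁ : isSimple H₁ ≡ true) (S₂ : isSimple H₂ ≡ true) (deg≤d : ∀ i → deg H₁ i ℕ.≤ d i) where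

    H∪ : Fin n → Fin n → Bool
    H∪ x y = adj (H₁ ∪G H₂) x y

    class : Adj n → Bool
    class G = isSimple G ∧ hasDegrees G d ∧ condEvent H₁ H₂ G

    module Member (G : Adj n) (e : class G ≡ true) where
      private
        e₁ = proj₂ (∧-true⁻ {isSimple G} e)
        e₂ = proj₂ (∧-true⁻ {hasDegrees G d} e₁)

      G-simple : isSimple G ≡ true
      G-simple = proj₁ (∧-true⁻ {isSimple G} e)

      G-deg : ∀ i → deg G i ≡ d i
      G-deg = hasDegrees⁻ {A = G} (proj₁ (∧-true⁻ {hasDegrees G d} e₁))

      ⊇H₁ : ∀ i j → not (adj H₁ i j) ∨ adj G i j ≡ true
      ⊇H₁ = subgraph⁻ {A = H₁} {B = G} (proj₁ (∧-true⁻ {subgraph H₁ G} e₂))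

      ∩H₂ : ∀ i j → not (adj H₂ i j ∧ adj G i j) ≡ true
      ∩H₂ = disjoint⁻ {A = H₂} {B = G} (proj₂ (∧-true⁻ {subgraph H₁ G} e₂))

    open Member

    dt : Fin n → ℕ
    dt i = d i ∸ deg H₁ i

    H-symmetric : ∀ x y → H∪ x y ≡ H∪ y x
    H-symmetric x y = trans (adj-∪ H₁ H₂ x y) (trans (cong₂ _∨_ (proj₁ (simple⁻ {A = H₁} S₁) x y) (proj₁ (simple⁻ {A = H₂} S₂) x y)) (sym (adj-∪ H₁ H₂ y x)))

    -- All four toggled pairs lie outside H₁ ∪ H₂, so containing H₁ and avoiding H₂ persist;
    -- `degree-switch` keeps the degrees.
    switch-closed : ∀ G u v x y → Distinct₄ u v x y →
      H∪ u v ≡ false → H∪ x y ≡ false → H∪ u x ≡ false → H∪ v y ≡ false → class G ≡ true →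
      adj G u v ≡ true → adj G x y ≡ true → adj G u x ≡ false → adj G v y ≡ false →
      class (switch u v x y G) ≡ true
    switch-closed G u v x y D h₁ h₂ h₃ h₄ e uv xy ux vy = ∧-true⁺ (simple⁺ {A = G′} symmetric irreflexive)
        (∧-true⁺ (hasDegrees⁺ {A = G′} degrees) (∧-true⁺ (subgraph⁺ {A = H₁} {B = G′} contains) (disjoint⁺ {A = H₂} {B = G′} avoids)))
      where
      G′ = switch u v x y G
      G-sym′ = proj₁ (simple⁻ {A = G} (G-simple G e))
      open Distinct₄ D
      open Switch D G
      open Switched G-sym′ uv xy ux vy
      symmetric : ∀ a b → adj G′ a b ≡ adj G′ b a
      symmetric a b = trans (adj-switch a b) (trans (cong₂ _xor_ (cong₂ _xor_ (cong₂ _xor_ (cong₂ _xor_ (G-sym′ a b) (isE-sym v y a b)) (isE-sym u x a b)) (isE-sym x y a b)) (isE-sym u v a b))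
        (sym (adj-switch b a)))
      isE-irr : ∀ {p q} → p ≢ q → ∀ a → isE p q a a ≡ false
      isE-irr p≢q a = isE-false⁺ λ { (inj₁ (k , l)) → p≢q (trans (sym k) l) ; (inj₂ (k , l)) → p≢q (trans (sym l) k) }
      irreflexive : ∀ a → adj G′ a a ≡ false
      irreflexive a = trans (adj-away (isE-irr u≢v a) (isE-irr x≢y a) (isE-irr u≢x a) (isE-irr v≢y a)) (proj₂ (simple⁻ {A = G} (G-simple G e)) a)
      degrees : ∀ a → deg G′ a ≡ d a
      degrees a = trans (ι-injective (trans (ι-deg G′ a) (trans (degree-switch a) (sym (ι-deg G a))))) (G-deg G e a)
      same : ∀ {a b} → H∪ a b ≡ true → adj G′ a b ≡ adj G a b
      same {a} {b} k = adj-away (off h₁) (off h₂) (off h₃) (off h₄)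
        where
        off : ∀ {p q} → H∪ p q ≡ false → isE p q a b ≡ false
        off {p} {q} h = isE-false⁺ λ { (inj₁ (refl , refl)) → true≢false k h ; (inj₂ (refl , refl)) → true≢false (trans (H-symmetric p q) k) h }
      contains : ∀ a b → not (adj H₁ a b) ∨ adj G′ a b ≡ true
      contains a b with adj H₁ a b in k | ⊇H₁ G e a b
      ... | false | _ = refl
      ... | true | g = trans (same (trans (adj-∪ H₁ H₂ a b) (cong (_∨ adj H₂ a b) k))) g
      avoids : ∀ a b → not (adj H₂ a b ∧ adj G′ a b) ≡ true
      avoids a b with adj H₂ a b in k | ∩H₂ G e a b
      ... | false | _ = refl
      ... | true | g = trans (cong not (same (trans (adj-∪ H₁ H₂ a b) (trans (cong (adj H₁ a b ∨_) k) (∨-zeroʳ _))))) g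

    base : Instance n
    base = record
      { w = class
      ; H = H∪
      ; d = dt
      ; H-sym = H-symmetric
      ; H-irr = λ x → trans (adj-∪ H₁ H₂ x x) (cong₂ _∨_ (proj₂ (simple⁻ {A = H₁} S₁) x) (proj₂ (simple⁻ {A = H₂} S₂) x))
      ; G-sym = λ G e → proj₁ (simple⁻ {A = G} (G-simple G e))
      ; G-irr = λ G e → proj₂ (simple⁻ {A = G} (G-simple G e))
      ; rows = λ G e x → trans (sum-cong (allFin n) (λ y → trans (cong (λ t → ⟦ adj G x y ∧ not t ⟧) (adj-∪ H₁ H₂ x y)) (residual-entry (adj G x y) (adj H₁ x y) (adj H₂ x y) (⊇H₁ G e x y) (∩H₂ G e x y))))
          (trans (∑-- _ _) (trans (cong₂ _-_ (trans (sym (ι-deg G x)) (cong ι (G-deg G e x))) (sym (ι-deg H₁ x))) (sym (ι-∸ (deg≤d x)))))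
      ; switchable = switch-closed
      }

    N≡ : N base ≡ ι (condCount n d H₁ H₂)
    N≡ = trans (sum-cong (allAdj n) (λ G → *-identityʳ ⟦ class G ⟧)) (sym (ι-count class (allAdj n)))

    P≡ : ∀ u v → H∪ u v ≡ false → 𝔼 base (λ G → b base G u v) ≡ ι (countGraphs n d (λ G → condEvent H₁ H₂ G ∧ edge G u v))
    P≡ u v Huv = trans (sum-cong (allAdj n) (λ G → trans (cong (⟦ class G ⟧ *_) (trans (b≡a base G Huv) (cong ⟦_⟧ (adj≡edge G u v))))
        (trans (sym (⟦∧⟧ (class G) (edge G u v))) (cong ⟦_⟧ (trans (∧-assoc (isSimple G) _ (edge G u v)) (cong (isSimple G ∧_) (∧-assoc (hasDegrees G d) _ (edge G u v))))))))
      (sym (ι-count (λ G → isSimple G ∧ hasDegrees G d ∧ (condEvent H₁ H₂ G ∧ edge G u v)) (allAdj n)))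

    m≡ : m base ≡ ι (sumℕ dt)
    m≡ = sym (ι-sum dt)

    handshake : ι (sumℕ (deg H₁)) ≡ ι 2 * ι (numEdges H₁)
    handshake = trans (ι-sum (deg H₁)) (trans (∑-cong (ι-deg H₁)) (trans (∑∑-cong split) (trans (∑∑-+ _ _)
        (trans (cong₂ _+_ (sym count) (trans (∑∑-swap _) (trans (∑∑-cong (λ x y → cong (λ t → ⟦ (toℕ x ℕ.<ᵇ toℕ y) ∧ t ⟧) (proj₁ (simple⁻ {A = H₁} S₁) y x))) (sym count))))
          (halve _)))))
      where
      up : Fin n → Fin n → Bool
      up x y = (toℕ x ℕ.<ᵇ toℕ y) ∧ adj H₁ x y
      count : ι (numEdges H₁) ≡ ∑∑ (λ x y → ⟦ up x y ⟧)
      count = trans (ι-count _ (pairs n)) (trans (sum-pairs _) (∑∑-cong (λ x y → cong (λ t → ⟦ (toℕ x ℕ.<ᵇ toℕ y) ∧ t ⟧) (sym (adj≡edge H₁ x y)))))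
      split : ∀ x y → ⟦ adj H₁ x y ⟧ ≡ ⟦ up x y ⟧ + ⟦ (toℕ y ℕ.<ᵇ toℕ x) ∧ adj H₁ x y ⟧
      split x y with ℕP.<-cmp (toℕ x) (toℕ y)
      ... | tri< k _ k′ rewrite T⇒true (ℕP.<⇒<ᵇ k) | ¬true (λ e → k′ (ℕP.<ᵇ⇒< (toℕ y) (toℕ x) (true⇒T e))) = +-true-left _
      ... | tri> k′ _ k rewrite T⇒true (ℕP.<⇒<ᵇ k) | ¬true (λ e → k′ (ℕP.<ᵇ⇒< (toℕ x) (toℕ y) (true⇒T e))) = +-true-right _
      ... | tri≈ _ k _ with FP.toℕ-injective k
      ...   | refl rewrite proj₂ (simple⁻ {A = H₁} S₁) x | ∧-zeroʳ (toℕ x ℕ.<ᵇ toℕ x) = +-zero-both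

    -- By the handshake identity the denominator M - 2|H₁| under φ̄ is M̃ again, so the whole
    -- formula uses the single reciprocal r.
    residual-total : ι (sumℕ dt) ≡ ι (sumℕ d) - ι 2 * ι (numEdges H₁)
    residual-total = trans (ι-sum dt) (trans (∑-cong (λ x → ι-∸ (deg≤d x))) (trans (∑-- _ _) (cong₂ _-_ (sym (ι-sum d)) (trans (sym (ι-sum (deg H₁))) handshake))))

    hdeg-base≤ : ∀ x → ∑ (h base x) ≤ ι (deg H₁ x) + ι (deg H₂ x)
    hdeg-base≤ x = ≤-trans (∑-mono (λ y → ≤-trans (≤-reflexive (cong ⟦_⟧ (adj-∪ H₁ H₂ x y))) (⟦∨⟧-≤ (adj H₁ x y) (adj H₂ x y))))
      (≤-reflexive (trans (∑-+ _ _) (cong₂ _+_ (sym (ι-deg H₁ x)) (sym (ι-deg H₂ x)))))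

  maxOf-≥ : ∀ {n} (f : Fin n → ℕ) x → f x ℕ.≤ maxOf f
  maxOf-≥ {n} f x = go (∈-allFin x)
    where
    go : ∀ {xs} → x ∈ xs → f x ℕ.≤ foldr ℕ._⊔_ 0 (map f xs)
    go {y ∷ xs} (here refl) = ℕP.m≤m⊔n (f x) _
    go {y ∷ xs} (there k) = ℕP.≤-trans (go k) (ℕP.m≤n⊔m (f y) _)

  sumℕ-≤ : ∀ {n} (f : Fin n → ℕ) K → (∀ x → f x ℕ.≤ K) → sumℕ f ℕ.≤ n ℕ.* K
  sumℕ-≤ {n} f K h = subst (λ t → sumℕ f ℕ.≤ t ℕ.* K) (length-tabulate (id {A = Fin n})) (go (allFin n))
    where
    go : ∀ xs → foldr ℕ._+_ 0 (map f xs) ℕ.≤ length xs ℕ.* K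
    go [] = z≤n
    go (x ∷ xs) = ℕP.+-mono-≤ (h x) (go xs)

  sumℕ-≥ : ∀ {n} (f : Fin n → ℕ) x → f x ℕ.≤ sumℕ f
  sumℕ-≥ {n} f x = go (∈-allFin x)
    where
    go : ∀ {xs} → x ∈ xs → f x ℕ.≤ foldr ℕ._+_ 0 (map f xs)
    go {y ∷ xs} (here refl) = ℕP.m≤m+n (f x) _
    go {y ∷ xs} (there k) = ℕP.≤-trans (go k) (ℕP.m≤n+m _ (f y)) 

-- The closed formula and its constants.

module Formula where
  open Arithmetic
  open Switching
  open Expectations
  open UpperBounds
  open EdgeChains
  open LowerBounds
  open BackwardSwitchings
  open ForwardSwitchings
  open Balance
  open GraphClass

  open Expectation hiding (c)

  opaque
    unfolding _+_ _*_ _-_ -_ ι ⟦_⟧ sum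

    -- Reciprocals come as witnesses with p i = 1, so that divisions in the formula become products
    -- accessible to the ring solver.
    inverse : ∀ p → 0ℚ < p → Σ ℚ λ i → 0ℚ < i × p * i ≡ 1ℚ
    inverse p p>0 = ℚ.1/ p , ℚP.positive⁻¹ _ {{ℚP.1/pos⇒pos p {{pos}}}} , ℚP.*-inverseʳ p
      where
      instance
        pos : ℚ.Positive p
        pos = ℚ.positive p>0
        nz : ℚ.NonZero p
        nz = ℚP.pos⇒nonZero p

    ÷′-≡ : ∀ p q i → q * i ≡ 1ℚ → p ÷' q ≡ p * i
    ÷′-≡ p q i e with q ℚP.≟ 0ℚ
    ... | yes refl = ⊥-elim (0≢1 (trans (sym (ℚP.*-zeroˡ i)) e))
      where
      0≢1 : 0ℚ ≢ 1ℚ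
      0≢1 ()
    ... | no q≢0 = cong (p ℚ.*_) (trans (sym (ℚP.*-identityʳ 1/q)) (trans (cong (1/q ℚ.*_) (sym e))
          (trans (sym (ℚP.*-assoc 1/q q i)) (trans (cong (ℚ._* i) (ℚP.*-inverseˡ q {{ℚ.≢-nonZero q≢0}})) (ℚP.*-identityˡ i)))))
      where
      1/q : ℚ
      1/q = (ℚ.1/ q) {{ℚ.≢-nonZero q≢0}}

    0÷′ : ∀ q → 0ℚ ÷' q ≡ 0ℚ
    0÷′ q with q ℚP.≟ 0ℚ
    ... | yes _ = refl
    ... | no q≢0 = ℚP.*-zeroˡ ((ℚ.1/ q) {{ℚ.≢-nonZero q≢0}})

    ÷′-nonneg : ∀ p q → 0ℚ ≤ p → 0ℚ ≤ q → 0ℚ ≤ p ÷' q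
    ÷′-nonneg p q p≥0 q≥0 with q ℚP.≟ 0ℚ
    ... | yes _ = ≤-refl
    ... | no q≢0 = p≥0 ⊗ ℚP.<⇒≤ (ℚP.positive⁻¹ _ {{ℚP.1/pos⇒pos q {{pos}}}})
      where
      pos : ℚ.Positive q
      pos = ℚ.positive (ℚP.≰⇒> (λ h → q≢0 (≤-antisym h q≥0)))

    if-⟦⟧ : ∀ b x → (if b then x else 0ℚ) ≡ ⟦ b ⟧ * x
    if-⟦⟧ true x = sym (ℚP.*-identityˡ x)
    if-⟦⟧ false x = sym (ℚP.*-zeroˡ x)

    abs≤ : ∀ E k → E ≤ k → - E ≤ k → ℚ.∣ E ∣ ≤ k
    abs≤ E k h h′ = [ (λ e → subst (_≤ k) (sym e) h) , (λ e → subst (_≤ k) (sym e) h′) ]′ (ℚP.∣p∣≡p∨∣p∣≡-p E)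

    0<1 : 0ℚ < 1ℚ
    0<1 = ℚP.positive⁻¹ 1ℚ

    pos-* : ∀ {a b} → 0ℚ < a → 0ℚ < b → 0ℚ < a * b
    pos-* {a} {b} h k = ℚP.positive⁻¹ _ {{ℚP.pos*pos⇒pos a {{ℚ.positive h}} b {{ℚ.positive k}}}}

    pos-+ : ∀ {a b} → 0ℚ < a → 0ℚ ≤ b → 0ℚ < a + b
    pos-+ = ℚP.+-mono-<-≤

    pos-from : ∀ {p q} → 0ℚ < p → p ≤ ι 4 * q → 0ℚ < q
    pos-from {p} {q} p>0 h = ℚP.≰⇒> (λ k → ℚP.<-irrefl refl (ℚP.<-≤-trans p>0 (≤-trans h (lem k))))
      where
      lem : q ≤ 0ℚ → ι 4 * q ≤ 0ℚ
      lem k = certify (# 4 ⊗ gap k) (solve (q ∷ []) ℚ-ring)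

    error-up : ∀ k N P T iN iT → 0ℚ ≤ iN → 0ℚ ≤ iT → N * iN ≡ 1ℚ → T * iT ≡ 1ℚ → P ≤ N * T + k * (N * T) → P * iN * iT - 1ℚ ≤ k
    error-up k N P T iN iT a b e f h = certify (a ⊗ b ⊗ gap h ⊕ zero⁺ ((- ((1ℚ + k) * (T * iT))) ⊠ e) ⊕ zero⁺ ((- (1ℚ + k)) ⊠ f)) (solve (k ∷ N ∷ P ∷ T ∷ iN ∷ iT ∷ []) ℚ-ring)

    error-lo : ∀ k N P T iN iT → 0ℚ ≤ iN → 0ℚ ≤ iT → N * iN ≡ 1ℚ → T * iT ≡ 1ℚ → N * T ≤ P + k * (N * T) → - (P * iN * iT - 1ℚ) ≤ k
    error-lo k N P T iN iT a b e f h = certify (a ⊗ b ⊗ gap h ⊕ zero⁺ (((1ℚ - k) * (T * iT)) ⊠ e) ⊕ zero⁺ ((1ℚ - k) ⊠ f)) (solve (k ∷ N ∷ P ∷ T ∷ iN ∷ iT ∷ []) ℚ-ring)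

    error-recover : ∀ P T iN iT → T * iT ≡ 1ℚ → P * iN ≡ (1ℚ + (P * iN * iT - 1ℚ)) * T
    error-recover P T iN iT f = equate ((- (P * iN)) ⊠ f) (solve (P ∷ T ∷ iN ∷ iT ∷ []) ℚ-ring)

    D≥1-arith : ∀ C x → 0ℚ ≤ C → 1ℚ ≤ x → 1ℚ ≤ (C + ι 7) * x
    D≥1-arith C x C≥0 h = certify ((C≥0 ⊕ # 7) ⊗ gap h ⊕ (C≥0 ⊕ # 6)) (solve (C ∷ x ∷ []) ℚ-ring)

    D≥Δ-arith : ∀ C x → 0ℚ ≤ C → 0ℚ ≤ x → x ≤ (C + ι 7) * x
    D≥Δ-arith C x C≥0 h = certify ((C≥0 ⊕ # 6) ⊗ h) (solve (C ∷ x ∷ []) ℚ-ring)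

    -- Origin of C + 7: H₁ contributes at most Δ, H₂ at most CΔ, and the budget 6 at most 6Δ because
    -- Δ ≥ 1.
    hdeg-bound-arith : ∀ C x a b → 1ℚ ≤ x → a ≤ x → b ≤ C * x → a + b + ι 6 ≤ (C + ι 7) * x
    hdeg-bound-arith C x a b h ha hb = certify (gap ha ⊕ gap hb ⊕ # 6 ⊗ gap h) (solve (C ∷ x ∷ a ∷ b ∷ []) ℚ-ring)

    small-arith : ∀ κ c i x M m r → 0ℚ ≤ r → ι 1000 * (κ * κ) * i ≡ 1ℚ → m * r ≡ 1ℚ → x * x ≤ c * i * M → c * M ≤ m →
      ι 1000 * ((κ * x) * (κ * x) * r) ≤ 1ℚ
    small-arith κ c i x M m r r≥0 e f h k = certify (# 1000 ⊗ square≥0 κ ⊗ r≥0 ⊗ gap h ⊕ zero⁺ ((- (c * M * r)) ⊠ e) ⊕ r≥0 ⊗ gap k ⊕ zero⁺ ((- 1ℚ) ⊠ f)) (solve (κ ∷ c ∷ i ∷ x ∷ M ∷ m ∷ r ∷ []) ℚ-ring)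

    -- `step₁` replaces 1/M̃ by 1/(cM), and `step₂` inserts the factor Δn/M ≥ 1. The resulting
    -- constant is 8000κ⁴/c².
    scale-arith : ∀ κ c j x M m r R ν → 0ℚ ≤ κ → 0ℚ ≤ x → 0ℚ ≤ r → 0ℚ ≤ R → 0ℚ ≤ j → c * j ≡ 1ℚ → M * R ≡ 1ℚ → m * r ≡ 1ℚ → c * M ≤ m → M ≤ ν * x →
      ι 8000 * (((κ * x) * (κ * x) * r) * ((κ * x) * (κ * x) * r)) ≤ ι 8000 * (κ * κ * (κ * κ)) * (j * j) * (x * x * x * x * x * ν * (R * R * R))
    scale-arith κ c j x M m r R ν κ≥0 x≥0 r≥0 R≥0 j≥0 e f g h k = ≤-trans step₁ step₂
      where
      r≤ : r ≤ j * R
      r≤ = certify (j≥0 ⊗ R≥0 ⊗ r≥0 ⊗ gap h ⊕ zero⁺ ((- (j * R)) ⊠ g) ⊕ zero⁺ ((r * (M * R)) ⊠ e) ⊕ zero⁺ (r ⊠ f)) (solve (c ∷ j ∷ M ∷ m ∷ r ∷ R ∷ []) ℚ-ring)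
      step₁ : ι 8000 * (((κ * x) * (κ * x) * r) * ((κ * x) * (κ * x) * r)) ≤ ι 8000 * (κ * κ * (κ * κ)) * (x * x * x * x) * ((j * R) * (j * R))
      step₁ = certify (# 8000 ⊗ (κ≥0 ⊗ κ≥0 ⊗ (κ≥0 ⊗ κ≥0)) ⊗ (x≥0 ⊗ x≥0 ⊗ x≥0 ⊗ x≥0) ⊗ ((gap r≤) ⊗ (j≥0 ⊗ R≥0 ⊕ r≥0))) (solve (κ ∷ j ∷ x ∷ r ∷ R ∷ []) ℚ-ring)
      step₂ : ι 8000 * (κ * κ * (κ * κ)) * (x * x * x * x) * ((j * R) * (j * R)) ≤ ι 8000 * (κ * κ * (κ * κ)) * (j * j) * (x * x * x * x * x * ν * (R * R * R))
      step₂ = certify (# 8000 ⊗ (κ≥0 ⊗ κ≥0 ⊗ (κ≥0 ⊗ κ≥0)) ⊗ (j≥0 ⊗ j≥0) ⊗ (x≥0 ⊗ x≥0 ⊗ x≥0 ⊗ x≥0 ⊗ (R≥0 ⊗ R≥0 ⊗ R≥0)) ⊗ gap k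
            ⊕ zero⁺ ((ι 8000 * (κ * κ * (κ * κ)) * (j * j) * (x * x * x * x) * (R * R)) ⊠ f)) (solve (κ ∷ j ∷ x ∷ M ∷ R ∷ ν ∷ []) ℚ-ring)

    -- The leading part m r of V is 1, so 2 - V equals 1 - r φ̄. The equations for gu and gv hold
    -- because both residual degrees are positive, so d - 1 is not truncated.
    V-arith : ∀ m r du dv nu nv gu gv M A → m * r ≡ 1ℚ → gu ≡ du - 1ℚ → gv ≡ dv - 1ℚ →
      1ℚ - ((((- (ι 2 * (du + dv)) + ι 2) - nu) - nv) - ((du + dv) - ι 2) * M * r + A) * r ≡
      ι 2 - (r * (m - ι 2 * (du + dv) + ι 2 - nu - nv) - (r * (r * gu * M) + r * (r * gv * M)) + r * A)
    V-arith m r du dv nu nv _ _ M A e refl refl = equate (1ℚ ⊠ e) (solve (m ∷ r ∷ du ∷ dv ∷ nu ∷ nv ∷ M ∷ A ∷ []) ℚ-ring)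

    main-arith : ∀ A r M Ω T → (A * r) * (((1ℚ - M * M * (r * r * r)) - M * (r * r)) - Ω * (r * r)) * T ≡ r * A * (1ℚ - (r * r * M + r * r * Ω + r * r * r * (M * M))) * T
    main-arith = solve-∀ ℚ-ring

    cubes : ∀ m r → m * r ≡ 1ℚ → m * m * m * (r * r * r) ≡ 1ℚ
    cubes m r e = equate ((m * r * (m * r) + m * r + 1ℚ) ⊠ e) (solve (m ∷ r ∷ []) ℚ-ring)

    squares : ∀ m r → m * r ≡ 1ℚ → m * m * (r * r) ≡ 1ℚ
    squares m r e = equate ((m * r + 1ℚ) ⊠ e) (solve (m ∷ r ∷ []) ℚ-ring)

    ι-cube : ∀ k → ι (k ℕ.^ 3) ≡ ι k * ι k * ι k
    ι-cube k = trans (ι-* k _) (trans (cong (ι k *_) (trans (ι-* k _) (cong (ι k *_) (ι-* k 1)))) (lem (ι k)))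
      where
      lem : ∀ x → x ℚ.* (x ℚ.* (x ℚ.* 1ℚ)) ≡ x ℚ.* x ℚ.* x
      lem = solve-∀ ℚ-ring

    ι-fifth : ∀ k → ι (k ℕ.^ 5) ≡ ι k * ι k * ι k * ι k * ι k
    ι-fifth k = trans (ι-* k _) (trans (cong (ι k *_) (trans (ι-* k _) (cong (ι k *_) (trans (ι-* k _) (cong (ι k *_) (trans (ι-* k _) (cong (ι k *_) (ι-* k 1)))))))) (lem (ι k)))
      where
      lem : ∀ x → x ℚ.* (x ℚ.* (x ℚ.* (x ℚ.* (x ℚ.* 1ℚ)))) ≡ x ℚ.* x ℚ.* x ℚ.* x ℚ.* x
      lem = solve-∀ ℚ-ring

    -- Keeps the main term at or above r/4, hence positive, so that the relative error can be
    -- defined as a quotient by it.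
    MT-lower-arith : ∀ r A S T → 0ℚ ≤ r → 1ℚ ≤ A → ι 1 ≤ ι 2 * S → ι 1 ≤ ι 2 * T → r ≤ ι 4 * (r * A * S * T)
    MT-lower-arith r A S T r≥0 hA hS hT = certify (r≥0 ⊗ gap hA ⊕ r≥0 ⊗ A≥0 ⊗ gap hS ⊕ # 2 ⊗ (r≥0 ⊗ A≥0 ⊗ half-nonneg S hS) ⊗ gap hT) (solve (r ∷ A ∷ S ∷ T ∷ []) ℚ-ring)
      where
      A≥0 : 0ℚ ≤ A
      A≥0 = ≤-trans 0≤1 hA

    MT-assoc : ∀ r A N S T → r * A * N * S * T ≡ N * (r * A * S * T)
    MT-assoc = solve-∀ ℚ-ring

  ≡ᵇ-== : ∀ {n} (x y : Fin n) → (toℕ x ℕ.≡ᵇ toℕ y) ≡ (x == y)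
  ≡ᵇ-== x y with x FP.≟ y
  ... | yes refl = trans (T⇒true (ℕP.≡⇒≡ᵇ (toℕ x) (toℕ x) refl)) (sym (==-refl x))
  ... | no h = trans (¬true (λ e → h (FP.toℕ-injective (ℕP.≡ᵇ⇒≡ (toℕ x) (toℕ y) (true⇒T e))))) (sym (==-≢ h))

  module Shape {n : ℕ} (d : Fin n → ℕ) (H₁ H₂ : Adj n) (u v : Fin n) (r : ℚ) where
    private
      module Qs = Quantities d H₁ H₂ u v

    nbrs : Fin n → ℚ
    nbrs s = ∑ λ x → ⟦ adj (H₁ ∪G H₂) s x ⟧ * ι (Qs.dt x)

    opaque
      unfolding _+_ _*_ _-_ -_ ι ⟦_⟧ sum adj

      mainTerm-shape : ι Qs.Mt * r ≡ 1ℚ → (ι Qs.M - ι 2 * ι (numEdges H₁)) * r ≡ 1ℚ →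
        Qs.mainTerm ≡ (ι (Qs.dt u) * ι (Qs.dt v) * r) * (((1ℚ - ι Qs.Mt₂ * ι Qs.Mt₂ * (r * r * r)) - ι Qs.Mt₂ * (r * r)) - Qs.Wsum) * (1ℚ - Qs.φbar * r)
      mainTerm-shape e f = cong₂ ℚ._*_ (cong₂ ℚ._*_ (÷′-≡ _ (ι Qs.Mt) r e) (cong (ℚ._- Qs.Wsum) (cong₂ ℚ._-_
          (cong (λ t → 1ℚ ℚ.- t) (÷′-≡ _ (ι Qs.Mt * ι Qs.Mt * ι Qs.Mt) (r * r * r) (cubes (ι Qs.Mt) r e))) (÷′-≡ _ (ι Qs.Mt * ι Qs.Mt) (r * r) (squares (ι Qs.Mt) r e)))))
        (cong (λ t → 1ℚ ℚ.- t) (÷′-≡ Qs.φbar (ι Qs.M - ι 2 * ι (numEdges H₁)) r f))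

      nbrSum-shape : ∀ s → Qs.nbrSum s ≡ nbrs s
      nbrSum-shape s = sum-cong (allFin n) (λ x → if-⟦⟧ (edge Qs.H s x) (Qs.qdt x))

      φbar-shape : ι Qs.Mt * r ≡ 1ℚ → Qs.φbar ≡ (((- (ι 2 * (ι (Qs.dt u) + ι (Qs.dt v))) + ι 2) - nbrs u) - nbrs v) - ((ι (Qs.dt u) + ι (Qs.dt v)) - ι 2) * ι Qs.Mt₂ * r + ι (Qs.dt u) * ι (Qs.dt v)
      φbar-shape e = cong (ℚ._+ (Qs.qdt u ℚ.* Qs.qdt v)) (cong₂ ℚ._-_ (cong₂ ℚ._-_ (cong (λ t → ((- (ι 2 * (ι (Qs.dt u) + ι (Qs.dt v)))) ℚ.+ ι 2) ℚ.- t) (nbrSum-shape u)) (nbrSum-shape v)) (÷′-≡ _ (ι Qs.Mt) r e))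

      Wsum-shape : ι Qs.Mt * r ≡ 1ℚ → Qs.Wsum ≡ (∑∑ λ x y → ⟦ Qs.inW (x , y) ⟧ * (ι (Qs.dt x) * ι (Qs.dt y))) * (r * r)
      Wsum-shape e = trans (sum-pairs {n} Wterm) (trans (∑∑-cong (λ x y → trans (if-⟦⟧ (Qs.inW (x , y)) _)
          (trans (cong (⟦ Qs.inW (x , y) ⟧ ℚ.*_) (÷′-≡ _ (ι Qs.Mt * ι Qs.Mt) (r * r) (squares (ι Qs.Mt) r e))) (sym (*-assoc ⟦ Qs.inW (x , y) ⟧ _ (r * r))))))
        (trans (∑-cong (λ x → ∑-*ʳ (r * r) (λ y → ⟦ Qs.inW (x , y) ⟧ * (ι (Qs.dt x) * ι (Qs.dt y))))) (∑-*ʳ (r * r) (λ x → ∑ λ y → ⟦ Qs.inW (x , y) ⟧ * (ι (Qs.dt x) * ι (Qs.dt y))))))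
        where
        Wterm : Fin n × Fin n → ℚ
        Wterm p = if Qs.inW p then (Qs.qdt (proj₁ p) ℚ.* Qs.qdt (proj₂ p)) ÷' (ι Qs.Mt ℚ.* ι Qs.Mt) else 0ℚ

      inW-shape : ∀ x y → Qs.inW (x , y) ≡ adj (H₁ ∪G H₂) x y ∧ (not (adj (H₁ ∪G H₂) x u) ∧ (not (adj (H₁ ∪G H₂) y v) ∧ (not (x == u) ∧ (not (x == v) ∧ (not (y == u) ∧ not (y == v))))))
      inW-shape x y rewrite ≡ᵇ-== x u | ≡ᵇ-== x v | ≡ᵇ-== y u | ≡ᵇ-== y v = refl   

-- Assembly for the given degree sequence.

module Conclusion where
  open Arithmetic
  open Switching
  open Expectations
  open UpperBounds
  open EdgeChains
  open LowerBounds
  open BackwardSwitchings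
  open ForwardSwitchings
  open Balance
  open GraphClass
  open Formula

  open Expectation hiding (c; H)

  opaque
    unfolding _+_ _*_ _-_ -_ ι ⟦_⟧ sum adj

    condProb-shape : ∀ {n} (d : Fin n → ℕ) H₁ H₂ u v iN → ι (condCount n d H₁ H₂) * iN ≡ 1ℚ →
      condProb n d H₁ H₂ u v ≡ ι (countGraphs n d (λ G → condEvent H₁ H₂ G ∧ edge G u v)) * iN
    condProb-shape d H₁ H₂ u v iN e = ÷′-≡ _ (ι (condCount _ d H₁ H₂)) iN e

    condProb-zero : ∀ {n} (d : Fin n → ℕ) H₁ H₂ u v → ι (countGraphs n d (λ G → condEvent H₁ H₂ G ∧ edge G u v)) ≡ 0ℚ → condProb n d H₁ H₂ u v ≡ 0ℚ
    condProb-zero {n} d H₁ H₂ u v e = trans (cong (_÷' ℕtoℚ (condCount n d H₁ H₂)) e) (0÷′ (ℕtoℚ (condCount n d H₁ H₂)))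

    mainTerm-zero : ∀ {n} (d : Fin n → ℕ) H₁ H₂ u v → let open Quantities d H₁ H₂ u v in ι (dt u) * ι (dt v) ≡ 0ℚ → mainTerm ≡ 0ℚ
    mainTerm-zero d H₁ H₂ u v e = trans (cong (λ t → t ℚ.* rest ℚ.* last) (trans (cong (_÷' ℕtoℚ Qs.Mt) e) (0÷′ (ℕtoℚ Qs.Mt)))) (trans (cong (ℚ._* last) (ℚP.*-zeroˡ rest)) (ℚP.*-zeroˡ last))
      where
      module Qs = Quantities d H₁ H₂ u v
      rest last : ℚ
      rest = ((1ℚ ℚ.- (Qs.q Qs.Mt₂ ℚ.* Qs.q Qs.Mt₂) ÷' (Qs.q Qs.Mt ℚ.* Qs.q Qs.Mt ℚ.* Qs.q Qs.Mt)) ℚ.- Qs.q Qs.Mt₂ ÷' (Qs.q Qs.Mt ℚ.* Qs.q Qs.Mt)) ℚ.- Qs.Wsum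
      last = 1ℚ ℚ.- Qs.φbar ÷' (Qs.q Qs.M ℚ.- Qs.q 2 ℚ.* Qs.q (numEdges H₁))

    errorScale-shape : ∀ {n} (d : Fin n → ℕ) H₁ H₂ u v R → let open Quantities d H₁ H₂ u v in ι M * R ≡ 1ℚ →
      errorScale ≡ ι Δ * ι Δ * ι Δ * ι Δ * ι Δ * ι n * (R * R * R)
    errorScale-shape {n} d H₁ H₂ u v R e = trans (÷′-≡ _ (ι (Qs.M ℕ.^ 3)) (R * R * R) (trans (cong (_* (R * R * R)) (ι-cube Qs.M)) (cubes (ι Qs.M) R e)))
      (cong (λ t → t * ι n * (R * R * R)) (ι-fifth Qs.Δ))
      where
      module Qs = Quantities d H₁ H₂ u v

    errorScale≥0 : ∀ {n} (d : Fin n → ℕ) H₁ H₂ u v → 0ℚ ≤ Quantities.errorScale d H₁ H₂ u v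
    errorScale≥0 {n} d H₁ H₂ u v = ÷′-nonneg _ _ (# (Qs.Δ ℕ.^ 5) ⊗ # n) (# (Qs.M ℕ.^ 3))
      where
      module Qs = Quantities d H₁ H₂ u v

    no-error : ∀ X Y K s → X ≡ 0ℚ → Y ≡ 0ℚ → 0ℚ ≤ K → 0ℚ ≤ s → (ℚ.∣ 0ℚ ∣ ≤ K * s) × X ≡ (1ℚ + 0ℚ) * Y
    no-error _ _ K s refl refl K≥0 s≥0 = K≥0 ⊗ s≥0 , refl

    m≥-arith : ∀ m → m + ι 2 * ι 6 ≤ m + ι 12
    m≥-arith m = ≤-refl

    0<ι : ∀ {k} → 1 ℕ.≤ k → 0ℚ < ι k
    0<ι h = ℚP.<-≤-trans 0<1 (ι-mono h)

    1≤A-arith : ∀ x y → 1ℚ ≤ x → 1ℚ ≤ y → 1ℚ ≤ x * y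
    1≤A-arith x y h k = certify (gap h ⊕ (0≤1 ⊕ gap h) ⊗ gap k) (solve (x ∷ y ∷ []) ℚ-ring)

  module Core (C c i j : ℚ) (C≥0 : 0ℚ ≤ C) (j≥0 : 0ℚ ≤ j) (e₁ : ι 1000 * ((C + ι 7) * (C + ι 7)) * i ≡ 1ℚ) (e₂ : c * j ≡ 1ℚ)
    {n : ℕ} (d : Fin n → ℕ) (H₁ H₂ : Adj n) (u v : Fin n) (S₁ : isSimple H₁ ≡ true) (S₂ : isSimple H₂ ≡ true)
    (deg≤d : ∀ x → deg H₁ x ℕ.≤ d x)
    (Δ²≤ : ι (maxOf d) * ι (maxOf d) ≤ c * i * ι (sumℕ d)) (maxH₂≤ : ι (maxDeg H₂) ≤ C * ι (maxOf d))
    (M≤ : c * ι (sumℕ d) ≤ ι (Quantities.Mt d H₁ H₂ u v)) (u≢v : u ≢ v) (Huv : adj (H₁ ∪G H₂) u v ≡ false)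
    (nonempty : 1 ℕ.≤ condCount n d H₁ H₂) where

    open Quantities d H₁ H₂ u v using (M; Δ; Mt; dt; mainTerm; errorScale)
    open Base d H₁ H₂ S₁ S₂ deg≤d using (base; N≡; P≡; m≡; residual-total; hdeg-base≤)

    κ K : ℚ
    κ = C + ι 7
    K = ι 8000 * (κ * κ * (κ * κ)) * (j * j)

    κ≥0 : 0ℚ ≤ κ
    κ≥0 = C≥0 ⊕ # 7

    K≥0 : 0ℚ ≤ K
    K≥0 = # 8000 ⊗ (κ≥0 ⊗ κ≥0 ⊗ (κ≥0 ⊗ κ≥0)) ⊗ (j≥0 ⊗ j≥0)

    Estimate : Set
    Estimate = Σ ℚ λ E → (ℚ.∣ E ∣ ≤ K * errorScale) × condProb n d H₁ H₂ u v ≡ (1ℚ + E) * mainTerm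

    P : ℚ
    P = 𝔼 base (λ G → b base G u v)

    -- An end of residual degree 0 has no free edge, so the probability and the main term are both
    -- 0, and the error 0 serves. With the convention x / 0 = 0 this includes M̃ = 0.
    isolated : ι (dt u) ≡ 0ℚ ⊎ ι (dt v) ≡ 0ℚ → Estimate
    isolated z = 0ℚ , no-error _ _ _ _ (condProb-zero d H₁ H₂ u v (trans (sym (P≡ u v Huv)) (trans (𝔼-cong base (λ G wG → zero-edge G wG z)) (𝔼-0 base))))
        (mainTerm-zero d H₁ H₂ u v (product-zero z)) K≥0 (errorScale≥0 d H₁ H₂ u v)
      where
      product-zero : ι (dt u) ≡ 0ℚ ⊎ ι (dt v) ≡ 0ℚ → ι (dt u) * ι (dt v) ≡ 0ℚ
      product-zero (inj₁ e) = trans (cong (_* ι (dt v)) e) (*-zeroˡ _)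
      product-zero (inj₂ e) = trans (cong (ι (dt u) *_) e) (*-zeroʳ _)
      bounded : ∀ G → w base G ≡ true → ∀ x y → ι (dt x) ≡ 0ℚ → b base G x y ≡ 0ℚ
      bounded G wG x y e = ≤-antisym (≤-resp refl (trans (row-sum base G wG x) e) (∑-single≤ (b base G x) (b≥0 base G x) y)) (b≥0 base G x y)
      zero-edge : ∀ G → w base G ≡ true → ι (dt u) ≡ 0ℚ ⊎ ι (dt v) ≡ 0ℚ → b base G u v ≡ 0ℚ
      zero-edge G wG (inj₁ e) = bounded G wG u v e
      zero-edge G wG (inj₂ e) = trans (b-sym base G wG u v) (bounded G wG v u e)

    module _ (du≥1 : 1 ℕ.≤ dt u) (dv≥1 : 1 ℕ.≤ dt v) where

      private
        1≤ι : ∀ {k} → 1 ℕ.≤ k → 1ℚ ≤ ι k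
        1≤ι h = ≤-resp ι1 refl (ι-mono h)

        d≤Δ : ∀ x → ι (d x) ≤ ι Δ
        d≤Δ x = ι-mono (maxOf-≥ d x)

        dt≤Δ : ∀ x → ι (dt x) ≤ ι Δ
        dt≤Δ x = ≤-trans (ι-mono (ℕP.m∸n≤m (d x) (deg H₁ x))) (d≤Δ x)

        Δ≥1 : 1ℚ ≤ ι Δ
        Δ≥1 = ≤-trans (1≤ι du≥1) (dt≤Δ u)

        D : ℚ
        D = κ * ι Δ

        D≥1 : 1ℚ ≤ D
        D≥1 = D≥1-arith C (ι Δ) C≥0 Δ≥1

        M≥1 : 1 ℕ.≤ M
        M≥1 = ℕP.≤-trans du≥1 (ℕP.≤-trans (ℕP.m∸n≤m (d u) (deg H₁ u)) (sumℕ-≥ d u))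

        Mt≥1 : 1 ℕ.≤ Mt
        Mt≥1 = ℕP.≤-trans du≥1 (sumℕ-≥ dt u)

        r-inv = inverse (ι Mt) (0<ι Mt≥1)
        R-inv = inverse (ι M) (0<ι M≥1)
        N-inv = inverse (ι (condCount n d H₁ H₂)) (0<ι nonempty)

        r R iN : ℚ
        r = proj₁ r-inv
        R = proj₁ R-inv
        iN = proj₁ N-inv

        r>0 : 0ℚ < r
        r>0 = proj₁ (proj₂ r-inv)

        r≥0 : 0ℚ ≤ r
        r≥0 = ℚP.<⇒≤ r>0

        Mt*r≡1 : ι Mt * r ≡ 1ℚ
        Mt*r≡1 = proj₂ (proj₂ r-inv)

        mr≡1 : m base * r ≡ 1ℚ
        mr≡1 = trans (cong (_* r) m≡) Mt*r≡1

        small : ι 1000 * (D * D * r) ≤ 1ℚ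
        small = small-arith κ c i (ι Δ) (ι M) (ι Mt) r r≥0 e₁ Mt*r≡1 Δ²≤ M≤

        bounded : Bounds.Bounded D (m base) r D≥1 r≥0 mr≡1 small base 6
        bounded = record
          { deg≤ = λ x → ≤-trans (dt≤Δ x) (D≥Δ-arith C (ι Δ) C≥0 (# Δ))
          ; hdeg≤ = λ x → ≤-trans (+-mono-≤ (hdeg-base≤ x) ≤-refl) (hdeg-bound-arith C (ι Δ) _ _ Δ≥1
              (≤-trans (ι-mono (deg≤d x)) (d≤Δ x)) (≤-trans (ι-mono (maxOf-≥ (deg H₂) x)) maxH₂≤))
          ; m≤ = ≤-refl
          ; m≥ = m≥-arith (m base)
          }

        open Asymptotics D r base D≥1 r≥0 mr≡1 small bounded u v u≢v Huv using (σ; V; 1/2≤1-σ; 1/2≤2-V; P-up; P-lo)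
        open BackwardCount D r base D≥1 r≥0 mr≡1 small bounded u v u≢v Huv using (M₂; Ω; W)
        open Shape d H₁ H₂ u v r

        A : ℚ
        A = ι (dt u) * ι (dt v)

        main : ℚ
        main = r * A * (1ℚ - σ) * (ι 2 - V)

        Mt₂≡ : ι (Quantities.Mt₂ d H₁ H₂ u v) ≡ M₂
        Mt₂≡ = trans (ι-sum _) (∑-cong (λ x → ι-* (dt x) (dt x ∸ 1)))

        Wsum≡ : Quantities.Wsum d H₁ H₂ u v ≡ Ω * (r * r)
        Wsum≡ = trans (Wsum-shape Mt*r≡1) (cong (_* (r * r)) (∑∑-cong (λ x y → cong (λ t → ⟦ t ⟧ * (ι (dt x) * ι (dt y))) (inW-shape x y))))

        pred≡ : ∀ x → 1 ℕ.≤ dt x → ι (dt x ∸ 1) ≡ ι (dt x) - 1ℚ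
        pred≡ x h = trans (ι-∸ h) (cong (λ t → ι (dt x) - t) ι1)

        factor≡ : 1ℚ - Quantities.φbar d H₁ H₂ u v * r ≡ ι 2 - V
        factor≡ = trans (cong (λ t → 1ℚ - t * r) (trans (φbar-shape Mt*r≡1) (cong (λ t → (((- (ι 2 * (ι (dt u) + ι (dt v))) + ι 2) - nbrs u) - nbrs v) - ((ι (dt u) + ι (dt v)) - ι 2) * t * r + A) Mt₂≡)))
          (V-arith (m base) r (ι (dt u)) (ι (dt v)) (nbrs u) (nbrs v) (ι (dt u ∸ 1)) (ι (dt v ∸ 1)) M₂ A mr≡1 (pred≡ u du≥1) (pred≡ v dv≥1))

        mainTerm≡ : mainTerm ≡ main
        mainTerm≡ = trans (mainTerm-shape Mt*r≡1 (trans (cong (_* r) (sym residual-total)) Mt*r≡1))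
          (trans (cong₂ _*_ (cong₂ (λ s t → A * r * (((1ℚ - s * s * (r * r * r)) - s * (r * r)) - t)) Mt₂≡ Wsum≡) factor≡) (main-arith A r M₂ Ω (ι 2 - V)))

        main>0 : 0ℚ < main
        main>0 = pos-from r>0 (MT-lower-arith r A (1ℚ - σ) (ι 2 - V) r≥0 (1≤A-arith _ _ (1≤ι du≥1) (1≤ι dv≥1)) 1/2≤1-σ 1/2≤2-V)

        main-inv = inverse main main>0

        iT : ℚ
        iT = proj₁ main-inv

        iT≥0 : 0ℚ ≤ iT
        iT≥0 = ℚP.<⇒≤ (proj₁ (proj₂ main-inv))

        iN≥0 : 0ℚ ≤ iN
        iN≥0 = ℚP.<⇒≤ (proj₁ (proj₂ N-inv))

        R≥0 : 0ℚ ≤ R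
        R≥0 = ℚP.<⇒≤ (proj₁ (proj₂ R-inv))

        NiN : N base * iN ≡ 1ℚ
        NiN = trans (cong (_* iN) N≡) (proj₂ (proj₂ N-inv))

        TiT : main * iT ≡ 1ℚ
        TiT = proj₂ (proj₂ main-inv)

        k : ℚ
        k = ι 8000 * ((D * D * r) * (D * D * r))

        Z≡ : r * A * N base * (1ℚ - σ) * (ι 2 - V) ≡ N base * main
        Z≡ = MT-assoc r A (N base) (1ℚ - σ) (ι 2 - V)

        k≤ : k ≤ K * errorScale
        k≤ = ≤-trans (scale-arith κ c j (ι Δ) (ι M) (ι Mt) r R (ι n) κ≥0 (# Δ) r≥0 R≥0 j≥0 e₂ (proj₂ (proj₂ R-inv)) Mt*r≡1 M≤
            (≤-trans (ι-mono (sumℕ-≤ d Δ (maxOf-≥ d))) (≤-reflexive (ι-* n Δ))))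
          (≤-reflexive (cong (K *_) (sym (errorScale-shape d H₁ H₂ u v R (proj₂ (proj₂ R-inv))))))

        E : ℚ
        E = P * iN * iT - 1ℚ

      -- The error is the quotient of the probability by the main term, minus 1; `P-up` and `P-lo`,
      -- divided by the class size and the main term, bound it from both sides.
      connected : Estimate
      connected = E , abs≤ E _ (≤-trans (error-up k (N base) P main iN iT iN≥0 iT≥0 NiN TiT (≤-resp refl (cong (λ t → t + k * t) Z≡) P-up)) k≤)
                               (≤-trans (error-lo k (N base) P main iN iT iN≥0 iT≥0 NiN TiT (≤-resp Z≡ (cong (λ t → P + k * t) Z≡) P-lo)) k≤)
        , trans (condProb-shape d H₁ H₂ u v iN (proj₂ (proj₂ N-inv)))
            (trans (cong (_* iN) (sym (P≡ u v Huv))) (trans (error-recover P main iN iT TiT) (cong ((1ℚ + E) *_) (sym mainTerm≡))))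

    estimate : Estimate
    estimate = split (dt u) (dt v) refl refl
      where
      split : ∀ a b → dt u ≡ a → dt v ≡ b → Estimate
      split zero _ e _ = isolated (inj₁ (trans (cong ι e) ι0))
      split (suc _) zero _ e = isolated (inj₂ (trans (cong ι e) ι0))
      split (suc _) (suc _) e f = connected (subst (1 ℕ.≤_) (sym e) (s≤s z≤n)) (subst (1 ℕ.≤_) (sym f) (s≤s z≤n))

  opaque
    unfolding _+_ _*_ _-_ -_ ι ⟦_⟧ sum adj

    edge-probability :
      (C c : ℚ) → 0ℚ < C → 0ℚ < c →
      Σ ℚ λ K → Σ ℚ λ δ → Σ ℕ λ n₀ → 0ℚ < δ ×
      ((n : ℕ) → n₀ ℕ.≤ n →
       (d : Fin n → ℕ) (H₁ H₂ : Adj n) (u v : Fin n) →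
       let open Quantities d H₁ H₂ u v in
       2 ∣ M →
       ℕtoℚ (Δ ℕ.* Δ) ≤ δ ℚ.* ℕtoℚ M →
       IsSimple H₁ → IsSimple H₂ →
       𝔹.T (disjoint H₁ H₂) →
       ((i : Fin n) → deg H₁ i ℕ.≤ d i) →
       ℕtoℚ (maxDeg H₂) ≤ C ℚ.* ℕtoℚ Δ →
       c ℚ.* ℕtoℚ M ≤ ℕtoℚ Mt →
       u ≢ v →
       edge H u v ≡ false →
       0 ℕ.< condCount n d H₁ H₂ →
       Σ ℚ λ E → (ℚ.∣ E ∣ ≤ K ℚ.* errorScale) ×
         (condProb n d H₁ H₂ u v ≡ (1ℚ ℚ.+ E) ℚ.* mainTerm))
    -- `c * i` is c/(1000κ²): from Δ² ≤ δM and cM ≤ M̃ it gives 1000(κΔ)² ≤ M̃, the smallness that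
    -- the estimates ask for with D = κΔ. All smallness is carried by this choice of δ.
    edge-probability C c C>0 c>0 = K , c * i , 0 , pos-* c>0 i>0 , λ n _ d H₁ H₂ u v _ Δ²≤ S₁ S₂ _ deg≤d maxH₂≤ M≤ u≢v Huv nonempty →
        Core.estimate C c i j C≥0 j≥0 i-inv j-inv d H₁ H₂ u v (T⇒true S₁) (T⇒true S₂) deg≤d
          (subst (_≤ c * i * ι (sumℕ d)) (ι-* (maxOf d) (maxOf d)) Δ²≤) maxH₂≤ M≤ u≢v Huv nonempty
      where
      C≥0 : 0ℚ ≤ C
      C≥0 = ℚP.<⇒≤ C>0
      κ : ℚ
      κ = C + ι 7
      κ>0 : 0ℚ < κ
      κ>0 = pos-+ C>0 (# 7)
      i-data : Σ ℚ λ i → 0ℚ < i × ι 1000 * (κ * κ) * i ≡ 1ℚ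
      i-data = inverse (ι 1000 * (κ * κ)) (pos-* (0<ι {1000} (s≤s z≤n)) (pos-* κ>0 κ>0))
      j-data : Σ ℚ λ j → 0ℚ < j × c * j ≡ 1ℚ
      j-data = inverse c c>0
      i j K : ℚ
      i = proj₁ i-data
      j = proj₁ j-data
      K = ι 8000 * (κ * κ * (κ * κ)) * (j * j)
      i>0 : 0ℚ < i
      i>0 = proj₁ (proj₂ i-data)
      i-inv : ι 1000 * (κ * κ) * i ≡ 1ℚ
      i-inv = proj₂ (proj₂ i-data)
      j≥0 : 0ℚ ≤ j
      j≥0 = ℚP.<⇒≤ (proj₁ (proj₂ j-data))
      j-inv : c * j ≡ 1ℚ
      j-inv = proj₂ (proj₂ j-data) 

open import Data.Bool using (T)
open import Data.Rational using (_*_; _+_; ∣_∣)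

theorem2p4 : (C c : ℚ) → 0ℚ < C → 0ℚ < c →
    Σ ℚ λ K → Σ ℚ λ δ → Σ ℕ λ n₀ → 0ℚ < δ ×
    ((n : ℕ) → n₀ ℕ.≤ n →
    (d : Fin n → ℕ) (H₁ H₂ : Adj n) (u v : Fin n) →
    let open Quantities d H₁ H₂ u v in
    2 ∣ M →
    ℕtoℚ (Δ ℕ.* Δ) ≤ δ * ℕtoℚ M →
    IsSimple H₁ → IsSimple H₂ →
    T (disjoint H₁ H₂) →
    ((i : Fin n) → deg H₁ i ℕ.≤ d i) →
    ℕtoℚ (maxDeg H₂) ≤ C * ℕtoℚ Δ →
    c * ℕtoℚ M ≤ ℕtoℚ Mt →
    u ≢ v →
    edge H u v ≡ false →
    0 ℕ.< condCount n d H₁ H₂ →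
    Σ ℚ λ E → (∣ E ∣ ≤ K * errorScale) ×
    (condProb n d H₁ H₂ u v ≡ (1ℚ + E) * mainTerm))
theorem2p4 = Conclusion.edge-probability
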